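{- Let $d \ge 2$ and $k \ge 2$ be fixed integers. For every $\epsilon > 0$, there is a deterministic algorithm solving $(d,\le k)$-CSP in time $O^*\left(\left(\frac{d(k-1)}{k}+\epsilon\right)^n\right)$, where $n$ is the number of variables of the input formula.
   Context: Let $V=\{x_1,\dots,x_n\}$ be a set of $n$ variables, each of which can take a value in $\{1,\dots,d\}$. A literal is an expression $(x_i \ne c)$ with $c\in\{1,\dots,d\}$; a constraint is a disjunction of literals; a CSP formula is a conjunction of constraints. A $(d,\le k)$-CSP formula is a CSP formula whose variables take values in $\{1,\dots,d\}$ and in which each constraint has at most $k$ literals. An assignment $\alpha : V\to\{1,\dots,d\}$ satisfies the literal $(x_i\ne c)$ if $\alpha(x_i)\ne c$, satisfies a constraint if it satisfies at least one of its literals, and satisfies a CSP formula if it satisfies every constraint in it. $(d,\le k)$-CSP is the problem of deciding whether a given $(d,\le k)$-CSP formula has a satisfying assignment. $O^*$ suppresses factors polynomial in $n$; $d$, $k$ and $\epsilon$ are constants, and the algorithm may depend on them. -}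

module Defs where

open import Data.Bool using (Bool; true; false)
open import Data.Fin using (Fin; zero; suc; toℕ)
open import Data.Integer using (+_)
open import Data.List using (List; []; _∷_; length)
open import Data.List.Relation.Unary.All using (All)
open import Data.List.Relation.Unary.Any using (Any)
open import Data.List.Relation.Unary.Unique.Propositional using (Unique)
open import Data.Nat using (ℕ; zero; suc; _+_; _*_; _^_; _≤_)
open import Data.Product using (_×_; _,_; ∃₂; ∃-syntax)
open import Data.Rational as ℚ using (ℚ)
open import Data.Vec using (Vec; []; _∷_; lookup)
open import Relation.Binary.PropositionalEquality using (_≡_; _≢_; refl)
open import Relation.Nullary using (Reflects)

------------------------------------------------------------------------
-- Constraint satisfaction

-- The pair (i , c) stands for the literal "xᵢ ≠ c".
Literal : ℕ → ℕ → Set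
Literal d n = Fin n × Fin d

Constraint : ℕ → ℕ → Set
Constraint d n = List (Literal d n)

-- A formula is a set of constraints, so the list has no repetitions. Without
-- this, no bound in terms of n alone could hold: reading the input would
-- already take time unbounded in n.
record CSP (d k n : ℕ) : Set where
  field
    constraints : List (Constraint d n)
    distinct    : Unique constraints
    width       : All (λ C → length C ≤ k) constraints

open CSP public

Assignment : ℕ → ℕ → Set
Assignment d n = Fin n → Fin d

module _ {d n : ℕ} (α : Assignment d n) where

  SatisfiesLiteral : Literal d n → Set
  SatisfiesLiteral (i , c) = α i ≢ c

  SatisfiesConstraint : Constraint d n → Set
  SatisfiesConstraint = Any SatisfiesLiteral

  Satisfies : ∀ {k} → CSP d k n → Set
  Satisfies F = All SatisfiesConstraint (constraints F)

Satisfiable : ∀ {d k n} → CSP d k n → Set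
Satisfiable F = ∃[ α ] Satisfies α F

------------------------------------------------------------------------
-- Model of computation: a first-order call-by-value language over binary
-- trees (in the style of N. D. Jones' language F), each rule having unit
-- cost. Trees are only ever built by consing and taken apart by matching, so
-- with trees as shared pointer structures each rule takes O(1) RAM operations.
-- As the addresses have O(log (t + input size)) bits, the overhead at running
-- times t exponential in n is polynomial in n.

infixr 5 _∙_

data Tree : Set where
  nil : Tree
  _∙_ : Tree → Tree → Tree

-- Expressions over p unary functions with m variables in scope (de Bruijn:
-- the innermost binding is `zero`).
data Exp (p m : ℕ) : Set where
  var    : Fin m → Exp p m
  quoted : Tree → Exp p m
  cons   : Exp p m → Exp p m → Exp p m
  letIn  : Exp p m → Exp p (suc m) → Exp p m
  -- caseOf e e₁ e₂ : e₁ is used on nil; e₂ on l ∙ r, with l as variable 0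
  -- and r as variable 1
  caseOf : Exp p m → Exp p m → Exp p (suc (suc m)) → Exp p m
  call   : Fin p → Exp p m → Exp p m

Bodies : ℕ → Set
Bodies p = Vec (Exp p 1) p

-- The functions may call each other recursively; function 0 is the entry.
record Program : Set where
  constructor program
  field
    others : ℕ
    bodies : Bodies (suc others)

infix 3 _,_⊢_⇓_∣_

-- B , ρ ⊢ e ⇓ v ∣ t : in environment ρ, e evaluates to v at cost t.
data _,_⊢_⇓_∣_ {p} (B : Bodies p) {m} (ρ : Vec Tree m) :
               Exp p m → Tree → ℕ → Set where

  var    : ∀ {x} →
           B , ρ ⊢ var x ⇓ lookup ρ x ∣ 1

  quoted : ∀ {v} →
           B , ρ ⊢ quoted v ⇓ v ∣ 1

  cons   : ∀ {e₁ e₂ v₁ v₂ t₁ t₂} →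
           B , ρ ⊢ e₁ ⇓ v₁ ∣ t₁ →
           B , ρ ⊢ e₂ ⇓ v₂ ∣ t₂ →
           B , ρ ⊢ cons e₁ e₂ ⇓ v₁ ∙ v₂ ∣ suc (t₁ + t₂)

  letIn  : ∀ {e₁ e₂ v₁ v t₁ t₂} →
           B , ρ ⊢ e₁ ⇓ v₁ ∣ t₁ →
           B , v₁ ∷ ρ ⊢ e₂ ⇓ v ∣ t₂ →
           B , ρ ⊢ letIn e₁ e₂ ⇓ v ∣ suc (t₁ + t₂)

  case-nil : ∀ {e e₁ e₂ v t₁ t₂} →
           B , ρ ⊢ e ⇓ nil ∣ t₁ →
           B , ρ ⊢ e₁ ⇓ v ∣ t₂ →
           B , ρ ⊢ caseOf e e₁ e₂ ⇓ v ∣ suc (t₁ + t₂)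

  case-∙ : ∀ {e e₁ e₂ l r v t₁ t₂} →
           B , ρ ⊢ e ⇓ l ∙ r ∣ t₁ →
           B , l ∷ r ∷ ρ ⊢ e₂ ⇓ v ∣ t₂ →
           B , ρ ⊢ caseOf e e₁ e₂ ⇓ v ∣ suc (t₁ + t₂)

  call   : ∀ {f e u v t₁ t₂} →
           B , ρ ⊢ e ⇓ u ∣ t₁ →
           B , u ∷ [] ⊢ lookup B f ⇓ v ∣ t₂ →
           B , ρ ⊢ call f e ⇓ v ∣ suc (t₁ + t₂)

Runs : Program → (input output : Tree) (cost : ℕ) → Set
Runs (program _ B) u v t = B , u ∷ [] ⊢ lookup B zero ⇓ v ∣ t

⇓-deterministic : ∀ {p} {B : Bodies p} {m} {ρ : Vec Tree m} {e v v′ t t′} →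
                  B , ρ ⊢ e ⇓ v ∣ t → B , ρ ⊢ e ⇓ v′ ∣ t′ →
                  v ≡ v′ × t ≡ t′
⇓-deterministic var var = refl , refl
⇓-deterministic quoted quoted = refl , refl
⇓-deterministic (cons a b) (cons a′ b′)
  with refl , refl ← ⇓-deterministic a a′
  with refl , refl ← ⇓-deterministic b b′ = refl , refl
⇓-deterministic (letIn a b) (letIn a′ b′)
  with refl , refl ← ⇓-deterministic a a′
  with refl , refl ← ⇓-deterministic b b′ = refl , refl
⇓-deterministic (case-nil a b) (case-nil a′ b′)
  with refl , refl ← ⇓-deterministic a a′
  with refl , refl ← ⇓-deterministic b b′ = refl , refl
⇓-deterministic (case-nil a b) (case-∙ a′ b′)
  with () , _ ← ⇓-deterministic a a′
⇓-deterministic (case-∙ a b) (case-nil a′ b′)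
  with () , _ ← ⇓-deterministic a a′
⇓-deterministic (case-∙ a b) (case-∙ a′ b′)
  with refl , refl ← ⇓-deterministic a a′
  with refl , refl ← ⇓-deterministic b b′ = refl , refl
⇓-deterministic (call a b) (call a′ b′)
  with refl , refl ← ⇓-deterministic a a′
  with refl , refl ← ⇓-deterministic b b′ = refl , refl

------------------------------------------------------------------------
-- Input and output encodings

-- Unary: the tree for n has size linear in n.
encodeℕ : ℕ → Tree
encodeℕ zero    = nil
encodeℕ (suc n) = nil ∙ encodeℕ n

encodeList : ∀ {A : Set} → (A → Tree) → List A → Tree
encodeList f []       = nil
encodeList f (x ∷ xs) = f x ∙ encodeList f xs

encodeLiteral : ∀ {d n} → Literal d n → Tree
encodeLiteral (i , c) = encodeℕ (toℕ i) ∙ encodeℕ (toℕ c)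

encodeCSP : ∀ {d k n} → CSP d k n → Tree
encodeCSP {n = n} F =
  encodeℕ n ∙ encodeList (encodeList encodeLiteral) (constraints F)

encodeBool : Bool → Tree
encodeBool false = nil
encodeBool true  = nil ∙ nil

------------------------------------------------------------------------
-- Solving within a time bound

-- T bounds the running time in the number n of variables.
SolvesCSP : (d k : ℕ) → Program → (T : ℕ → ℕ) → Set
SolvesCSP d k P T =
  ∀ {n} (F : CSP d k n) →
  ∃₂ λ answer t →
    Runs P (encodeCSP F) (encodeBool answer) t ×
    Reflects (Satisfiable F) answer ×
    t ≤ T n

fromℕ : ℕ → ℚ
fromℕ n = + n ℚ./ 1

infix 4 _∈O*_

-- T(n) ≤ p(n) · g(n) for a polynomial p; it suffices to let p range over
-- a (1 + n) ^ b, as these dominate all polynomials on ℕ.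
_∈O*_ : (ℕ → ℕ) → (ℕ → ℚ) → Set
T ∈O* g = ∃₂ λ a b → ∀ n → fromℕ (T n) ℚ.≤ fromℕ (a * suc n ^ b) ℚ.* g n

module Submission where

-- Schöning's random walk, derandomized as by Moser and Scheder. A variable gets a
-- current value c and the alternative value c + 1 mod d; a random c makes the
-- solution agree with c with probability 1 / d, and with the alternative with
-- probability 1 / d. On blocks of constant length b this randomness is replaced by
-- a greedily built covering code with a fixed number r of alternatives per block.
-- Weighing an alternative by 1 / β, where β = u / v is slightly above k - 1, the
-- code costs (d β / (β + 1))^b if the subsequent search for a solution at distance
-- R costs β^R.
--
-- That search collects disjoint violated clauses. Each of them has a literal in
-- which the solution takes the alternative value. If there are t such clauses, the
-- choices of literals are words over k letters, and it suffices to try a covering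
-- code of radius s: a try flips t - s variables rightly and s wrongly, which brings
-- the distance down by Δ = t - 2 s, and there are at most β^Δ / 2 tries. If there
-- are fewer than t, all their variables are fixed in all possible ways, at constant
-- cost; from then on every violated clause contains a fixed variable, so branching
-- on the other k - 1 literals and fixing the variable flipped takes (k - 1)^R steps.

open import Defs
import Algebra.Definitions.RawSemiring
open import Data.Bool using (Bool; true; false; not; if_then_else_)
open import Data.Empty using (⊥; ⊥-elim)
open import Data.Fin as Fin using (Fin; zero; suc; toℕ; fromℕ<)
open import Data.Fin.Properties as Fin using (toℕ<n; toℕ-fromℕ<; fromℕ<-toℕ; toℕ-injective)
import Data.Integer as ℤ
import Data.Integer.Properties as ℤ
open import Data.List as List using (List; []; _∷_; _++_; length; map; foldr; take; drop; replicate; upTo; applyUpTo; cartesianProductWith; filterᵇ)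
open import Data.List.Membership.Propositional using (_∈_)
open import Data.List.Membership.Propositional.Properties using (∈-upTo⁺; ∈-upTo⁻; ∈-cartesianProductWith⁺; ∈-cartesianProductWith⁻; ∈-lookup)
open import Data.List.Properties using (length-map; length-++; length-take; length-drop; length-upTo; length-applyUpTo; length-replicate; map-upTo; ++-assoc; ++-identityʳ; take++drop≡id)
open import Data.List.Relation.Binary.Pointwise using (Pointwise; []; _∷_)
open import Data.List.Relation.Unary.All as All using (All; []; _∷_)
import Data.List.Relation.Unary.All.Properties as All
open import Data.List.Relation.Unary.AllPairs using (AllPairs; []; _∷_)
open import Data.List.Relation.Unary.Any as Any using (Any; here; there)
import Data.List.Relation.Unary.Any.Properties as Any
open import Data.List.Relation.Unary.Unique.Propositional using (Unique)
open import Data.Nat as ℕ using (ℕ; NonZero)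
open import Data.Nat.Coprimality using (Coprime)
open import Data.Nat.DivMod using (m/n*n≤m; m*n/n≡m; m≡m%n+[m/n]*n; m%n<n; /-monoˡ-≤)
open import Data.Nat.Properties
open import Data.Nat.Tactic.RingSolver using (solve-∀)
open import Data.Product using (∃-syntax; ∃₂; _×_; _,_; proj₁; proj₂)
open import Data.Rational as ℚ using (ℚ; mkℚ; toℚᵘ)
import Data.Rational.Properties as ℚ
open import Data.Rational.Unnormalised as ℚᵘ using (mkℚᵘ)
import Data.Rational.Unnormalised.Properties as ℚᵘ
open import Data.Sum using (_⊎_; inj₁; inj₂)
open import Data.Unit using (tt)
open import Data.Vec using (Vec; []; _∷_; lookup)
open import Function using (_∘_; id; const)
open import Relation.Binary.PropositionalEquality using (_≡_; _≢_; refl; sym; trans; cong; cong₂; subst; subst₂; module ≡-Reasoning)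
open import Relation.Nullary using (yes; no; contradiction; Reflects; ofʸ; ofⁿ)

-- Two equations determine the numbers. At β = k - 1 the rate d β / (β + 1) equals d (k - 1) / k, so
-- β may exceed k - 1 only by as much as ε permits. A code of length t and radius s over k letters
-- has roughly (k / (1 + (k - 1) / β^2))^t β^(-2 s) words, and this falls exponentially below β^(t -
-- 2 s) exactly if k β < β^2 + (k - 1), that is, (β - 1) (β - (k - 1)) > 0: this is why β must lie
-- strictly above k - 1. In both cases the strict gap, raised to a large constant power, swallows
-- the polynomial overhead of the greedy code. The codes therefore depend on d, k and ε alone and
-- are written out in the program.
--
-- The averaging that yields a code also decides its radius: r and s come from a pigeonhole over the
-- terms of a binomial expansion and cannot be prescribed. The weights 1 / β and 1 / β^2 make every
-- outcome good enough: a larger radius is paid for by a smaller code.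
--
-- β is the fraction u / v with u = (k - 1) v + 1. The estimates are multiplied out in natural
-- numbers; rationals enter only in the comparison with the final rate.

module Algorithm where

  open import Data.Nat

  -- Inequalities between powers

  ^-distribʳ-* : ∀ x y n → (x * y) ^ n ≡ x ^ n * y ^ n
  ^-distribʳ-* x y zero    = refl
  ^-distribʳ-* x y (suc n) = trans (cong (x * y *_) (^-distribʳ-* x y n)) (eq x y (x ^ n) (y ^ n))
    where
    eq : ∀ x y a b → x * y * (a * b) ≡ x * a * (y * b)
    eq = solve-∀

  1≤^ : ∀ {x} n → 1 ≤ x → 1 ≤ x ^ n
  1≤^ {suc x} n _ = m^n>0 (suc x) n

  -- Bernoulli's inequality for 1 + y / x, multiplied by x^(j + 1) so that no division occurs.
  bernoulli : ∀ x y j → x ^ j * (x + j * y) ≤ x * (x + y) ^ j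
  bernoulli x y zero    = ≤-reflexive (eq x)
    where
    eq : ∀ x → 1 * (x + 0) ≡ x * 1
    eq = solve-∀
  bernoulli x y (suc j) = begin
    x * x ^ j * (x + (y + j * y))                           ≤⟨ m≤m+n _ (x ^ j * (j * y * y)) ⟩
    x * x ^ j * (x + (y + j * y)) + x ^ j * (j * y * y)     ≡⟨ eq₁ x y j (x ^ j) ⟩
    (x + y) * (x ^ j * (x + j * y))                         ≤⟨ *-monoʳ-≤ (x + y) (bernoulli x y j) ⟩
    (x + y) * (x * (x + y) ^ j)                             ≡⟨ eq₂ x y ((x + y) ^ j) ⟩
    x * ((x + y) * (x + y) ^ j)                             ∎
    where
    open ≤-Reasoning
    eq₁ : ∀ x y j a → x * a * (x + (y + j * y)) + a * (j * y * y) ≡ (x + y) * (a * (x + j * y))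
    eq₁ = solve-∀
    eq₂ : ∀ x y a → (x + y) * (x * a) ≡ x * ((x + y) * a)
    eq₂ = solve-∀

  -- Once the exponent reaches x / y, Bernoulli's bound 1 + (1 + j) y / x is at least 2. This
  -- quantifies how fast a ratio above 1 grows; it serves both to beat polynomials and to end the
  -- greedy cover.
  doubling : ∀ x y j → x ≤ suc j * y → 2 * x ^ suc j ≤ (x + y) ^ suc j
  doubling zero    y j _ = z≤n
  doubling x@(suc _) y j h = *-cancelˡ-≤ x (begin
    x * (2 * x ^ suc j)           ≡⟨ eq x (x ^ suc j) ⟩
    x ^ suc j * (x + x)           ≤⟨ *-monoʳ-≤ (x ^ suc j) (+-monoʳ-≤ x h) ⟩
    x ^ suc j * (x + suc j * y)   ≤⟨ bernoulli x y (suc j) ⟩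
    x * (x + y) ^ suc j           ∎)
    where
    open ≤-Reasoning
    eq : ∀ x a → x * (2 * a) ≡ a * (x + x)
    eq = solve-∀

  doubling-^ : ∀ x y j l → x ≤ suc j * y → 2 ^ l * x ^ (suc j * l) ≤ (x + y) ^ (suc j * l)
  doubling-^ x y j l h = begin
    2 ^ l * x ^ (suc j * l)     ≡⟨ cong (2 ^ l *_) (sym (^-*-assoc x (suc j) l)) ⟩
    2 ^ l * (x ^ suc j) ^ l     ≡⟨ sym (^-distribʳ-* 2 (x ^ suc j) l) ⟩
    (2 * x ^ suc j) ^ l         ≤⟨ ^-monoˡ-≤ l (doubling x y j h) ⟩
    ((x + y) ^ suc j) ^ l       ≡⟨ ^-*-assoc (x + y) (suc j) l ⟩
    (x + y) ^ (suc j * l)       ∎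
    where open ≤-Reasoning

  n<2^n : ∀ n → n < 2 ^ n
  n<2^n zero    = s≤s z≤n
  n<2^n (suc n) = begin-strict
    suc n             ≤⟨ n<2^n n ⟩
    2 ^ n             <⟨ m<m+n (2 ^ n) (m^n>0 2 n) ⟩
    2 ^ n + 2 ^ n     ≡⟨ cong (2 ^ n +_) (sym (+-identityʳ (2 ^ n))) ⟩
    2 * 2 ^ n         ∎
    where open ≤-Reasoning

  n²≤2^n : ∀ n → (4 + n) * (4 + n) ≤ 2 ^ (4 + n)
  n²≤2^n zero    = ≤-refl
  n²≤2^n (suc n) = begin
    (5 + n) * (5 + n)                                   ≤⟨ m≤m+n _ (7 + 6 * n + n * n) ⟩
    (5 + n) * (5 + n) + (7 + 6 * n + n * n)             ≡⟨ eq n ⟩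
    2 * ((4 + n) * (4 + n))                             ≤⟨ *-monoʳ-≤ 2 (n²≤2^n n) ⟩
    2 * 2 ^ (4 + n)                                     ∎
    where
    open ≤-Reasoning
    eq : ∀ n → (5 + n) * (5 + n) + (7 + 6 * n + n * n) ≡ 2 * ((4 + n) * (4 + n))
    eq = solve-∀

  -- Taking n = (1 + x) 2^i, the right-hand side gains a factor 2^(2^i) while
  -- the polynomial on the left is only 2^O(i).
  exponential-beats-polynomial : ∀ a c {x y} → x < y →
    ∃[ n ] 1 ≤ n × a * suc n ^ c * x ^ n ≤ y ^ n
  exponential-beats-polynomial a c {x} {y} x<y = n , 1≤n , (begin
      a * suc n ^ c * x ^ n                        ≤⟨ *-monoˡ-≤ (x ^ n) poly≤ ⟩
      2 ^ (2 ^ i) * x ^ n                          ≤⟨ doubling-^ x 1 x (2 ^ i) (≤-trans (n≤1+n x) (≤-reflexive (sym (*-identityʳ (suc x))))) ⟩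
      (x + 1) ^ n                                  ≤⟨ ^-monoˡ-≤ n (≤-trans (≤-reflexive (+-comm x 1)) x<y) ⟩
      y ^ n                                        ∎)
    where
    open ≤-Reasoning
    -- `s` collects all the parameters, so that the polynomial is at most 2^(i * i); the summand 4
    -- in `i` is the point from which squares are below powers of 2.
    s = a + c * suc (suc x) + c
    i = 4 + s
    n = suc x * 2 ^ i
    1≤n : 1 ≤ n
    1≤n = *-mono-≤ {1} {suc x} (s≤s z≤n) (m^n>0 2 i)
    suc-n≤ : suc n ≤ 2 ^ (suc (suc x) + i)
    suc-n≤ = begin
      suc (suc x * 2 ^ i)          ≤⟨ +-monoˡ-≤ _ (m^n>0 2 i) ⟩
      suc (suc x) * 2 ^ i          ≤⟨ *-monoˡ-≤ (2 ^ i) (<⇒≤ (n<2^n (suc (suc x)))) ⟩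
      2 ^ suc (suc x) * 2 ^ i      ≡⟨ sym (^-distribˡ-+-* 2 (suc (suc x)) i) ⟩
      2 ^ (suc (suc x) + i)        ∎
    rearrange : ∀ a c y s → a + (y + (4 + (a + c * y + c))) * c + ((a + c * y) * (3 + s) + 4 * (4 + s) ) ≡ (a + c * y) * (4 + s) + c * (4 + (a + c * y + c)) + 4 * (4 + s)
    rearrange = solve-∀
    poly≤ : a * suc n ^ c ≤ 2 ^ (2 ^ i)
    poly≤ = begin
      a * suc n ^ c                                ≤⟨ *-mono-≤ (<⇒≤ (n<2^n a)) (^-monoˡ-≤ c suc-n≤) ⟩
      2 ^ a * (2 ^ (suc (suc x) + i)) ^ c          ≡⟨ cong (2 ^ a *_) (^-*-assoc 2 (suc (suc x) + i) c) ⟩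
      2 ^ a * 2 ^ ((suc (suc x) + i) * c)          ≡⟨ sym (^-distribˡ-+-* 2 a _) ⟩
      2 ^ (a + (suc (suc x) + i) * c)              ≤⟨ ^-monoʳ-≤ 2 (m≤m+n (a + (suc (suc x) + i) * c) ((a + c * suc (suc x)) * (3 + s) + 4 * (4 + s))) ⟩
      2 ^ (a + (suc (suc x) + i) * c + ((a + c * suc (suc x)) * (3 + s) + 4 * (4 + s)))
                                                   ≡⟨ cong (2 ^_) (trans (rearrange a c (suc (suc x)) s) (final a c (suc (suc x)))) ⟩
      2 ^ (i * i)                                  ≤⟨ ^-monoʳ-≤ 2 (n²≤2^n s) ⟩
      2 ^ (2 ^ i)                                  ∎
      where
      final : ∀ a c y → (a + c * y) * (4 + (a + c * y + c)) + c * (4 + (a + c * y + c)) + 4 * (4 + (a + c * y + c)) ≡ (4 + (a + c * y + c)) * (4 + (a + c * y + c))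
      final = solve-∀

  -- Finite sums, averaging and greedy covers

  private variable
    A B C : Set

  ∑ : List A → (A → ℕ) → ℕ
  ∑ []       f = 0
  ∑ (x ∷ xs) f = f x + ∑ xs f

  ∑-++ : ∀ (xs : List A) {ys} (f : A → ℕ) → ∑ (xs ++ ys) f ≡ ∑ xs f + ∑ ys f
  ∑-++ []       f = refl
  ∑-++ (x ∷ xs) f = trans (cong (f x +_) (∑-++ xs f)) (sym (+-assoc (f x) _ _))

  ∑-map : (g : B → A) (xs : List B) (f : A → ℕ) → ∑ (map g xs) f ≡ ∑ xs (f ∘ g)
  ∑-map g []       f = refl
  ∑-map g (x ∷ xs) f = cong (f (g x) +_) (∑-map g xs f)

  ∑-mono-≤ : ∀ {xs : List A} {f g} → All (λ x → f x ≤ g x) xs → ∑ xs f ≤ ∑ xs g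
  ∑-mono-≤ []      = z≤n
  ∑-mono-≤ (h ∷ hs) = +-mono-≤ h (∑-mono-≤ hs)

  ∑-distrib-+ : ∀ (xs : List A) f g → ∑ xs (λ x → f x + g x) ≡ ∑ xs f + ∑ xs g
  ∑-distrib-+ []       f g = refl
  ∑-distrib-+ (x ∷ xs) f g =
    trans (cong (f x + g x +_) (∑-distrib-+ xs f g)) (eq (f x) (g x) (∑ xs f) (∑ xs g))
    where
    eq : ∀ a b c d → a + b + (c + d) ≡ a + c + (b + d)
    eq = solve-∀

  ∑-*ˡ : ∀ (xs : List A) c f → ∑ xs (λ x → c * f x) ≡ c * ∑ xs f
  ∑-*ˡ []       c f = sym (*-zeroʳ c)
  ∑-*ˡ (x ∷ xs) c f = trans (cong (c * f x +_) (∑-*ˡ xs c f)) (sym (*-distribˡ-+ c (f x) _))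

  ∑-const : ∀ (xs : List A) c → ∑ xs (const c) ≡ length xs * c
  ∑-const []       c = refl
  ∑-const (x ∷ xs) c = cong (c +_) (∑-const xs c)

  ∑-swap : (xs : List A) (ys : List B) (f : A → B → ℕ) →
           ∑ xs (λ x → ∑ ys (f x)) ≡ ∑ ys (λ y → ∑ xs (λ x → f x y))
  ∑-swap []       ys f = sym (trans (∑-const ys 0) (*-zeroʳ (length ys)))
  ∑-swap (x ∷ xs) ys f =
    trans (cong (∑ ys (f x) +_) (∑-swap xs ys f)) (sym (∑-distrib-+ ys (f x) _))

  ∑-∈ : ∀ {xs : List A} {x} f → x ∈ xs → f x ≤ ∑ xs f
  ∑-∈ f (here refl) = m≤m+n _ _
  ∑-∈ {xs = y ∷ _} f (there p) = ≤-trans (∑-∈ f p) (m≤n+m _ (f y))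

  ∑-∈₂ : ∀ {xs : List A} {x y} f → x ≢ y → x ∈ xs → y ∈ xs → f x + f y ≤ ∑ xs f
  ∑-∈₂ f x≢y (here refl) (here refl) = contradiction refl x≢y
  ∑-∈₂ f x≢y (here refl) (there q)   = +-monoʳ-≤ _ (∑-∈ f q)
  ∑-∈₂ f x≢y (there p)   (here refl) = ≤-trans (≤-reflexive (+-comm (f _) (f _))) (+-monoʳ-≤ _ (∑-∈ f p))
  ∑-∈₂ {xs = z ∷ _} f x≢y (there p) (there q) = ≤-trans (∑-∈₂ f x≢y p q) (m≤n+m _ (f z))

  average : ∀ (x : A) (xs : List A) f →
            ∃[ y ] y ∈ x ∷ xs × ∑ (x ∷ xs) f ≤ suc (length xs) * f y
  average x []       f = x , here refl , ≤-refl
  average x (z ∷ zs) f with average z zs f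
  ... | y , y∈ , h with ≤-total (f x) (f y)
  ... | inj₁ fx≤fy = y , there y∈ , +-mono-≤ fx≤fy h
  ... | inj₂ fy≤fx = x , here refl , +-monoʳ-≤ (f x) (≤-trans h (*-monoʳ-≤ (suc (length zs)) fy≤fx))

  𝟙 : Bool → ℕ
  𝟙 b = if b then 1 else 0

  𝟙≤1 : ∀ b → 𝟙 b ≤ 1
  𝟙≤1 true  = ≤-refl
  𝟙≤1 false = z≤n

  length-filterᵇ-not : ∀ (p : A → Bool) xs →
                       length (filterᵇ (not ∘ p) xs) + ∑ xs (𝟙 ∘ p) ≡ length xs
  length-filterᵇ-not p []       = refl
  length-filterᵇ-not p (x ∷ xs) with p x
  ... | true  = trans (+-suc _ _) (cong suc (length-filterᵇ-not p xs))
  ... | false = cong suc (length-filterᵇ-not p xs)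

  filterᵇ-not⁺ : ∀ (p : A → Bool) {xs x} → x ∈ xs →
                 p x ≡ true ⊎ x ∈ filterᵇ (not ∘ p) xs
  filterᵇ-not⁺ p {x ∷ xs} (here refl) with p x
  ... | true  = inj₁ refl
  ... | false = inj₂ (here refl)
  filterᵇ-not⁺ p {y ∷ xs} (there x∈) with filterᵇ-not⁺ p x∈ | p y
  ... | inj₁ px  | _     = inj₁ px
  ... | inj₂ x∈′ | true  = inj₂ x∈′
  ... | inj₂ x∈′ | false = inj₂ (there x∈′)

  filterᵇ-All : ∀ {P : A → Set} (p : A → Bool) {xs} → All P xs → All P (filterᵇ p xs)
  filterᵇ-All p []               = []
  filterᵇ-All p (_∷_ {x} px pxs) with p x
  ... | true  = px ∷ filterᵇ-All p pxs
  ... | false = filterᵇ-All p pxs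

  -- By averaging, some member of the family covers at least the fraction
  -- g / (y + g) of the points that are still uncovered.
  module _ {X Y : Set} (cov : Y → X → Bool) (y₀ : Y) (ys : List Y) (g y : ℕ)
           (size : suc (length ys) ≡ y + g) where

    private
      Y₀ = y₀ ∷ ys

    greedy-cover : ∀ j (R : List X) → All (λ x → g ≤ ∑ Y₀ (λ c → 𝟙 (cov c x))) R →
      ∃₂ λ (L : List Y) (R′ : List X) →
        length L ≡ j × All (_∈ Y₀) L ×
        (∀ {x} → x ∈ R → Any (λ c → cov c x ≡ true) L ⊎ x ∈ R′) ×
        length R′ * (y + g) ^ j ≤ length R * y ^ j
    greedy-cover zero    R hR = [] , R , refl , [] , inj₂ , ≤-refl
    greedy-cover (suc j) R hR
      with average y₀ ys (λ c → ∑ R (λ x → 𝟙 (cov c x)))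
    ... | c , c∈ , avg
      with greedy-cover j (filterᵇ (not ∘ cov c) R) (filterᵇ-All (not ∘ cov c) hR)
    ... | L , R′ , |L| , L⊆ , covers , bound = c ∷ L , R′ , cong suc |L| , c∈ ∷ L⊆ , covers′ , (begin
      length R′ * ((y + g) * (y + g) ^ j)   ≡⟨ eq₁ (length R′) (y + g) _ ⟩
      (y + g) * (length R′ * (y + g) ^ j)   ≤⟨ *-monoʳ-≤ (y + g) bound ⟩
      (y + g) * (length R₁ * y ^ j)         ≡⟨ eq₂ (y + g) (length R₁) _ ⟩
      length R₁ * (y + g) * y ^ j           ≤⟨ *-monoˡ-≤ (y ^ j) shrink ⟩
      length R * y * y ^ j                  ≡⟨ *-assoc (length R) y _ ⟩
      length R * (y * y ^ j)                ∎)
      where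
      open ≤-Reasoning
      R₁ = filterᵇ (not ∘ cov c) R
      cnt = ∑ R (λ x → 𝟙 (cov c x))
      eq₁ : ∀ a b c → a * (b * c) ≡ b * (a * c)
      eq₁ = solve-∀
      eq₂ : ∀ a b c → a * (b * c) ≡ b * a * c
      eq₂ = solve-∀
      covers′ : ∀ {x} → x ∈ R → Any (λ c → cov c x ≡ true) (c ∷ L) ⊎ x ∈ R′
      covers′ x∈ with filterᵇ-not⁺ (cov c) x∈
      ... | inj₁ h = inj₁ (here h)
      ... | inj₂ x∈₁ with covers x∈₁
      ... | inj₁ h  = inj₁ (there h)
      ... | inj₂ x∈′ = inj₂ x∈′
      many : length R * g ≤ cnt * (y + g)
      many = begin
        length R * g                                 ≡⟨ sym (∑-const R g) ⟩
        ∑ R (const g)                                ≤⟨ ∑-mono-≤ hR ⟩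
        ∑ R (λ x → ∑ Y₀ (λ c → 𝟙 (cov c x)))         ≡⟨ ∑-swap R Y₀ (λ x c → 𝟙 (cov c x)) ⟩
        ∑ Y₀ (λ c → ∑ R (λ x → 𝟙 (cov c x)))         ≤⟨ avg ⟩
        suc (length ys) * cnt                        ≡⟨ cong (_* cnt) size ⟩
        (y + g) * cnt                                ≡⟨ *-comm (y + g) cnt ⟩
        cnt * (y + g)                                ∎
      shrink : length R₁ * (y + g) ≤ length R * y
      shrink = +-cancelʳ-≤ (length R * g) _ _ (begin
        length R₁ * (y + g) + length R * g     ≤⟨ +-monoʳ-≤ (length R₁ * (y + g)) many ⟩
        length R₁ * (y + g) + cnt * (y + g)    ≡⟨ sym (*-distribʳ-+ (y + g) (length R₁) cnt) ⟩
        (length R₁ + cnt) * (y + g)            ≡⟨ cong (_* (y + g)) (length-filterᵇ-not (cov c) R) ⟩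
        length R * (y + g)                     ≡⟨ *-distribˡ-+ (length R) y g ⟩
        length R * y + length R * g            ∎)

    -- The number of uncovered points is an integer, so it vanishes once the bound
    -- of greedy-cover is below 1.
    greedy-cover-all : ∀ j₀ l (R : List X) → All (λ x → g ≤ ∑ Y₀ (λ c → 𝟙 (cov c x))) R →
      y ≤ suc j₀ * g → length R < 2 ^ l →
      ∃[ L ] length L ≡ suc j₀ * l × All (_∈ Y₀) L ×
        (∀ {x} → x ∈ R → Any (λ c → cov c x ≡ true) L)
    greedy-cover-all j₀ l R hR y≤ R<2^l with greedy-cover (suc j₀ * l) R hR
    ... | L , R′ , |L| , L⊆ , covered , left = L , |L| , L⊆ , λ x∈ → all-covered (covered x∈)
      where
      open ≤-Reasoning
      j = suc j₀ * l
      one-left : ∀ {x} (R′ : List X) → length R′ * (y + g) ^ j ≤ length R * y ^ j → x ∈ R′ → (y + g) ^ j ≤ length R * y ^ j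
      one-left (_ ∷ R″) left _ = ≤-trans (m≤m+n _ _) left
      -- Doubling gives 2^l * y^j ≤ length R * y^j although length R < 2^l. This does not contradict
      -- y^j = 0, but then the upper bound on the positive number (y + g)^j is itself 0.
      vanish : ∀ z p → p * z ≤ length R * z → length R < p → z ≡ 0
      vanish zero    p _ _  = refl
      vanish (suc z) p h lt = contradiction (*-cancelʳ-≤ p (length R) (suc z) h) (<⇒≱ lt)
      absurd : ∀ {x} → x ∈ R′ → ⊥
      absurd x∈ = <-irrefl refl (begin-strict
        0                         <⟨ 1≤^ j (subst (1 ≤_) size (s≤s z≤n)) ⟩
        (y + g) ^ j               ≤⟨ one-left R′ left x∈ ⟩
        length R * y ^ j          ≡⟨ cong (length R *_) (vanish (y ^ j) (2 ^ l) (≤-trans (doubling-^ y g j₀ l y≤) (one-left R′ left x∈)) R<2^l) ⟩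
        length R * 0              ≡⟨ *-zeroʳ (length R) ⟩
        0                         ∎)
      all-covered : ∀ {x} → Any (λ c → cov c x ≡ true) L ⊎ x ∈ R′ → Any (λ c → cov c x ≡ true) L
      all-covered (inj₁ h)  = h
      all-covered (inj₂ x∈) = ⊥-elim (absurd x∈)

  -- Existence of covering codes

  Word : (q b : ℕ) → List ℕ → Set
  Word q b w = length w ≡ b × All (_< q) w

  words : (q b : ℕ) → List (List ℕ)
  words q zero    = [] ∷ []
  words q (suc b) = cartesianProductWith _∷_ (upTo q) (words q b)

  ∈-words⁺ : ∀ {q w} → All (_< q) w → w ∈ words q (length w)
  ∈-words⁺ []       = here refl
  ∈-words⁺ (h ∷ hs) = ∈-cartesianProductWith⁺ _∷_ (∈-upTo⁺ h) (∈-words⁺ hs)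

  ∈-words⁻ : ∀ {q} b {w} → w ∈ words q b → Word q b w
  ∈-words⁻ zero    (here refl) = refl , []
  ∈-words⁻ {q} (suc b) w∈ with ∈-cartesianProductWith⁻ _∷_ (upTo q) (words q b) w∈
  ... | c , w , c∈ , w∈′ , refl with ∈-words⁻ b w∈′
  ... | |w| , hw = cong suc |w| , ∈-upTo⁻ c∈ ∷ hw

  ∑-cartesianProductWith : ∀ (g : A → B → C) xs ys (f : C → ℕ) →
    ∑ (cartesianProductWith g xs ys) f ≡ ∑ xs (λ x → ∑ ys (λ y → f (g x y)))
  ∑-cartesianProductWith g []       ys f = refl
  ∑-cartesianProductWith g (x ∷ xs) ys f =
    trans (∑-++ (map (g x) ys) f) (cong₂ _+_ (∑-map (g x) ys f) (∑-cartesianProductWith g xs ys f))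

  length≡∑ : ∀ (xs : List A) → length xs ≡ ∑ xs (const 1)
  length≡∑ xs = sym (trans (∑-const xs 1) (*-identityʳ _))

  length-words : ∀ q b → length (words q b) ≡ q ^ b
  length-words q zero    = refl
  length-words q (suc b) = begin
    length (words q (suc b))                    ≡⟨ length≡∑ (words q (suc b)) ⟩
    ∑ (words q (suc b)) (const 1)               ≡⟨ ∑-cartesianProductWith _∷_ (upTo q) (words q b) (const 1) ⟩
    ∑ (upTo q) (λ _ → ∑ (words q b) (const 1))  ≡⟨ ∑-const (upTo q) _ ⟩
    length (upTo q) * ∑ (words q b) (const 1)   ≡⟨ cong₂ _*_ (length-upTo q) (trans (sym (length≡∑ (words q b))) (length-words q b)) ⟩
    q * q ^ b                                   ∎
    where open ≡-Reasoning

  data Move : Set where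
    stay shift out : Move

  after : Move → (ℕ → Bool) → ℕ → Bool
  after stay  f r       = f r
  after shift f zero    = false
  after shift f (suc r) = f r
  after out   f r       = false

  -- A codeword covers the words at exactly (not at most) r shifts from it: then
  -- the words covered can be counted exactly, and r is chosen by pigeonhole.
  cov : (ℕ → ℕ → Move) → List ℕ → List ℕ → ℕ → Bool
  cov wt []      []      zero = true
  cov wt (c ∷ cs) (x ∷ xs) r  = after (wt c x) (cov wt cs xs) r
  cov wt _       _       _    = false

  -- The number of words of length b that cover a given word, if m letters shift to
  -- a given letter: binomial(b, r) m^r. Its weighted version reachʷ stands for
  -- reach m b r * v^r * u^(b - r), the terms of (u + m v)^b.
  reach : ℕ → ℕ → ℕ → ℕ
  reach m zero    zero    = 1
  reach m zero    (suc r) = 0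
  reach m (suc b) zero    = reach m b zero
  reach m (suc b) (suc r) = reach m b (suc r) + m * reach m b r

  reachʷ : (m u v : ℕ) → ℕ → ℕ → ℕ
  reachʷ m u v zero    zero    = 1
  reachʷ m u v zero    (suc r) = 0
  reachʷ m u v (suc b) zero    = u * reachʷ m u v b zero
  reachʷ m u v (suc b) (suc r) = u * reachʷ m u v b (suc r) + m * v * reachʷ m u v b r

  reachʷ≡ : ∀ m u v b r → reachʷ m u v b r * u ^ r ≡ reach m b r * (v ^ r * u ^ b)
  reachʷ≡ m u v zero    zero    = refl
  reachʷ≡ m u v zero    (suc r) = refl
  reachʷ≡ m u v (suc b) zero    = begin
    u * reachʷ m u v b 0 * 1                ≡⟨ *-assoc u _ 1 ⟩
    u * (reachʷ m u v b 0 * 1)              ≡⟨ cong (u *_) (reachʷ≡ m u v b 0) ⟩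
    u * (reach m b 0 * (1 * u ^ b))         ≡⟨ eq u (reach m b 0) (u ^ b) ⟩
    reach m b 0 * (1 * (u * u ^ b))         ∎
    where
    open ≡-Reasoning
    eq : ∀ u a b → u * (a * (1 * b)) ≡ a * (1 * (u * b))
    eq = solve-∀
  reachʷ≡ m u v (suc b) (suc r) = begin
    (u * a + m * v * a′) * (u * u ^ r)                          ≡⟨ eq₁ u a m v a′ (u ^ r) ⟩
    u * (a * (u * u ^ r)) + m * v * u * (a′ * u ^ r)            ≡⟨ cong₂ (λ y z → u * y + m * v * u * z) (reachʷ≡ m u v b (suc r)) (reachʷ≡ m u v b r) ⟩
    u * (c * (v * v ^ r * u ^ b)) + m * v * u * (c′ * (v ^ r * u ^ b))
                                                               ≡⟨ eq₂ u c v (v ^ r) (u ^ b) m c′ ⟩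
    (c + m * c′) * (v * v ^ r * (u * u ^ b))                    ∎
    where
    open ≡-Reasoning
    a = reachʷ m u v b (suc r)
    a′ = reachʷ m u v b r
    c = reach m b (suc r)
    c′ = reach m b r
    eq₁ : ∀ u a m v a′ x → (u * a + m * v * a′) * (u * x) ≡ u * (a * (u * x)) + m * v * u * (a′ * x)
    eq₁ = solve-∀
    eq₂ : ∀ u c v y x m c′ → u * (c * (v * y * x)) + m * v * u * (c′ * (y * x)) ≡ (c + m * c′) * (v * y * (u * x))
    eq₂ = solve-∀

  ∑-upTo-suc : ∀ n f → ∑ (upTo (suc n)) f ≡ f 0 + ∑ (upTo n) (f ∘ suc)
  ∑-upTo-suc n f = cong (f 0 +_) (trans (cong (λ xs → ∑ xs f) (sym (map-upTo suc n))) (∑-map suc (upTo n) f))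

  ∑-upTo-mono : ∀ {n n′} f → n ≤ n′ → ∑ (upTo n) f ≤ ∑ (upTo n′) f
  ∑-upTo-mono f z≤n             = z≤n
  ∑-upTo-mono {suc n} {suc n′} f (s≤s h) =
    subst₂ _≤_ (sym (∑-upTo-suc n f)) (sym (∑-upTo-suc n′ f)) (+-monoʳ-≤ (f 0) (∑-upTo-mono (f ∘ suc) h))

  reachʷ-total : ∀ m u v b → (u + m * v) ^ b ≤ ∑ (upTo (suc b)) (reachʷ m u v b)
  reachʷ-total m u v zero    = s≤s z≤n
  reachʷ-total m u v (suc b) = begin
    (u + m * v) * (u + m * v) ^ b                      ≤⟨ *-monoʳ-≤ (u + m * v) (reachʷ-total m u v b) ⟩
    (u + m * v) * ∑ (upTo (suc b)) w                   ≡⟨ *-distribʳ-+ _ u (m * v) ⟩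
    u * ∑ (upTo (suc b)) w + m * v * ∑ (upTo (suc b)) w
      ≤⟨ +-monoˡ-≤ _ (*-monoʳ-≤ u (∑-upTo-mono w (n≤1+n (suc b)))) ⟩
    u * ∑ (upTo (2 + b)) w + m * v * ∑ (upTo (suc b)) w
      ≡⟨ cong (λ s → u * s + m * v * ∑ (upTo (suc b)) w) (∑-upTo-suc (suc b) w) ⟩
    u * (w 0 + ∑ (upTo (suc b)) (w ∘ suc)) + m * v * ∑ (upTo (suc b)) w
      ≡⟨ eq u (w 0) (∑ (upTo (suc b)) (w ∘ suc)) (m * v * ∑ (upTo (suc b)) w) ⟩
    u * w 0 + (u * ∑ (upTo (suc b)) (w ∘ suc) + m * v * ∑ (upTo (suc b)) w)
      ≡⟨ cong (u * w 0 +_) (sym (trans (∑-distrib-+ (upTo (suc b)) (λ r → u * w (suc r)) (λ r → m * v * w r))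
                                       (cong₂ _+_ (∑-*ˡ (upTo (suc b)) u (w ∘ suc)) (∑-*ˡ (upTo (suc b)) (m * v) w)))) ⟩
    u * w 0 + ∑ (upTo (suc b)) (reachʷ m u v (suc b) ∘ suc)
      ≡⟨ sym (∑-upTo-suc (suc b) (reachʷ m u v (suc b))) ⟩
    ∑ (upTo (2 + b)) (reachʷ m u v (suc b))            ∎
    where
    open ≤-Reasoning
    w = reachʷ m u v b
    eq : ∀ u a b c → u * (a + b) + c ≡ u * a + (u * b + c)
    eq = solve-∀

  record IsCode (q : ℕ) (wt : ℕ → ℕ → Move) (b r : ℕ) (L : List (List ℕ)) : Set where
    constructor isCode
    field
      codewords : All (Word q b) L
      covers    : ∀ {x} → Word q b x → Any (λ c → cov wt c x r ≡ true) L

  -- `fan-in` expresses that, for a given letter x of a word, at least one code letter stays and at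
  -- least m others shift to x. It is stated for arbitrary weights `f` of the moves because the
  -- weights in `count-reach` are the numbers of ways to continue the codeword.
  module Covering
    (q m : ℕ) (wt : ℕ → ℕ → Move)
    (fan-in : ∀ {x} → x < q → (f : Move → ℕ) → f stay + m * f shift ≤ ∑ (upTo q) (λ c → f (wt c x)))
    where

    count-reach : ∀ {b x} → Word q b x → ∀ r →
                  reach m b r ≤ ∑ (words q b) (λ c → 𝟙 (cov wt c x r))
    count-reach {zero}  {[]}     _ zero    = ≤-refl
    count-reach {zero}  {[]}     _ (suc r) = z≤n
    count-reach {zero}  {_ ∷ _}  (() , _)
    count-reach {suc b} {[]}     (() , _)
    count-reach {suc b} {x ∷ xs} (|x| , x<q ∷ xs<q) r = begin
      reach m (suc b) r                                        ≤⟨ by-first-letter r ⟩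
      f r stay + m * f r shift                                 ≤⟨ fan-in x<q (f r) ⟩
      ∑ (upTo q) (λ c → f r (wt c x))                          ≡⟨ sym (∑-cartesianProductWith _∷_ (upTo q) (words q b) (λ c → 𝟙 (cov wt c (x ∷ xs) r))) ⟩
      ∑ (words q (suc b)) (λ c → 𝟙 (cov wt c (x ∷ xs) r))      ∎
      where
      open ≤-Reasoning
      f : ℕ → Move → ℕ
      f r mv = ∑ (words q b) (λ w → 𝟙 (after mv (cov wt w xs) r))
      ih : ∀ r → reach m b r ≤ f r stay
      ih = count-reach (suc-injective |x| , xs<q)
      by-first-letter : ∀ r → reach m (suc b) r ≤ f r stay + m * f r shift
      by-first-letter zero    = ≤-trans (ih 0) (m≤m+n _ _)
      by-first-letter (suc r) = +-mono-≤ (ih (suc r)) (*-monoʳ-≤ m (ih r))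

    some-word : 1 ≤ q → ∀ b → Word q b (replicate b 0)
    some-word 1≤q b = length-replicate b , all-zero b
      where
      all-zero : ∀ b → All (_< q) (replicate b 0)
      all-zero zero    = []
      all-zero (suc b) = 1≤q ∷ all-zero b

    reach≤ : 1 ≤ q → ∀ b r → reach m b r ≤ q ^ b
    reach≤ 1≤q b r = begin
      reach m b r                                              ≤⟨ count-reach (some-word 1≤q b) r ⟩
      ∑ (words q b) (λ c → 𝟙 (cov wt c (replicate b 0) r))     ≤⟨ ∑-mono-≤ {g = const 1} (All.universal (λ c → 𝟙≤1 _) (words q b)) ⟩
      ∑ (words q b) (const 1)                                  ≡⟨ trans (sym (length≡∑ (words q b))) (length-words q b) ⟩
      q ^ b                                                    ∎
      where open ≤-Reasoning

    -- The bound on the number of uncovered words halves every `suc j₀` greedy rounds, and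
    -- `suc (q * b)` halvings bring it from q^b below 1. So the code exceeds the volume bound q^b /
    -- reach only by a factor linear in b, up to rounding.
    covering-radius : 1 ≤ q → ∀ b r j₀ → 1 ≤ reach m b r → q ^ b ≤ suc j₀ * reach m b r →
      ∃[ L ] length L ≡ suc j₀ * suc (q * b) × All (Word q b) L ×
        (∀ {x} → Word q b x → Any (λ c → cov wt c x r ≡ true) L)
    covering-radius 1≤q b r j₀ 1≤g Q≤ = go (words q b) refl
      where
      open ≤-Reasoning
      g = reach m b r
      y+g≡ : q ^ b ∸ g + g ≡ q ^ b
      y+g≡ = m∸n+n≡m (reach≤ 1≤q b r)
      Q<2^l : q ^ b < 2 ^ suc (q * b)
      Q<2^l = begin-strict
        q ^ b             ≤⟨ ^-monoˡ-≤ b (<⇒≤ (n<2^n q)) ⟩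
        (2 ^ q) ^ b       ≡⟨ ^-*-assoc 2 q b ⟩
        2 ^ (q * b)       <⟨ ^-monoʳ-< 2 (s≤s (s≤s z≤n)) (n<1+n (q * b)) ⟩
        2 ^ suc (q * b)   ∎
      go : ∀ W → W ≡ words q b →
        ∃[ L ] length L ≡ suc j₀ * suc (q * b) × All (Word q b) L ×
          (∀ {x} → Word q b x → Any (λ c → cov wt c x r ≡ true) L)
      go [] eq = contradiction (trans (sym (length-words q b)) (cong length (sym eq))) (λ h → <⇒≢ (1≤^ b 1≤q) (sym h))
      go W@(w₀ ∷ ws) eq = L , |L| , All.map (λ w∈ → ∈-words⁻ b (subst (_ ∈_) eq w∈)) L⊆ ,
          λ { (refl , x<q) → covers (subst (_ ∈_) (sym eq) (∈-words⁺ x<q)) }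
        where
        |W| : length W ≡ q ^ b
        |W| = trans (cong length eq) (length-words q b)
        cover = greedy-cover-all (λ c x → cov wt c x r) w₀ ws g (q ^ b ∸ g) (trans |W| (sym y+g≡)) j₀ (suc (q * b)) W
          (All.tabulate (λ {x} x∈ → subst (λ W → g ≤ ∑ W (λ c → 𝟙 (cov wt c x r))) (sym eq)
                                      (count-reach (∈-words⁻ b (subst (x ∈_) eq x∈)) r)))
          (≤-trans (m∸n≤m (q ^ b) g) Q≤) (subst (_< 2 ^ suc (q * b)) (sym |W|) Q<2^l)
        L      = proj₁ cover
        |L|    = proj₁ (proj₂ cover)
        L⊆     = proj₁ (proj₂ (proj₂ cover))
        covers = proj₂ (proj₂ (proj₂ cover))

    -- The b + 1 weighted counts add up to at least (u + m v)^b, so some radius r carries at least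
    -- the average, and this r is used. The size bound reads poly(b) (q u / (u + m v))^b (v / u)^r
    -- with the denominators cleared.
    covering-code : ∀ u v b → 1 ≤ q → 1 ≤ u →
      ∃₂ λ (r : ℕ) (L : List (List ℕ)) → IsCode q wt b r L ×
        length L * ((u + m * v) ^ b * u ^ r) ≤ suc b * (2 * suc (q * b)) * (q ^ b * (v ^ r * u ^ b))
    covering-code u v b 1≤q 1≤u
      with average 0 (applyUpTo suc b) (reachʷ m u v b)
    ... | r , _ , avg = r , code (covering-radius 1≤q b r (q ^ b / reach m b r) 1≤g Q≤)
      where
      open ≤-Reasoning
      g = reach m b r
      weigh : (u + m * v) ^ b * u ^ r ≤ suc b * (g * (v ^ r * u ^ b))
      weigh = begin
        (u + m * v) ^ b * u ^ r                                              ≤⟨ *-monoˡ-≤ (u ^ r) (≤-trans (reachʷ-total m u v b) avg) ⟩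
        suc (length (applyUpTo suc b)) * reachʷ m u v b r * u ^ r            ≡⟨ cong (λ n → suc n * reachʷ m u v b r * u ^ r) (length-applyUpTo suc b) ⟩
        suc b * reachʷ m u v b r * u ^ r                                     ≡⟨ *-assoc (suc b) (reachʷ m u v b r) (u ^ r) ⟩
        suc b * (reachʷ m u v b r * u ^ r)                                   ≡⟨ cong (suc b *_) (reachʷ≡ m u v b r) ⟩
        suc b * (g * (v ^ r * u ^ b))                                        ∎
      positive : ∀ g → 1 ≤ suc b * (g * (v ^ r * u ^ b)) → 1 ≤ g
      positive (suc g) _ = s≤s z≤n
      positive zero    h = contradiction (≤-trans h (≤-reflexive (*-zeroʳ b))) λ ()
      1≤g : 1 ≤ g
      1≤g = positive g (≤-trans (*-mono-≤ (1≤^ b (≤-trans 1≤u (m≤m+n u _))) (1≤^ r 1≤u)) weigh)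
      instance
        g≢0 : NonZero g
        g≢0 = >-nonZero 1≤g
      Q≤ : q ^ b ≤ suc (q ^ b / g) * g
      Q≤ = begin
        q ^ b                            ≡⟨ m≡m%n+[m/n]*n (q ^ b) g ⟩
        q ^ b % g + q ^ b / g * g        ≤⟨ +-monoˡ-≤ _ (<⇒≤ (m%n<n (q ^ b) g)) ⟩
        g + q ^ b / g * g                ∎
      eq₁ : ∀ j l b g x → j * l * (b * (g * x)) ≡ j * g * (b * l * x)
      eq₁ = solve-∀
      eq₂ : ∀ Q b l x → (Q + Q) * (b * l * x) ≡ b * (2 * l) * (Q * x)
      eq₂ = solve-∀
      -- Rounding q^b / g up to `suc j₀` costs at most a factor 2, because g ≤ q^b.
      size≤ : ∀ j₀ l → suc j₀ * g ≤ q ^ b + q ^ b →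
              suc j₀ * l * ((u + m * v) ^ b * u ^ r) ≤ suc b * (2 * l) * (q ^ b * (v ^ r * u ^ b))
      size≤ j₀ l h = begin
        suc j₀ * l * ((u + m * v) ^ b * u ^ r)                   ≤⟨ *-monoʳ-≤ (suc j₀ * l) weigh ⟩
        suc j₀ * l * (suc b * (g * (v ^ r * u ^ b)))             ≡⟨ eq₁ (suc j₀) l (suc b) g (v ^ r * u ^ b) ⟩
        suc j₀ * g * (suc b * l * (v ^ r * u ^ b))               ≤⟨ *-monoˡ-≤ _ h ⟩
        (q ^ b + q ^ b) * (suc b * l * (v ^ r * u ^ b))          ≡⟨ eq₂ (q ^ b) (suc b) l (v ^ r * u ^ b) ⟩
        suc b * (2 * l) * (q ^ b * (v ^ r * u ^ b))              ∎
      code : ∃[ L ] length L ≡ suc (q ^ b / g) * suc (q * b) × All (Word q b) L ×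
               (∀ {x} → Word q b x → Any (λ c → cov wt c x r ≡ true) L) →
             ∃[ L ] IsCode q wt b r L ×
               length L * ((u + m * v) ^ b * u ^ r) ≤ suc b * (2 * suc (q * b)) * (q ^ b * (v ^ r * u ^ b))
      code (L , |L| , words , covers) = L , isCode words covers ,
        subst (λ n → n * ((u + m * v) ^ b * u ^ r) ≤ suc b * (2 * suc (q * b)) * (q ^ b * (v ^ r * u ^ b))) (sym |L|)
          (size≤ (q ^ b / g) (suc (q * b)) (+-mono-≤ (reach≤ 1≤q b r) (m/n*n≤m (q ^ b) g)))

  -- The two codes: boxes for blocks of variables, and choices of literals

  ≡ᵇ-refl : ∀ n → (n ≡ᵇ n) ≡ true
  ≡ᵇ-refl zero    = refl
  ≡ᵇ-refl (suc n) = ≡ᵇ-refl n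

  ≢⇒≡ᵇ-false : ∀ {m n} → m ≢ n → (m ≡ᵇ n) ≡ false
  ≢⇒≡ᵇ-false {zero}  {zero}  h = contradiction refl h
  ≢⇒≡ᵇ-false {zero}  {suc n} h = refl
  ≢⇒≡ᵇ-false {suc m} {zero}  h = refl
  ≢⇒≡ᵇ-false {suc m} {suc n} h = ≢⇒≡ᵇ-false (λ e → h (cong suc e))

  ≡ᵇ-true⇒≡ : ∀ m n → (m ≡ᵇ n) ≡ true → m ≡ n
  ≡ᵇ-true⇒≡ m n e = ≡ᵇ⇒≡ m n (subst Data.Bool.T (sym e) tt)

  hamming : ℕ → ℕ → Move
  hamming c x = if x ≡ᵇ c then stay else shift

  hamming-fan-in : ∀ κ {x} → x < suc κ → (f : Move → ℕ) →
                   f stay + κ * f shift ≤ ∑ (upTo (suc κ)) (λ c → f (hamming c x))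
  hamming-fan-in κ {zero} _ f = ≤-reflexive (sym (trans (∑-upTo-suc κ (λ c → f (hamming c 0)))
    (cong (f stay +_) (trans (∑-const (upTo κ) (f shift)) (cong (_* f shift) (length-upTo κ))))))
  hamming-fan-in (suc κ) {suc x} (s≤s x<) f = begin
    f stay + (f shift + κ * f shift)                                    ≡⟨ eq (f stay) (f shift) (κ * f shift) ⟩
    f shift + (f stay + κ * f shift)                                    ≤⟨ +-monoʳ-≤ (f shift) (hamming-fan-in κ x< f) ⟩
    f shift + ∑ (upTo (suc κ)) (λ c → f (hamming c x))                  ≡⟨ sym (∑-upTo-suc (suc κ) (λ c → f (hamming c (suc x)))) ⟩
    ∑ (upTo (2 + κ)) (λ c → f (hamming c (suc x)))                      ∎
    where
    open ≤-Reasoning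
    eq : ∀ a b c → a + (b + c) ≡ b + (a + c)
    eq = solve-∀

  -- The alternative value in the cell of a variable whose current value is c.
  next : ℕ → ℕ → ℕ
  next d c = if suc c ≡ᵇ d then 0 else suc c

  next< : ∀ {d c} → 1 ≤ d → c < d → next d c < d
  next< {d} {c} 1≤d c<d with suc c ≡ᵇ d in e
  ... | true  = 1≤d
  ... | false = ≤∧≢⇒< c<d (λ h → contradiction (trans (sym e) (trans (cong (_≡ᵇ d) h) (≡ᵇ-refl d))) λ ())

  cyclic : ℕ → ℕ → ℕ → Move
  cyclic d c x = if x ≡ᵇ c then stay else (if x ≡ᵇ next d c then shift else out)

  cyclic-stay : ∀ d x → cyclic d x x ≡ stay
  cyclic-stay d x rewrite ≡ᵇ-refl x = refl

  cyclic-shift : ∀ d {c} x → x ≢ c → next d c ≡ x → cyclic d c x ≡ shift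
  cyclic-shift d x x≢c refl rewrite ≢⇒≡ᵇ-false x≢c | ≡ᵇ-refl x = refl

  -- The current values whose cell contains x are x itself and its predecessor modulo d, which is d
  -- - 1 for x = 0. They are different since d ≥ 2, so both contribute to the sum.
  cyclic-fan-in : ∀ {d} → 2 ≤ d → ∀ {x} → x < d → (f : Move → ℕ) →
                  f stay + 1 * f shift ≤ ∑ (upTo d) (λ c → f (cyclic d c x))
  cyclic-fan-in {suc zero} (s≤s ()) {zero}
  cyclic-fan-in {d@(suc (suc d′))} _ {zero} x<d f =
    subst₂ (λ a b → f a + b ≤ ∑ (upTo d) (λ c → f (cyclic d c 0))) (cyclic-stay d 0) (trans (cong f (cyclic-shift d {suc d′} 0 (λ ()) next≡)) (sym (*-identityˡ _)))
      (∑-∈₂ (λ c → f (cyclic d c 0)) (λ ()) (∈-upTo⁺ x<d) (∈-upTo⁺ (n<1+n (suc d′))))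
    where
    next≡ : next d (suc d′) ≡ 0
    next≡ rewrite ≡ᵇ-refl d′ = refl
  cyclic-fan-in {d} 2≤d {suc x} x<d f =
    subst₂ (λ a b → f a + b ≤ ∑ (upTo d) (λ c → f (cyclic d c (suc x)))) (cyclic-stay d (suc x)) (trans (cong f (cyclic-shift d {x} (suc x) (λ ()) next≡)) (sym (*-identityˡ _)))
      (∑-∈₂ (λ c → f (cyclic d c (suc x))) (λ ()) (∈-upTo⁺ x<d) (∈-upTo⁺ (<-trans (n<1+n x) x<d)))
    where
    next≡ : next d x ≡ suc x
    next≡ rewrite ≢⇒≡ᵇ-false (<⇒≢ x<d) = refl

  overhead≤ : ∀ q b → suc b * (2 * suc (q * b)) ≤ 2 * suc q * suc b ^ 2
  overhead≤ q b = ≤-trans (m≤m+n _ (2 * suc b * (q + b))) (≤-reflexive (eq q b))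
    where
    eq : ∀ q b → suc b * (2 * suc (q * b)) + 2 * suc b * (q + b) ≡ 2 * suc q * (suc b * (suc b * 1))
    eq = solve-∀

  box-code-size : ∀ {l p d u v S X Y} b r → 1 ≤ S → p * (d * u * Y) ^ b ≤ (X * S) ^ b →
    l * (S ^ b * u ^ r) ≤ p * (d ^ b * (v ^ r * u ^ b)) →
    l * (u ^ r * Y ^ b) ≤ X ^ b * v ^ r
  box-code-size {l} {p} {d} {u} {v} {S} {X} {Y} b r 1≤S growth size = *-cancelʳ-≤ _ _ (S ^ b) {{>-nonZero (1≤^ b 1≤S)}} (begin
    l * (u ^ r * Y ^ b) * S ^ b                   ≡⟨ eq₁ l (u ^ r) (Y ^ b) (S ^ b) ⟩
    l * (S ^ b * u ^ r) * Y ^ b                   ≤⟨ *-monoˡ-≤ (Y ^ b) size ⟩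
    p * (d ^ b * (v ^ r * u ^ b)) * Y ^ b         ≡⟨ eq₂ p (d ^ b) (v ^ r) (u ^ b) (Y ^ b) ⟩
    p * (d ^ b * u ^ b * Y ^ b) * v ^ r           ≡⟨ cong (λ z → p * z * v ^ r) (sym (trans (^-distribʳ-* (d * u) Y b) (cong (_* Y ^ b) (^-distribʳ-* d u b)))) ⟩
    p * (d * u * Y) ^ b * v ^ r                   ≤⟨ *-monoˡ-≤ (v ^ r) growth ⟩
    (X * S) ^ b * v ^ r                           ≡⟨ cong (_* v ^ r) (^-distribʳ-* X S b) ⟩
    X ^ b * S ^ b * v ^ r                         ≡⟨ eq₃ (X ^ b) (S ^ b) (v ^ r) ⟩
    X ^ b * v ^ r * S ^ b                         ∎)
    where
    open ≤-Reasoning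
    eq₁ : ∀ l a b c → l * (a * b) * c ≡ l * (c * a) * b
    eq₁ = solve-∀
    eq₂ : ∀ p d v u y → p * (d * (v * u)) * y ≡ p * (d * u * y) * v
    eq₂ = solve-∀
    eq₃ : ∀ a b c → a * b * c ≡ a * c * b
    eq₃ = solve-∀

  -- The size condition is length L ≤ (X / Y)^b (u / v)^(-r). A block thus has rate X / Y per
  -- variable even after the search has paid (u / v)^r for the r alternatives of the block.
  BoxCode : (d u v X Y : ℕ) → Set
  BoxCode d u v X Y =
    ∃[ b ] ∃[ r ] ∃[ L ] 1 ≤ b × IsCode d (cyclic d) b r L × length L * (u ^ r * Y ^ b) ≤ X ^ b * v ^ r

  box-code : ∀ d u v X Y → 2 ≤ d → 1 ≤ u → d * u * Y < X * (u + 1 * v) → BoxCode d u v X Y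
  box-code d u v X Y 2≤d 1≤u lt = pick (exponential-beats-polynomial (2 * suc d) 2 lt)
    where
    S = u + 1 * v
    pick : ∃[ b ] 1 ≤ b × 2 * suc d * suc b ^ 2 * (d * u * Y) ^ b ≤ (X * S) ^ b → BoxCode d u v X Y
    pick (b , 1≤b , growth) = finish (Covering.covering-code d 1 (cyclic d) (cyclic-fan-in 2≤d) u v b (≤-trans (s≤s z≤n) 2≤d) 1≤u)
      where
      finish : ∃₂ (λ r L → IsCode d (cyclic d) b r L ×
                 length L * (S ^ b * u ^ r) ≤ suc b * (2 * suc (d * b)) * (d ^ b * (v ^ r * u ^ b))) → BoxCode d u v X Y
      finish (r , L , code , size) = b , r , L , 1≤b , code ,
        box-code-size {length L} {2 * suc d * suc b ^ 2} b r (≤-trans 1≤u (m≤m+n u (1 * v))) growth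
          (≤-trans size (*-monoˡ-≤ (d ^ b * (v ^ r * u ^ b)) (overhead≤ d b)))

  branching-code-size : ∀ {l p k u v w} t s → 1 ≤ p → 1 ≤ k → 1 ≤ u →
    2 * p * (k * (u * v)) ^ t ≤ w ^ t →
    l * (w ^ t * (u * u) ^ s) ≤ p * (k ^ t * ((v * v) ^ s * (u * u) ^ t)) →
    2 * l * (v ^ t * u ^ (2 * s)) ≤ v ^ (2 * s) * u ^ t
  branching-code-size {l} {p} {k} {u} {v} {w} t s 1≤p 1≤k 1≤u growth size =
    *-cancelʳ-≤ _ _ (p * (k ^ t * u ^ t)) {{>-nonZero (*-mono-≤ 1≤p (*-mono-≤ (1≤^ t 1≤k) (1≤^ t 1≤u)))}} (begin
      2 * l * (v ^ t * u ^ (2 * s)) * (p * (k ^ t * u ^ t))      ≡⟨ eq₁ l (v ^ t) (u ^ t) (u ^ (2 * s)) p (k ^ t) ⟩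
      l * (2 * p * (k ^ t * (u ^ t * v ^ t))) * u ^ (2 * s)      ≡⟨ cong (λ z → l * (2 * p * z) * u ^ (2 * s)) (sym (trans (^-distribʳ-* k (u * v) t) (cong (k ^ t *_) (^-distribʳ-* u v t)))) ⟩
      l * (2 * p * (k * (u * v)) ^ t) * u ^ (2 * s)              ≤⟨ *-monoˡ-≤ (u ^ (2 * s)) (*-monoʳ-≤ l growth) ⟩
      l * w ^ t * u ^ (2 * s)                                    ≡⟨ trans (*-assoc l _ _) (cong (λ z → l * (w ^ t * z)) (sym (square u s))) ⟩
      l * (w ^ t * (u * u) ^ s)                                  ≤⟨ size ⟩
      p * (k ^ t * ((v * v) ^ s * (u * u) ^ t))                  ≡⟨ cong₂ (λ y z → p * (k ^ t * (y * z))) (square v s) (^-distribʳ-* u u t) ⟩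
      p * (k ^ t * (v ^ (2 * s) * (u ^ t * u ^ t)))              ≡⟨ eq₂ (v ^ (2 * s)) (u ^ t) p (k ^ t) ⟩
      v ^ (2 * s) * u ^ t * (p * (k ^ t * u ^ t))                ∎)
    where
    open ≤-Reasoning
    eq₁ : ∀ l v u s p k → 2 * l * (v * s) * (p * (k * u)) ≡ l * (2 * p * (k * (u * v))) * s
    eq₁ = solve-∀
    eq₂ : ∀ v u p k → p * (k * (v * (u * u))) ≡ v * u * (p * (k * u))
    eq₂ = solve-∀
    square : ∀ x n → (x * x) ^ n ≡ x ^ (2 * n)
    square x n = trans (cong (_^ n) (cong (x *_) (sym (*-identityʳ x)))) (^-*-assoc x 2 n)

  -- The hypothesis reads 2 l ≤ (u / v)^(t - S). Its left side exceeds 1, whereas the right side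
  -- would be at most 1 if S ≥ t; hence S < t, and the truncated subtraction is a true one.
  branching-gain : ∀ {l u v} t S → 1 ≤ l → 1 ≤ v → v ≤ u →
    2 * l * (v ^ t * u ^ S) ≤ v ^ S * u ^ t → S < t × 2 * l * v ^ (t ∸ S) ≤ u ^ (t ∸ S)
  branching-gain {l} {u} {v} t S 1≤l 1≤v v≤u main = S<t ,
    *-cancelʳ-≤ _ _ (v ^ S * u ^ S) {{>-nonZero (*-mono-≤ (1≤^ S 1≤v) (1≤^ S 1≤u))}} (begin
      2 * l * v ^ Δ * (v ^ S * u ^ S)      ≡⟨ eq₁ (2 * l) (v ^ Δ) (v ^ S) (u ^ S) ⟩
      2 * l * (v ^ Δ * v ^ S * u ^ S)      ≡⟨ cong (λ z → 2 * l * (z * u ^ S)) (split v) ⟩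
      2 * l * (v ^ t * u ^ S)              ≤⟨ main ⟩
      v ^ S * u ^ t                        ≡⟨ cong (v ^ S *_) (sym (split u)) ⟩
      v ^ S * (u ^ Δ * u ^ S)              ≡⟨ eq₂ (v ^ S) (u ^ Δ) (u ^ S) ⟩
      u ^ Δ * (v ^ S * u ^ S)              ∎)
    where
    open ≤-Reasoning
    Δ = t ∸ S
    1≤u = ≤-trans 1≤v v≤u
    eq₁ : ∀ a b c d → a * b * (c * d) ≡ a * (b * c * d)
    eq₁ = solve-∀
    eq₂ : ∀ a b c → a * (b * c) ≡ b * (a * c)
    eq₂ = solve-∀
    eq₃ : ∀ a b c → a * b * c ≡ a * (c * b)
    eq₃ = solve-∀
    S<t : S < t
    S<t with <-≤-connex S t
    ... | inj₁ lt  = lt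
    ... | inj₂ t≤S = contradiction main (<⇒≱ (begin-strict
      v ^ S * u ^ t                        ≡⟨ cong (λ n → v ^ n * u ^ t) (sym (m+[n∸m]≡n t≤S)) ⟩
      v ^ (t + e) * u ^ t                  ≡⟨ cong (_* u ^ t) (^-distribˡ-+-* v t e) ⟩
      v ^ t * v ^ e * u ^ t                ≤⟨ *-monoˡ-≤ (u ^ t) (*-monoʳ-≤ (v ^ t) (^-monoˡ-≤ e v≤u)) ⟩
      v ^ t * u ^ e * u ^ t                ≡⟨ eq₃ (v ^ t) (u ^ e) (u ^ t) ⟩
      v ^ t * (u ^ t * u ^ e)              ≡⟨ cong (v ^ t *_) (trans (sym (^-distribˡ-+-* u t e)) (cong (u ^_) (m+[n∸m]≡n t≤S))) ⟩
      z                                    <⟨ m<m+n z (*-mono-≤ (1≤^ t 1≤v) (1≤^ S 1≤u)) ⟩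
      z + z                                ≡⟨ cong (z +_) (sym (+-identityʳ z)) ⟩
      2 * z                                ≤⟨ *-monoˡ-≤ z (*-monoʳ-≤ 2 1≤l) ⟩
      2 * l * z                            ∎))
      where
      z = v ^ t * u ^ S
      e = S ∸ t
    split : ∀ x → x ^ Δ * x ^ S ≡ x ^ t
    split x = trans (sym (^-distribˡ-+-* x Δ S)) (cong (x ^_) (m∸n+n≡m (<⇒≤ S<t)))

  -- A codeword at distance s from the true choices makes s wrong flips and t - s
  -- right ones, which brings the distance down by Δ = t - 2 s.
  BranchingCode : (κ v : ℕ) → Set
  BranchingCode κ v =
    ∃[ s ] ∃[ Δ ] ∃[ L ] 1 ≤ Δ × IsCode (suc κ) hamming (Δ + 2 * s) s L × 2 * length L * v ^ Δ ≤ suc (κ * v) ^ Δ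

  branching-code : ∀ κ v → 1 ≤ κ → 1 ≤ v → BranchingCode κ v
  branching-code (suc κ′) v _ 1≤v = pick (exponential-beats-polynomial (2 * (2 * suc k)) 2 growing)
    where
    κ = suc κ′
    k = suc κ
    u = suc (κ * v)
    w = u * u + κ * (v * v)
    -- w - k u v factors as (u - v) (u - κ v). The second factor is 1 by the choice of u, and the
    -- first is κ′ v + 1.
    growing : k * (u * v) < w
    growing = ≤-trans (m≤m+n _ (κ′ * v)) (≤-reflexive (eq κ′ v))
      where
      eq : ∀ κ′ v → suc (suc (suc κ′) * (suc (suc κ′ * v) * v)) + κ′ * v ≡ suc (suc κ′ * v) * suc (suc κ′ * v) + suc κ′ * (v * v)
      eq = solve-∀
    v≤u : v ≤ u
    v≤u = ≤-trans (m≤m+n v (κ′ * v)) (n≤1+n _)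
    nonempty : ∀ {P : List ℕ → Set} {L} → Any P L → 1 ≤ length L
    nonempty (here _)  = s≤s z≤n
    nonempty (there _) = s≤s z≤n
    finish : ∀ {t s L} → IsCode k hamming t s L → 2 * s < t × 2 * length L * v ^ (t ∸ 2 * s) ≤ u ^ (t ∸ 2 * s) →
      BranchingCode κ v
    finish {t} {s} {L} code (2s<t , gain) = s , t ∸ 2 * s , L , m<n⇒0<n∸m 2s<t ,
      subst (λ t → IsCode k hamming t s L) (sym (m∸n+n≡m (<⇒≤ 2s<t))) code , gain
    pick : ∃[ t ] 1 ≤ t × 2 * (2 * suc k) * suc t ^ 2 * (k * (u * v)) ^ t ≤ w ^ t → BranchingCode κ v
    pick (t , _ , growth) = go (Covering.covering-code k κ hamming (hamming-fan-in κ) (u * u) (v * v) t (s≤s z≤n) (s≤s z≤n))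
      where
      growth′ : 2 * (2 * suc k * suc t ^ 2) * (k * (u * v)) ^ t ≤ w ^ t
      growth′ = subst (λ z → z * (k * (u * v)) ^ t ≤ w ^ t) (*-assoc 2 (2 * suc k) (suc t ^ 2)) growth
      go : ∃₂ (λ s L → IsCode k hamming t s L ×
             length L * (w ^ t * (u * u) ^ s) ≤ suc t * (2 * suc (k * t)) * (k ^ t * ((v * v) ^ s * (u * u) ^ t))) → BranchingCode κ v
      go (s , L , code , size) = finish code
        (branching-gain t (2 * s) (nonempty (IsCode.covers code (Covering.some-word k κ hamming (hamming-fan-in κ) (s≤s z≤n) t))) 1≤v v≤u
          (branching-code-size {length L} {2 * suc k * suc t ^ 2} {k} t s (*-mono-≤ {1} {2 * suc k} (s≤s z≤n) (1≤^ {suc t} 2 (s≤s z≤n))) (s≤s z≤n) (s≤s z≤n) growth′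
            (≤-trans size (*-monoˡ-≤ (k ^ t * ((v * v) ^ s * (u * u) ^ t)) (overhead≤ k t)))))

  -- Counting calls instead of steps

  size : ∀ {p m} → Exp p m → ℕ
  size (var x)         = 1
  size (quoted v)      = 1
  size (cons e e₁)     = suc (size e + size e₁)
  size (letIn e e₁)    = suc (size e + size e₁)
  size (caseOf e e₁ e₂) = suc (size e + (size e₁ + size e₂))
  size (call f e)      = suc (size e)

  totalSize : ∀ {p m n} → Vec (Exp p m) n → ℕ
  totalSize []       = 0
  totalSize (e ∷ es) = size e + totalSize es

  size-lookup : ∀ {p m n} (es : Vec (Exp p m) n) f → size (lookup es f) ≤ totalSize es
  size-lookup (e ∷ es) zero    = m≤m+n _ _
  size-lookup (e ∷ es) (suc f) = ≤-trans (size-lookup es f) (m≤n+m _ (size e))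

  -- Each subexpression of a body is evaluated at most once per call, so running
  -- times are measured by the number N of calls, up to the constant factor K.
  module Calls {p : ℕ} (B : Bodies p) where

    abstract
      K : ℕ
      K = totalSize B

      size≤K : ∀ f → size (lookup B f) ≤ K
      size≤K = size-lookup B

    record Ev {m : ℕ} (ρ : Vec Tree m) (e : Exp p m) (v : Tree) (N : ℕ) : Set where
      constructor ev
      field
        {cost} : ℕ
        run    : B , ρ ⊢ e ⇓ v ∣ cost
        cost≤  : cost ≤ size e + N * K

    Call : Fin p → Tree → Tree → ℕ → Set
    Call f u v N = Ev (u ∷ []) (lookup B f) v N

    private
      add : ∀ {t₁ t₂} s₁ s₂ N₁ N₂ → t₁ ≤ s₁ + N₁ * K → t₂ ≤ s₂ + N₂ * K →
            suc (t₁ + t₂) ≤ suc (s₁ + s₂) + (N₁ + N₂) * K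
      add s₁ s₂ N₁ N₂ h₁ h₂ = s≤s (≤-trans (+-mono-≤ h₁ h₂) (≤-reflexive (eq s₁ s₂ N₁ N₂ K)))
        where
        eq : ∀ s₁ s₂ N₁ N₂ k → s₁ + N₁ * k + (s₂ + N₂ * k) ≡ s₁ + s₂ + (N₁ + N₂) * k
        eq = solve-∀

    module _ {m : ℕ} {ρ : Vec Tree m} where

      evVar : ∀ {x} → Ev ρ (var x) (lookup ρ x) 0
      evVar = ev var ≤-refl

      evQuoted : ∀ {v} → Ev ρ (quoted v) v 0
      evQuoted = ev quoted ≤-refl

      evCons : ∀ {e₁ e₂ v₁ v₂ N₁ N₂} → Ev ρ e₁ v₁ N₁ → Ev ρ e₂ v₂ N₂ → Ev ρ (cons e₁ e₂) (v₁ ∙ v₂) (N₁ + N₂)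
      evCons {e₁} {e₂} {N₁ = N₁} {N₂} (ev r₁ h₁) (ev r₂ h₂) =
        ev (cons r₁ r₂) (add (size e₁) (size e₂) N₁ N₂ h₁ h₂)

      evLet : ∀ {e₁ e₂ v₁ v N₁ N₂} → Ev ρ e₁ v₁ N₁ → Ev (v₁ ∷ ρ) e₂ v N₂ → Ev ρ (letIn e₁ e₂) v (N₁ + N₂)
      evLet {e₁} {e₂} {N₁ = N₁} {N₂} (ev r₁ h₁) (ev r₂ h₂) =
        ev (letIn r₁ r₂) (add (size e₁) (size e₂) N₁ N₂ h₁ h₂)

      evNil : ∀ {e e₁ e₂ v N₁ N₂} → Ev ρ e nil N₁ → Ev ρ e₁ v N₂ → Ev ρ (caseOf e e₁ e₂) v (N₁ + N₂)
      evNil {e} {e₁} {e₂} {N₁ = N₁} {N₂} (ev r₁ h₁) (ev r₂ h₂) =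
        ev (case-nil r₁ r₂) (add (size e) (size e₁ + size e₂) N₁ N₂ h₁
          (≤-trans h₂ (+-monoˡ-≤ (N₂ * K) (m≤m+n (size e₁) (size e₂)))))

      evNode : ∀ {e e₁ e₂ l r v N₁ N₂} → Ev ρ e (l ∙ r) N₁ → Ev (l ∷ r ∷ ρ) e₂ v N₂ →
               Ev ρ (caseOf e e₁ e₂) v (N₁ + N₂)
      evNode {e} {e₁} {e₂} {N₁ = N₁} {N₂} (ev r₁ h₁) (ev r₂ h₂) =
        ev (case-∙ r₁ r₂) (add (size e) (size e₁ + size e₂) N₁ N₂ h₁
          (≤-trans h₂ (+-monoˡ-≤ (N₂ * K) (m≤n+m (size e₂) (size e₁)))))

      evCall : ∀ {f e u v N₁ N₂} → Ev ρ e u N₁ → Call f u v N₂ → Ev ρ (call f e) v (N₁ + suc N₂)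
      evCall {f} {e} {N₁ = N₁} {N₂} (ev r₁ h₁) (ev r₂ h₂) = ev (call r₁ r₂)
        (≤-trans (add (size e) 0 N₁ (suc N₂) h₁ (≤-trans h₂ (+-monoˡ-≤ (N₂ * K) (size≤K f))))
                 (≤-reflexive (cong (λ s → suc s + (N₁ + suc N₂) * K) (+-identityʳ (size e)))))

      weaken : ∀ {e v N N′} → N ≤ N′ → Ev ρ e v N → Ev ρ e v N′
      weaken {e} h (ev r c) = ev r (≤-trans c (+-monoʳ-≤ (size e) (*-monoˡ-≤ K h)))

  -- The program

  -- Literals and cells of the state are encoded alike: the cell (a , a′) of a
  -- variable holds its current and its alternative value. A variable is fixed
  -- if a ≡ a′, and erased if a ≡ a′ ≡ d, which violates no literal.
  encodePair : ℕ × ℕ → Tree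
  encodePair (a , b) = encodeℕ a ∙ encodeℕ b

  encodePairs : List (ℕ × ℕ) → Tree
  encodePairs = encodeList encodePair

  encodeClauses : List (List (ℕ × ℕ)) → Tree
  encodeClauses = encodeList encodePairs

  pattern fmain   = zero
  pattern fgen    = suc fmain
  pattern fsearch = suc fgen
  pattern ffix    = suc fsearch
  pattern fwalk   = suc ffix
  pattern fbranch = suc fwalk
  pattern fapply  = suc fbranch
  pattern fflip   = suc fapply
  pattern fgreedy = suc fflip
  pattern ferase  = suc fgreedy
  pattern fviol   = suc ferase
  pattern feq     = suc fviol
  pattern fset    = suc feq
  pattern flook   = suc fset
  pattern fmonus  = suc flook

  pattern i1 = suc zero
  pattern i2 = suc i1
  pattern i3 = suc i2
  pattern i4 = suc i3
  pattern i5 = suc i4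
  pattern i6 = suc i5
  pattern i7 = suc i6
  pattern i8 = suc i7
  pattern i9 = suc i8
  pattern i10 = suc i9
  pattern i11 = suc i10
  pattern v0 = var zero
  pattern v1 = var i1
  pattern v2 = var i2
  pattern v3 = var i3
  pattern v4 = var i4
  pattern v5 = var i5
  pattern v6 = var i6
  pattern v7 = var i7
  pattern v9 = var i9
  pattern v11 = var i11

  pattern ⟨nil⟩  = quoted nil
  pattern ⟨true⟩ = quoted (nil ∙ nil)

  E : ℕ → Set
  E = Exp 15

  or : ∀ {m} → E m → E m → E m
  or e e₁ = caseOf e e₁ ⟨true⟩

  anyOf : ∀ {m} → List (E m) → E m
  anyOf = foldr or ⟨nil⟩

  prepend : ∀ {m} → List Tree → E m → E m
  prepend us e = foldr (λ u → cons (quoted u)) e us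

  lookBody : E 1
  lookBody =
    caseOf v0 ⟨nil⟩
    -- `⟨true⟩` is also the tree of the pair (0 , 0), which is the value of `look` outside the list.
    (caseOf v1 ⟨true⟩
    (caseOf v2 v0 (call flook (cons v1 v3))))

  setBody : E 1
  setBody =
    caseOf v0 ⟨nil⟩
    (caseOf v1 ⟨nil⟩
    (caseOf v1 ⟨nil⟩
    (caseOf v4 (cons v2 v1)
               (cons v2 (call fset (cons v1 (cons v4 v3)))))))

  eqBody : E 1
  eqBody =
    caseOf v0 ⟨nil⟩
    (caseOf v0 (caseOf v1 ⟨true⟩ ⟨nil⟩)
    (caseOf v3 ⟨nil⟩ (call feq (cons v3 v1))))

  -- As numbers are lists of `nil`, the same code drops elements from any list. This compares the
  -- number of collected clauses with a constant without computing a length.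
  monusBody : E 1
  monusBody =
    caseOf v0 ⟨nil⟩
    (caseOf v1 v0
    (caseOf v2 ⟨nil⟩ (call fmonus (cons v1 v3))))

  violatedBody : E 1
  violatedBody =
    caseOf v0 ⟨nil⟩
    (caseOf v0 ⟨true⟩
    (caseOf v0 ⟨nil⟩
    (caseOf (call flook (cons v0 v5)) ⟨nil⟩
    (caseOf (call feq (cons v0 v3)) ⟨nil⟩
            (call fviol (cons v7 v9))))))

  flipBody : E 1
  flipBody =
    caseOf v0 ⟨nil⟩
    (caseOf v1 ⟨nil⟩
    (caseOf v0 v1
    (caseOf v4
      (caseOf v0 ⟨nil⟩
      (caseOf (call flook (cons v0 v5)) ⟨nil⟩
              (call fset (cons v2 (cons (cons v1 v0) v7)))))
      (call fflip (cons v1 (cons v3 v5))))))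

  applyBody : E 1
  applyBody =
    caseOf v0 ⟨nil⟩
    (caseOf v1 ⟨nil⟩
    (caseOf v2 v1
    (caseOf v2 v3
            (call fapply (cons v3 (cons v1 (call fflip (cons v2 (cons v0 v5)))))))))

  greedyBody : E 1
  greedyBody =
    caseOf v0 ⟨nil⟩
    (caseOf v0 ⟨nil⟩
    (caseOf (call fviol (cons v0 v3))
            (call fgreedy (cons v1 v3))
            (cons v2 (call fgreedy (cons v3 (call ferase (cons v2 v5)))))))

  walkBody : E 1
  walkBody =
    caseOf v0 ⟨nil⟩
    (caseOf v1 ⟨nil⟩
    (caseOf (call fgreedy (cons v1 v2)) ⟨true⟩
    (caseOf v2 ⟨nil⟩
            (call fbranch (cons v2 (cons v6 (cons v1 v5)))))))

  branchBody : E 1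
  branchBody =
    caseOf v0 ⟨nil⟩
    (caseOf v0 ⟨nil⟩
    (caseOf v3 ⟨nil⟩
    (caseOf v2 ⟨nil⟩
    (caseOf (call flook (cons v0 v2)) ⟨nil⟩
    (caseOf (call feq (cons v0 v1))
      (or (call fwalk (cons (call fset (cons v2 (cons (cons v1 v1) v4))) v5))
          (call fbranch (cons v7 v9)))
      (call fbranch (cons v9 v11)))))))

  fixBody : E 1
  fixBody =
    caseOf v0 ⟨nil⟩
    (caseOf v0 (call fwalk v1)
    (caseOf v0 (call ffix (cons v1 v3))
    (caseOf v5 ⟨nil⟩
    (caseOf v2 ⟨nil⟩
    (caseOf (call flook (cons v0 v2)) ⟨nil⟩
      (or (call ffix (cons (cons v7 v9) (cons (call fset (cons v2 (cons (cons v0 v0) v4))) v5)))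
          (call ffix (cons (cons v7 v9) (cons (call fset (cons v2 (cons (cons v1 v1) v4))) v5)))))))))

  module Functions (d b r t Δ : ℕ) (L₁ L₂ : List (List ℕ)) where

    eraseBody : E 1
    eraseBody =
      caseOf v0 ⟨nil⟩
      (caseOf v0 v1
      (caseOf v0 ⟨nil⟩
              (call ferase (cons v3 (call fset (cons v0 (cons (quoted (encodePair (d , d))) v5)))))))

    flipBy : List ℕ → E 10
    flipBy w = call fsearch (cons (call fapply (cons (quoted (encodeList encodeℕ w)) (cons v4 v7))) (cons v1 v6))

    searchBody : E 1
    searchBody =
      caseOf v0 ⟨nil⟩
      (caseOf v1 ⟨nil⟩
      (letIn (call fgreedy (cons v1 v2))
      -- The extra element in front makes the result nonempty exactly if at least `t` clauses were
      -- collected. Likewise 1 + R - Δ is nonzero exactly if Δ ≤ R, and matching on it leaves R - Δ.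
      (caseOf (call fmonus (cons (cons ⟨nil⟩ v0) (quoted (encodeℕ t))))
        (call ffix (cons v0 v5))
        (caseOf (call fmonus (cons (cons ⟨nil⟩ v3) (quoted (encodeℕ Δ)))) ⟨nil⟩
                (anyOf (map flipBy L₂))))))

    cells : List ℕ → List (ℕ × ℕ)
    cells = map (λ c → c , next d c)

    -- One recursive call per codeword is unrolled in the program text. The `r` copies of `nil` in
    -- front of the radius account for the alternatives that the solution takes in the new block.
    extendBy : List ℕ → E 10
    extendBy c = call fgen (cons v0 (cons (prepend (map encodePair (cells c)) v3) (cons (prepend (replicate r nil) v1) v2)))

    genBody : E 1
    genBody =
      caseOf v0 ⟨nil⟩
      (caseOf v0 (call fsearch v1)
      (caseOf v3 ⟨nil⟩
      (caseOf v1 ⟨nil⟩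
      (letIn (call fmonus (cons v6 (quoted (encodeℕ b))))
             (anyOf (map extendBy L₁))))))

    mainBody : E 1
    mainBody = caseOf v0 ⟨nil⟩ (call fgen (cons v0 (cons ⟨nil⟩ (cons ⟨nil⟩ v1))))

    bodies : Bodies 15
    bodies = mainBody ∷ genBody ∷ searchBody ∷ fixBody ∷ walkBody ∷ branchBody ∷ applyBody ∷ flipBody ∷
        greedyBody ∷ eraseBody ∷ violatedBody ∷ eqBody ∷ setBody ∷ lookBody ∷ monusBody ∷ []

  -- What the functions of the program compute

  Pairs : Set
  Pairs = List (ℕ × ℕ)

  look : ℕ → Pairs → ℕ × ℕ
  look i       []      = 0 , 0
  look zero    (p ∷ α) = p
  look (suc i) (p ∷ α) = look i α

  set : ℕ → ℕ × ℕ → Pairs → Pairs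
  set i       q []      = []
  set zero    q (p ∷ α) = q ∷ α
  set (suc i) q (p ∷ α) = p ∷ set i q α

  current : Pairs → ℕ → ℕ
  current α i = proj₁ (look i α)

  violated : Pairs → Pairs → Bool
  violated []            α = true
  violated ((i , c) ∷ C) α = if current α i ≡ᵇ c then violated C α else false

  erase : ℕ → Pairs → Pairs → Pairs
  erase d []            α = α
  erase d ((i , _) ∷ C) α = erase d C (set i (d , d) α)

  greedy : ℕ → List Pairs → Pairs → List Pairs
  greedy d []      α = []
  greedy d (C ∷ F) α = if violated C α then C ∷ greedy d F (erase d C α) else greedy d F α

  swap : ℕ × ℕ → ℕ × ℕ
  swap (a , a′) = a′ , a

  flip : ℕ → Pairs → Pairs → Pairs
  flip j       []            α = α
  flip zero    ((i , _) ∷ C) α = set i (swap (look i α)) α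
  flip (suc j) (_ ∷ C)       α = flip j C α

  apply : List ℕ → List Pairs → Pairs → Pairs
  apply []      G       α = α
  apply (j ∷ w) []      α = α
  apply (j ∷ w) (C ∷ G) α = apply w G (flip j C α)

  look-All : ∀ {P : ℕ × ℕ → Set} {α i} → All P α → i < length α → P (look i α)
  look-All {i = zero}  (h ∷ _)  _       = h
  look-All {i = suc i} (_ ∷ hs) (s≤s l) = look-All hs l

  set-All : ∀ {P : ℕ × ℕ → Set} i {q α} → P q → All P α → All P (set i q α)
  set-All i       hq []       = []
  set-All zero    hq (_ ∷ hs) = hq ∷ hs
  set-All (suc i) hq (h ∷ hs) = h ∷ set-All i hq hs

  length-set : ∀ i q α → length (set i q α) ≡ length α
  length-set i       q []      = refl
  length-set zero    q (p ∷ α) = refl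
  length-set (suc i) q (p ∷ α) = cong suc (length-set i q α)

  length-erase : ∀ d C α → length (erase d C α) ≡ length α
  length-erase d []            α = refl
  length-erase d ((i , _) ∷ C) α = trans (length-erase d C (set i (d , d) α)) (length-set i (d , d) α)

  length-flip : ∀ j C α → length (flip j C α) ≡ length α
  length-flip j       []            α = refl
  length-flip zero    ((i , _) ∷ C) α = length-set i _ α
  length-flip (suc j) (_ ∷ C)       α = length-flip j C α

  Bounded : ℕ → Pairs → Set
  Bounded d = All (λ p → proj₂ p < d)

  -- Costs of the auxiliary functions

  module HelperCosts (ℓ d k m : ℕ) where

    violatedCost eraseCost flipCost : ℕ
    violatedCost = k * (3 + ℓ + d)
    eraseCost    = k * (2 + ℓ)
    flipCost     = k + (2 + (ℓ + ℓ))

    greedyStep greedyCost : ℕ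
    greedyStep = 3 + violatedCost + eraseCost
    greedyCost = m * greedyStep

  module SearchCosts (d k ℓ m t Δ : ℕ) where
    open HelperCosts ℓ d k m public

    literalCost Q fixStep J applyCost overhead Y : ℕ
    literalCost = 5 + (ℓ + ℓ) + d
    Q         = 2 + greedyCost + k * literalCost
    fixStep   = 5 + (ℓ + (ℓ + ℓ))
    J         = t * suc k
    applyCost = 2 + t * (2 + flipCost)
    overhead  = suc greedyCost + (suc t + suc Δ)
    -- The first two summands are what `round-cost` asks for, the last one is what `leaf-cost` asks
    -- for, so that one factor serves both kinds of node.
    Y         = 2 * overhead + applyCost + (overhead + 2 ^ J * (suc fixStep + Q))

  module Runs (d b r t Δ : ℕ) (L₁ L₂ : List (List ℕ)) where

    open Functions d b r t Δ L₁ L₂ public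
    open Calls bodies public

    evLook : ∀ i α → Call flook (encodeℕ i ∙ encodePairs α) (encodePair (look i α)) (length α)
    evLook i []            = evNode evVar (evNil evVar evQuoted)
    evLook zero (p ∷ α)    = weaken z≤n (evNode evVar (evNode evVar (evNil evVar evVar)))
    evLook (suc i) (p ∷ α) = evNode evVar (evNode evVar (evNode evVar (evCall (evCons evVar evVar) (evLook i α))))

    evSet : ∀ i q α → Call fset (encodeℕ i ∙ (encodePair q ∙ encodePairs α)) (encodePairs (set i q α)) (length α)
    evSet i q []            = evNode evVar (evNode evVar (evNil evVar evQuoted))
    evSet zero q (p ∷ α)    = weaken z≤n (evNode evVar (evNode evVar (evNode evVar (evNil evVar (evCons evVar evVar)))))
    evSet (suc i) q (p ∷ α) = evNode evVar (evNode evVar (evNode evVar (evNode evVar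
      (evCons evVar (evCall (evCons evVar (evCons evVar evVar)) (evSet i q α))))))

    -- The bound is in terms of the second argument, which is always the value in a literal or the
    -- alternative value of a cell that is not erased, hence below d. The first argument may be the
    -- erasing value d.
    evEq : ∀ x y → Call feq (encodeℕ x ∙ encodeℕ y) (encodeBool (x ≡ᵇ y)) y
    evEq zero    zero    = evNode evVar (evNil evVar (evNil evVar evQuoted))
    evEq zero    (suc y) = weaken z≤n (evNode evVar (evNil evVar (evNode evVar evQuoted)))
    evEq (suc x) zero    = evNode evVar (evNode evVar (evNil evVar evQuoted))
    evEq (suc x) (suc y) = evNode evVar (evNode evVar (evNode evVar (evCall (evCons evVar evVar) (evEq x y))))

    spine : List Tree → Tree
    spine = encodeList (λ u → u)

    evMonus : ∀ xs y → Call fmonus (spine xs ∙ encodeℕ y) (spine (drop y xs)) y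
    evMonus xs       zero    = evNode evVar (evNil evVar evVar)
    evMonus []       (suc y) = weaken z≤n (evNode evVar (evNode evVar (evNil evVar evQuoted)))
    evMonus (x ∷ xs) (suc y) = evNode evVar (evNode evVar (evNode evVar (evCall (evCons evVar evVar) (evMonus xs y))))

    module Bounded-by (ℓ k m : ℕ) where
      open HelperCosts ℓ d k m

      private
        perLiteral : ∀ {n} → n ≤ k → ∀ a → n * a ≤ k * a
        perLiteral h a = *-monoˡ-≤ a h

      evViolated′ : ∀ C α → Bounded d C → length α ≡ ℓ →
                    Call fviol (encodePairs C ∙ encodePairs α) (encodeBool (violated C α)) (length C * (3 + ℓ + d))
      evViolated′ []            α _ _ = evNode evVar (evNil evVar evQuoted)
      evViolated′ ((i , c) ∷ C) α (c<d ∷ C<d) refl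
        with current α i ≡ᵇ c | evEq (current α i) c
      ... | false | eq = weaken le (evNode evVar (evNode evVar (evNode evVar (evNode (evCall (evCons evVar evVar) (evLook i α))
        (evNil (evCall (evCons evVar evVar) eq) evQuoted)))))
        where
        le : suc (length α) + (suc c + 0) ≤ suc (length C) * (3 + length α + d)
        le = ≤-trans (+-monoʳ-≤ (suc (length α)) (≤-trans (≤-reflexive (+-identityʳ (suc c))) c<d))
               (≤-trans (n≤1+n _) (≤-trans (n≤1+n _) (m≤m+n _ _)))
      ... | true  | eq = weaken le (evNode evVar (evNode evVar (evNode evVar (evNode (evCall (evCons evVar evVar) (evLook i α))
        (evNode (evCall (evCons evVar evVar) eq) (evCall (evCons evVar evVar) (evViolated′ C α C<d refl)))))))
        where
        X = length C * (3 + length α + d)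
        le : suc (length α) + (suc c + suc X) ≤ 3 + length α + d + X
        le = ≤-trans (+-monoʳ-≤ (suc (length α)) (+-monoˡ-≤ (suc X) c<d)) (≤-trans (≤-reflexive (e (length α) d X)) (n≤1+n _))
          where
          e : ∀ l d x → suc l + (d + suc x) ≡ 2 + l + d + x
          e = solve-∀

      evViolated : ∀ C α → Bounded d C → length C ≤ k → length α ≡ ℓ →
                   Call fviol (encodePairs C ∙ encodePairs α) (encodeBool (violated C α)) violatedCost
      evViolated C α C<d |C| |α| = weaken (perLiteral |C| (3 + ℓ + d)) (evViolated′ C α C<d |α|)

      evErase′ : ∀ C α → length α ≡ ℓ →
                 Call ferase (encodePairs C ∙ encodePairs α) (encodePairs (erase d C α)) (length C * (2 + ℓ))
      evErase′ []            α _    = evNode evVar (evNil evVar evVar)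
      evErase′ ((i , c) ∷ C) α refl = weaken (≤-reflexive (e (length α) _)) (evNode evVar (evNode evVar (evNode evVar
        (evCall (evCons evVar (evCall (evCons evVar (evCons evQuoted evVar)) (evSet i (d , d) α)))
                (evErase′ C (set i (d , d) α) (length-set i (d , d) α))))))
        where
        e : ∀ l x → suc l + suc x ≡ 2 + l + x
        e = solve-∀

      evErase : ∀ C α → length C ≤ k → length α ≡ ℓ →
                Call ferase (encodePairs C ∙ encodePairs α) (encodePairs (erase d C α)) eraseCost
      evErase C α |C| |α| = weaken (perLiteral |C| (2 + ℓ)) (evErase′ C α |α|)

      evGreedy′ : ∀ F α → All (Bounded d) F → All (λ C → length C ≤ k) F → length α ≡ ℓ →
        Call fgreedy (encodeClauses F ∙ encodePairs α) (encodeClauses (greedy d F α)) (length F * greedyStep)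
      evGreedy′ []      α _ _ _ = evNode evVar (evNil evVar evQuoted)
      evGreedy′ (C ∷ F) α (C<d ∷ F<d) (|C| ∷ |F|) |α|
        with violated C α | evViolated C α C<d |C| |α|
      ... | false | viol = weaken le (evNode evVar (evNode evVar (evNil (evCall (evCons evVar evVar) viol)
        (evCall (evCons evVar evVar) (evGreedy′ F α F<d |F| |α|)))))
        where
        le : suc violatedCost + suc (length F * greedyStep) ≤ greedyStep + length F * greedyStep
        le = ≤-trans (m≤m+n _ (suc eraseCost)) (≤-reflexive (e violatedCost eraseCost (length F * greedyStep)))
          where
          e : ∀ v r x → suc v + suc x + suc r ≡ 3 + v + r + x
          e = solve-∀
      ... | true | viol = weaken (≤-reflexive (e violatedCost eraseCost (length F * greedyStep)))
        (evNode evVar (evNode evVar (evNode (evCall (evCons evVar evVar) viol)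
          (evCons evVar (evCall (evCons evVar (evCall (evCons evVar evVar) (evErase C α |C| |α|)))
            (evGreedy′ F (erase d C α) F<d |F| (trans (length-erase d C α) |α|)))))))
        where
        e : ∀ v r x → suc v + (suc r + suc x) ≡ 3 + v + r + x
        e = solve-∀

      evGreedy : ∀ F α → All (Bounded d) F → All (λ C → length C ≤ k) F → length F ≤ m → length α ≡ ℓ →
        Call fgreedy (encodeClauses F ∙ encodePairs α) (encodeClauses (greedy d F α)) greedyCost
      evGreedy F α F<d |C| |F| |α| = weaken (*-monoˡ-≤ greedyStep |F|) (evGreedy′ F α F<d |C| |α|)

      evFlip′ : ∀ j C α → length α ≡ ℓ →
        Call fflip (encodeℕ j ∙ (encodePairs C ∙ encodePairs α)) (encodePairs (flip j C α)) (length C + (2 + (ℓ + ℓ)))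
      evFlip′ j       []            α _ = weaken z≤n (evNode evVar (evNode evVar (evNil evVar evVar)))
      evFlip′ zero    ((i , c) ∷ C) α refl = weaken (≤-trans (≤-reflexive (e (length α))) (m≤n+m _ (suc (length C))))
        (evNode evVar (evNode evVar (evNode evVar (evNil evVar (evNode evVar
          (evNode (evCall (evCons evVar evVar) (evLook i α))
            (evCall (evCons evVar (evCons (evCons evVar evVar) evVar)) (evSet i (swap (look i α)) α))))))))
        where
        e : ∀ l → suc l + suc l ≡ 2 + (l + l)
        e = solve-∀
      evFlip′ (suc j) (_ ∷ C)       α |α| = evNode evVar (evNode evVar (evNode evVar (evNode evVar
        (evCall (evCons evVar (evCons evVar evVar)) (evFlip′ j C α |α|)))))

      evFlip : ∀ j C α → length C ≤ k → length α ≡ ℓ →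
        Call fflip (encodeℕ j ∙ (encodePairs C ∙ encodePairs α)) (encodePairs (flip j C α)) flipCost
      evFlip j C α |C| |α| = weaken (+-monoˡ-≤ (2 + (ℓ + ℓ)) |C|) (evFlip′ j C α |α|)

      evApply : ∀ w G α → All (λ C → length C ≤ k) G → length α ≡ ℓ →
        Call fapply (encodeList encodeℕ w ∙ (encodeClauses G ∙ encodePairs α)) (encodePairs (apply w G α))
             (length w * (2 + flipCost))
      evApply []      G       α _ _ = evNode evVar (evNode evVar (evNil evVar evVar))
      evApply (j ∷ w) []      α _ _ = weaken z≤n (evNode evVar (evNode evVar (evNode evVar (evNil evVar evVar))))
      evApply (j ∷ w) (C ∷ G) α (|C| ∷ |G|) |α| = weaken (≤-reflexive (e flipCost _))
        (evNode evVar (evNode evVar (evNode evVar (evNode evVar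
          (evCall (evCons evVar (evCons evVar (evCall (evCons evVar (evCons evVar evVar)) (evFlip j C α |C| |α|))))
            (evApply w G (flip j C α) |G| (trans (length-flip j C α) |α|)))))))
        where
        e : ∀ l x → suc l + suc x ≡ 2 + l + x
        e = solve-∀

  -- Solutions, boxes and distances

  at : List ℕ → ℕ → ℕ
  at []       i       = 0
  at (y ∷ ys) zero    = y
  at (y ∷ ys) (suc i) = at ys i

  SatClause : List ℕ → Pairs → Set
  SatClause x = Any (λ (i , c) → at x i ≢ c)

  SatAll : List ℕ → List Pairs → Set
  SatAll x = All (SatClause x)

  InCell : ℕ → ℕ × ℕ → Set
  InCell y (a , a′) = y ≡ a ⊎ y ≡ a′

  InBox : List ℕ → Pairs → Set
  InBox = Pointwise InCell

  miss : ℕ → ℕ × ℕ → ℕ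
  miss y (a , _) = if y ≡ᵇ a then 0 else 1

  dist : List ℕ → Pairs → ℕ
  dist (y ∷ ys) (p ∷ α) = miss y p + dist ys α
  dist _        _       = 0

  Wrong : List ℕ → Pairs → ℕ → Set
  Wrong x α i = at x i ≢ current α i

  InRange : ℕ → Pairs → Set
  InRange n = All (λ p → proj₁ p < n)

  miss≤1 : ∀ y p → miss y p ≤ 1
  miss≤1 y (a , _) with y ≡ᵇ a
  ... | true  = z≤n
  ... | false = ≤-refl

  miss-≡ : ∀ {y} p → y ≡ proj₁ p → miss y p ≡ 0
  miss-≡ (a , _) refl rewrite ≡ᵇ-refl a = refl

  miss-≢ : ∀ {y} p → y ≢ proj₁ p → miss y p ≡ 1
  miss-≢ (a , _) h rewrite ≢⇒≡ᵇ-false h = refl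

  look-set-≡ : ∀ {i} q α → i < length α → look i (set i q α) ≡ q
  look-set-≡ {zero}  q (p ∷ α) _       = refl
  look-set-≡ {suc i} q (p ∷ α) (s≤s h) = look-set-≡ q α h

  look-set-≢ : ∀ {i j} q α → i ≢ j → look j (set i q α) ≡ look j α
  look-set-≢ {zero}  {zero}  q α       h = contradiction refl h
  look-set-≢ {i}     {j}     q []      h = refl
  look-set-≢ {zero}  {suc j} q (p ∷ α) h = refl
  look-set-≢ {suc i} {zero}  q (p ∷ α) h = refl
  look-set-≢ {suc i} {suc j} q (p ∷ α) h = look-set-≢ q α (λ e → h (cong suc e))

  inBox-look : ∀ {x α i} → InBox x α → i < length α → InCell (at x i) (look i α)
  inBox-look {i = zero}  (h ∷ _)  _       = h
  inBox-look {i = suc i} (_ ∷ hs) (s≤s l) = inBox-look hs l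

  inBox-set : ∀ {x α q} i → InBox x α → InCell (at x i) q → InBox x (set i q α)
  inBox-set i       []       _ = []
  inBox-set zero    (_ ∷ hs) c = c ∷ hs
  inBox-set (suc i) (h ∷ hs) c = h ∷ inBox-set i hs c

  dist-set : ∀ {x α i} q → InBox x α → i < length α →
             dist x (set i q α) + miss (at x i) (look i α) ≡ dist x α + miss (at x i) q
  dist-set {y ∷ x} {p ∷ α} {zero}  q (h ∷ hs) _ = eq (miss y q) (dist x α) (miss y p)
    where
    eq : ∀ a b c → a + b + c ≡ c + b + a
    eq = solve-∀
  dist-set {y ∷ x} {p ∷ α} {suc i} q (h ∷ hs) (s≤s l) =
    trans (+-assoc (miss y p) _ _) (trans (cong (miss y p +_) (dist-set q hs l)) (sym (+-assoc (miss y p) _ _)))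

  dist-set-right : ∀ {x α i} q → InBox x α → i < length α → at x i ≡ proj₁ q → dist x (set i q α) ≤ dist x α
  dist-set-right {x} {α} {i} q b l e = ≤-trans (m≤m+n _ _)
    (≤-reflexive (trans (dist-set q b l) (trans (cong (dist x α +_) (miss-≡ q e)) (+-identityʳ _))))

  dist-set-wrong : ∀ {x α i} q → InBox x α → i < length α → at x i ≡ proj₁ q → Wrong x α i →
                   suc (dist x (set i q α)) ≡ dist x α
  dist-set-wrong {x} {α} {i} q b l e w = trans (sym (trans (cong (dist x (set i q α) +_) (miss-≢ (look i α) w)) (+-comm _ 1)))
    (trans (dist-set q b l) (trans (cong (dist x α +_) (miss-≡ q e)) (+-identityʳ _)))

  dist-set-any : ∀ {x α i} q → InBox x α → i < length α → dist x (set i q α) ≤ suc (dist x α)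
  dist-set-any {x} {α} {i} q b l = begin
    dist x (set i q α)                                     ≤⟨ m≤m+n _ _ ⟩
    dist x (set i q α) + miss (at x i) (look i α)          ≡⟨ dist-set q b l ⟩
    dist x α + miss (at x i) q                             ≤⟨ +-monoʳ-≤ (dist x α) (miss≤1 (at x i) q) ⟩
    dist x α + 1                                           ≡⟨ +-comm _ 1 ⟩
    suc (dist x α)                                         ∎
    where open ≤-Reasoning

  wrong⇒alternative : ∀ {x α i} → InBox x α → i < length α → Wrong x α i → at x i ≡ proj₂ (look i α)
  wrong⇒alternative b l w with inBox-look b l
  ... | inj₁ e = contradiction e w
  ... | inj₂ e = e

  swap-cell : ∀ {y p} → InCell y p → InCell y (swap p)
  swap-cell (inj₁ e) = inj₂ e
  swap-cell (inj₂ e) = inj₁ e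

  violated-true : ∀ C {α} → violated C α ≡ true → All (λ (i , c) → current α i ≡ c) C
  violated-true []            e = []
  violated-true ((i , c) ∷ C) {α} e with current α i ≡ᵇ c in h
  ... | true  = ≡ᵇ-true⇒≡ _ _ h ∷ violated-true C e
  ... | false = contradiction e λ ()

  true-violated : ∀ {C α} → All (λ (i , c) → current α i ≡ c) C → violated C α ≡ true
  true-violated []                            = refl
  true-violated {(i , c) ∷ C} {α} (refl ∷ hs) rewrite ≡ᵇ-refl c = true-violated hs

  violated-false : ∀ C {α} → violated C α ≡ false → Any (λ (i , c) → current α i ≢ c) C
  violated-false ((i , c) ∷ C) {α} e with current α i ≡ᵇ c in h
  ... | true  = there (violated-false C e)
  ... | false = here λ { refl → contradiction (trans (sym h) (≡ᵇ-refl c)) λ () }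

  violated-cong : ∀ C {α α′} → All (λ (i , c) → current α i ≡ current α′ i) C → violated C α ≡ violated C α′
  violated-cong []            []       = refl
  violated-cong ((i , c) ∷ C) {α} {α′} (e ∷ es) rewrite e | violated-cong C {α} {α′} es = refl

  violated-wrong : ∀ {x C α} → violated C α ≡ true → SatClause x C → Any (λ p → Wrong x α (proj₁ p)) C
  violated-wrong {x} {C} {α} e s = go (violated-true C e) s
    where
    go : ∀ {C} → All (λ (i , c) → current α i ≡ c) C → SatClause x C → Any (λ p → Wrong x α (proj₁ p)) C
    go (e ∷ _)  (here h)  = here λ e′ → h (trans e′ e)
    go (_ ∷ es) (there h) = there (go es h)

  Disjoint : Pairs → Pairs → Set
  Disjoint C C′ = All (λ p → All (λ p′ → proj₁ p ≢ proj₁ p′) C′) C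

  flip-other : ∀ j C α {i} → All (λ p → proj₁ p ≢ i) C → look i (flip j C α) ≡ look i α
  flip-other j       []            α _        = refl
  flip-other zero    ((i , _) ∷ C) α (h ∷ _)  = look-set-≢ _ α h
  flip-other (suc j) (_ ∷ C)       α (_ ∷ hs) = flip-other j C α hs

  -- Even a wrong flip stays in the box, since it exchanges the two values of a cell, and it changes
  -- one variable only. Clauses may be shorter than k; a position past the end flips nothing.
  flip-near : ∀ j {C} {x} {α} → InRange (length α) C → InBox x α →
              InBox x (flip j C α) × dist x (flip j C α) ≤ suc (dist x α)
  flip-near j       {[]}          _       b = b , n≤1+n _
  flip-near zero    {(i , _) ∷ C} (l ∷ _) b = inBox-set i b (swap-cell (inBox-look b l)) , dist-set-any _ b l
  flip-near (suc j) {_ ∷ C}       (_ ∷ r) b = flip-near j r b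

  data Hits (x : List ℕ) (α : Pairs) : ℕ → Pairs → Set where
    hit  : ∀ {i c C} → Wrong x α i → Hits x α 0 ((i , c) ∷ C)
    skip : ∀ {j p C} → Hits x α j C → Hits x α (suc j) (p ∷ C)

  hits : ∀ {x α C} → Any (λ p → Wrong x α (proj₁ p)) C → ∃[ j ] j < length C × Hits x α j C
  hits (here w)  = 0 , s≤s z≤n , hit w
  hits (there a) with hits a
  ... | j , l , h = suc j , s≤s l , skip h

  flip-hit : ∀ {x α j C} → Hits x α j C → InRange (length α) C → InBox x α → suc (dist x (flip j C α)) ≡ dist x α
  flip-hit (hit w)  (l ∷ _) b = dist-set-wrong _ b l (wrong⇒alternative b l w) w
  flip-hit (skip h) (_ ∷ r) b = flip-hit h r b

  data HitsAll (x : List ℕ) (α : Pairs) : List ℕ → List Pairs → Set where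
    []  : ∀ {G} → HitsAll x α [] G
    _∷_ : ∀ {j js C G} → Hits x α j C → HitsAll x α js G → HitsAll x α (j ∷ js) (C ∷ G)

  hits-other : ∀ {x α α′ j C} → All (λ p → look (proj₁ p) α′ ≡ look (proj₁ p) α) C → Hits x α j C → Hits x α′ j C
  hits-other (e ∷ _)  (hit w)  = hit (λ h → w (trans h (cong proj₁ e)))
  hits-other (_ ∷ es) (skip h) = skip (hits-other es h)

  transpose : ∀ {C C′ : Pairs} → Disjoint C C′ → All (λ p′ → All (λ p → proj₁ p ≢ proj₁ p′) C) C′
  transpose {C′ = []}    _ = []
  transpose {C′ = _ ∷ _} d = All.map All.head d ∷ transpose (All.map All.tail d)

  -- Disjointness is used here: a flip in C leaves the cells of the other clauses alone, so choices
  -- made against the initial assignment stay right while `apply` changes it.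
  hitsAll-flip : ∀ {x α j C js G} → All (Disjoint C) G → HitsAll x α js G → HitsAll x (flip j C α) js G
  hitsAll-flip _        []       = []
  hitsAll-flip {α = α} {j} {C} (d ∷ ds) (h ∷ hs) =
    hits-other (All.map (flip-other j C α) (transpose d)) h ∷ hitsAll-flip ds hs

  -- On disjoint clauses the right choices of w come 1 closer to x and the s
  -- wrong ones go at most 1 further away.
  apply-near : ∀ {w js s G x α} → cov hamming w js s ≡ true → AllPairs Disjoint G →
    All (InRange (length α)) G → InBox x α → HitsAll x α js G →
    InBox x (apply w G α) × dist x (apply w G α) + length w ≤ dist x α + 2 * s
  apply-near {[]} {[]} {zero} _ _ _ b _ = b , ≤-refl
  apply-near {j ∷ w} {j′ ∷ js} {s} {C ∷ G} {x} {α} cv (d ∷ ds) (r ∷ rs) b (h ∷ hs)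
    with j′ ≡ᵇ j in e
  ... | true rewrite ≡ᵇ-true⇒≡ j′ j e
    with apply-near {w} {js} {s} {G} cv ds (subst (λ l → All (InRange l) G) (sym (length-flip j C α)) rs)
           (proj₁ (flip-near j r b)) (hitsAll-flip d hs)
  ... | b′ , n = b′ , (begin
      dist x (apply w G (flip j C α)) + suc (length w)     ≡⟨ +-suc _ _ ⟩
      suc (dist x (apply w G (flip j C α)) + length w)     ≤⟨ s≤s n ⟩
      suc (dist x (flip j C α) + 2 * s)                    ≡⟨ cong (_+ 2 * s) (flip-hit h r b) ⟩
      dist x α + 2 * s                                     ∎)
    where open ≤-Reasoning
  apply-near {j ∷ w} {j′ ∷ js} {suc s} {C ∷ G} {x} {α} cv (d ∷ ds) (r ∷ rs) b (h ∷ hs) | false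
    with apply-near {w} {js} {s} {G} cv ds (subst (λ l → All (InRange l) G) (sym (length-flip j C α)) rs)
           (proj₁ (flip-near j r b)) (hitsAll-flip d hs)
  ... | b′ , n = b′ , (begin
      dist x (apply w G (flip j C α)) + suc (length w)     ≡⟨ +-suc _ _ ⟩
      suc (dist x (apply w G (flip j C α)) + length w)     ≤⟨ s≤s n ⟩
      suc (dist x (flip j C α) + 2 * s)                    ≤⟨ s≤s (+-monoˡ-≤ (2 * s) (proj₂ (flip-near j r b))) ⟩
      suc (suc (dist x α) + 2 * s)                         ≡⟨ eq (dist x α) s ⟩
      dist x α + 2 * suc s                                 ∎)
    where
    open ≤-Reasoning
    eq : ∀ a s → suc (suc a + 2 * s) ≡ a + 2 * suc s
    eq = solve-∀

  -- Greedy collection of disjoint violated clauses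

  erase-look : ∀ d C {α i} → i < length α →
    current (erase d C α) i ≡ d ⊎ (All (λ p → proj₁ p ≢ i) C × look i (erase d C α) ≡ look i α)
  erase-look d []            l = inj₂ ([] , refl)
  erase-look d ((j , c) ∷ C) {α} {i} l
    with erase-look d C {set j (d , d) α} {i} (subst (i <_) (sym (length-set j (d , d) α)) l)
  ... | inj₁ e = inj₁ e
  ... | inj₂ (hs , e) with j ≟ i
  ... | yes refl = inj₁ (cong proj₁ (trans e (look-set-≡ (d , d) α l)))
  ... | no  h    = inj₂ (h ∷ hs , trans e (look-set-≢ (d , d) α h))

  transpose′ : ∀ {C C′ : Pairs} → All (λ p′ → All (λ p → proj₁ p ≢ proj₁ p′) C) C′ → Disjoint C C′
  transpose′ {[]}    _ = []
  transpose′ {_ ∷ _} d = All.map All.head d ∷ transpose′ (All.map All.tail d)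

  -- An erased variable has the value d, which no literal mentions. A clause that is violated after
  -- the erasure therefore avoids all erased variables, and its cells are the original ones.
  violated-erase : ∀ d C₀ C {α} → Bounded d C → InRange (length α) C → violated C (erase d C₀ α) ≡ true →
                   Disjoint C₀ C × violated C α ≡ true
  violated-erase d C₀ C {α} C<d r e =
    transpose′ (All.map proj₁ (go C<d r (violated-true C e))) , true-violated (All.map proj₂ (go C<d r (violated-true C e)))
    where
    go : ∀ {C} → Bounded d C → InRange (length α) C → All (λ (i , c) → current (erase d C₀ α) i ≡ c) C →
         All (λ p′ → All (λ p → proj₁ p ≢ proj₁ p′) C₀ × current α (proj₁ p′) ≡ proj₂ p′) C
    go []         []       []       = []
    go (c<d ∷ bs) (l ∷ ls) (e ∷ es) with erase-look d C₀ {α} l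
    ... | inj₁ e′       = contradiction (trans (sym e) e′) (<⇒≢ c<d)
    ... | inj₂ (h , e′) = (h , trans (cong proj₁ (sym e′)) e) ∷ go bs ls es

  record Greedy (α : Pairs) (G : List Pairs) : Set where
    constructor mkGreedy
    field
      allViolated : All (λ C → violated C α ≡ true) G
      disjoint    : AllPairs Disjoint G

  greedy-All : ∀ {P : Pairs → Set} {d F} α → All P F → All P (greedy d F α)
  greedy-All         α []              = []
  greedy-All {d = d} α (_∷_ {C} {F} p ps) with violated C α
  ... | true  = p ∷ greedy-All (erase d C α) ps
  ... | false = greedy-All α ps

  greedy-spec : ∀ d F {α} → All (Bounded d) F → All (InRange (length α)) F → Greedy α (greedy d F α)
  greedy-spec d []      _ _ = mkGreedy [] []
  greedy-spec d (C ∷ F) {α} (_ ∷ bs) (_ ∷ rs) with violated C α in e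
  ... | false = greedy-spec d F bs rs
  ... | true  = mkGreedy (e ∷ All.map proj₂ back) (All.map proj₁ back ∷ Greedy.disjoint ih)
    where
    rs′ = subst (λ l → All (InRange l) F) (sym (length-erase d C α)) rs
    ih  = greedy-spec d F {erase d C α} bs rs′
    back : All (λ C′ → Disjoint C C′ × violated C′ α ≡ true) (greedy d F (erase d C α))
    back = All.zipWith (λ { ((b , r) , v) → violated-erase d C _ b r v })
             (All.zip (greedy-All (erase d C α) bs , greedy-All (erase d C α) rs) , Greedy.allViolated ih)

  greedy-[] : ∀ d F {α} → greedy d F α ≡ [] → All (λ C → violated C α ≡ false) F
  greedy-[] d []      _ = []
  greedy-[] d (C ∷ F) {α} h with violated C α in e
  ... | false = e ∷ greedy-[] d F h

  Occurs : List Pairs → ℕ → Set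
  Occurs G i = Any (Any (λ p → proj₁ p ≡ i)) G

  -- The empty clause is always violated and contains no variable, so it has to be an exception in
  -- any statement that violated clauses contain certain variables.
  Meets : (ℕ → Set) → Pairs → Set
  Meets V C = C ≡ [] ⊎ Any (λ p → V (proj₁ p)) C

  meets-map : ∀ {V V′ : ℕ → Set} {C} → (∀ {i} → V i → V′ i) → Meets V C → Meets V′ C
  meets-map f (inj₁ e) = inj₁ e
  meets-map f (inj₂ a) = inj₂ (Any.map f a)

  occurs-here : ∀ C {G} → Meets (Occurs (C ∷ G)) C
  occurs-here []            = inj₁ refl
  occurs-here ((i , c) ∷ C) = inj₂ (here (here (here refl)))

  violated-erase-false : ∀ d C₀ C {α} → InRange (length α) C → violated C α ≡ true →
    violated C (erase d C₀ α) ≡ false → Any (λ p′ → Any (λ p → proj₁ p ≡ proj₁ p′) C₀) C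
  violated-erase-false d C₀ C {α} r e e′ = go C r (violated-true C e) (violated-false C e′)
    where
    touched : ∀ C₀ {i} → (All (λ p → proj₁ p ≢ i) C₀ → ⊥) → Any (λ p → proj₁ p ≡ i) C₀
    touched []             h = ⊥-elim (h [])
    touched ((j , _) ∷ C₀) {i} h with j ≟ i
    ... | yes e = here e
    ... | no ¬e = there (touched C₀ (λ hs → h (¬e ∷ hs)))
    go : ∀ C → InRange (length α) C → All (λ (i , c) → current α i ≡ c) C → Any (λ (i , c) → current (erase d C₀ α) i ≢ c) C →
         Any (λ p′ → Any (λ p → proj₁ p ≡ proj₁ p′) C₀) C
    go (_ ∷ C) (l ∷ _) (e ∷ _) (here h) = here (touched C₀ untouched)
      where
      untouched : All _ C₀ → ⊥
      untouched hs = h (trans (cong proj₁ (look-erase C₀ hs)) e)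
        where
        look-erase : ∀ C₀ {α i} → All (λ p → proj₁ p ≢ i) C₀ → look i (erase d C₀ α) ≡ look i α
        look-erase []             []       = refl
        look-erase ((j , _) ∷ C₀) {α} (h ∷ hs) = trans (look-erase C₀ hs) (look-set-≢ (d , d) α h)
    go (_ ∷ C) (_ ∷ r) (_ ∷ es) (there h) = there (go C r es h)

  -- A violated clause that is not collected was no longer violated when its turn came. Only the
  -- erasure of a collected clause can have caused this, so the two share a variable.
  greedy-maximal : ∀ d F {α} → All (InRange (length α)) F →
    All (λ C → violated C α ≡ true → Meets (Occurs (greedy d F α)) C) F
  greedy-maximal d []      _ = []
  greedy-maximal d (C ∷ F) {α} (r ∷ rs) with violated C α in e
  ... | false = (λ h → contradiction (trans (sym e) h) λ ()) ∷ greedy-maximal d F rs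
  ... | true  = (λ _ → occurs-here C) ∷ All.zipWith later (rs , greedy-maximal d F rs′)
    where
    rs′ = subst (λ l → All (InRange l) F) (sym (length-erase d C α)) rs
    later : ∀ {C′} → InRange (length α) C′ × (violated C′ (erase d C α) ≡ true → Meets (Occurs (greedy d F (erase d C α))) C′) →
            violated C′ α ≡ true → Meets (Occurs (C ∷ greedy d F (erase d C α))) C′
    later {C′} (r′ , ih) v with violated C′ (erase d C α) in e′
    ... | true  = meets-map there (ih refl)
    ... | false = inj₂ (Any.map here (violated-erase-false d C C′ r′ v e′))

  Fixed : Pairs → ℕ → Set
  Fixed α i = proj₁ (look i α) ≡ proj₂ (look i α)

  -- Once no variable is left to be fixed (V is empty), this leaves at most k - 1
  -- free literals in any violated clause, also after further variables are fixed.
  Touched : List Pairs → (ℕ → Set) → Pairs → Set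
  Touched F V α = All (λ C → violated C α ≡ true → Meets (λ i → Fixed α i ⊎ V i) C) F

  -- A clause that contains variable i now contains a fixed variable. Any other clause is violated
  -- iff it was before, and its witness is a variable different from i, hence still fixed or still
  -- in the smaller set V′.
  touched-fix : ∀ {F V V′ α} i a → All (InRange (length α)) F → (∀ {j} → V j → j ≡ i ⊎ V′ j) →
                Touched F V α → Touched F V′ (set i (a , a) α)
  touched-fix {F} {V} {V′} {α} i a rs sub t = All.zipWith step (rs , t)
    where
    α′ = set i (a , a) α
    fixed : ∀ {j} → j < length α → j ≡ i → Fixed α′ j
    fixed l refl rewrite look-set-≡ (a , a) α l = refl
    retain : ∀ {j} → j < length α → Fixed α j ⊎ V j → Fixed α′ j ⊎ V′ j
    retain {j} l h with j ≟ i
    retain l h | yes e = inj₁ (fixed l e)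
    retain l (inj₁ f) | no ¬e = inj₁ (subst (λ p → proj₁ p ≡ proj₂ p) (sym (look-set-≢ (a , a) α (λ e → ¬e (sym e)))) f)
    retain l (inj₂ v) | no ¬e with sub v
    ... | inj₁ e  = contradiction e ¬e
    ... | inj₂ v′ = inj₂ v′
    retainAny : ∀ {C} → InRange (length α) C → Any (λ p → Fixed α (proj₁ p) ⊎ V (proj₁ p)) C →
                Any (λ p → Fixed α′ (proj₁ p) ⊎ V′ (proj₁ p)) C
    retainAny (l ∷ _) (here h)  = here (retain l h)
    retainAny (_ ∷ r) (there h) = there (retainAny r h)
    inspect : ∀ C → InRange (length α) C → Any (λ p → Fixed α′ (proj₁ p) ⊎ V′ (proj₁ p)) C ⊎ All (λ p → i ≢ proj₁ p) C
    inspect []            []      = inj₂ []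
    inspect ((j , _) ∷ C) (l ∷ r) with j ≟ i | inspect C r
    ... | yes e | _       = inj₁ (here (inj₁ (fixed l e)))
    ... | no _  | inj₁ h  = inj₁ (there h)
    ... | no ¬e | inj₂ hs = inj₂ ((λ e → ¬e (sym e)) ∷ hs)
    step : ∀ {C} → InRange (length α) C × (violated C α ≡ true → Meets (λ i → Fixed α i ⊎ V i) C) →
           violated C α′ ≡ true → Meets (λ i → Fixed α′ i ⊎ V′ i) C
    step {C} (r , h) v with inspect C r
    ... | inj₁ a  = inj₂ a
    ... | inj₂ hs with h (trans (sym (violated-cong C (All.map (λ ¬e → cong proj₁ (look-set-≢ (a , a) α ¬e)) hs))) v)
    ... | inj₁ e  = inj₁ e
    ... | inj₂ a′ = inj₂ (retainAny r a′)

  -- Walks, and the fixing of the collected variables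

  module Searching
    (n d κ ℓ m : ℕ) (b r Δ s : ℕ) (L₁ L₂ : List (List ℕ)) (F : List Pairs)
    (n≤ℓ : n ≤ ℓ) (F-bounded : All (Bounded d) F) (F-range : All (InRange n) F)
    (F-width : All (λ C → length C ≤ suc κ) F) (F-length : length F ≤ m)
    (SAT : Set)
    (model : ∀ α → length α ≡ ℓ → All (λ p → proj₁ p < d × proj₂ p < d) α → All (λ C → violated C α ≡ false) F → SAT)
    where

    t k : ℕ
    t = Δ + 2 * s
    k = suc κ

    open Runs d b r t Δ L₁ L₂ public
    open Bounded-by ℓ k m
    open SearchCosts d k ℓ m t Δ public

    -- Soundness is unconditional, while completeness is required only under the promise `Good`.
    -- Tries based on wrong guesses can thus be combined with the right one: they may find a model,
    -- but never claim one falsely.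
    record Decides {a : ℕ} (ρ : Vec Tree a) (e : E a) (Good : Set) (N : ℕ) : Set where
      constructor decides
      field
        {answer} : Bool
        run      : Ev ρ e (encodeBool answer) N
        sound    : answer ≡ true → SAT
        complete : Good → answer ≡ true

    module _ {a : ℕ} {ρ : Vec Tree a} where

      decOr : ∀ {e₁ e₂ G₁ G₂ N₁ N₂} → Decides ρ e₁ G₁ N₁ → Decides ρ e₂ G₂ N₂ → Decides ρ (or e₁ e₂) (G₁ ⊎ G₂) (N₁ + N₂)
      decOr {N₁ = N₁} (decides {true}  r₁ s₁ c₁) (decides r₂ s₂ c₂) =
        decides (weaken (+-monoʳ-≤ N₁ z≤n) (evNode r₁ evQuoted)) s₁ (λ _ → refl)
      decOr (decides {false} r₁ s₁ c₁) (decides r₂ s₂ c₂) =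
        decides (evNil r₁ r₂) s₂ λ { (inj₁ g) → contradiction (c₁ g) λ () ; (inj₂ g) → c₂ g }

      decFalse : ∀ {e G N} → Ev ρ e nil N → (G → ⊥) → Decides ρ e G N
      decFalse r h = decides {answer = false} r (λ ()) (λ g → ⊥-elim (h g))

      decWeaken : ∀ {e G G′ N N′} → N ≤ N′ → (G′ → G) → Decides ρ e G N → Decides ρ e G′ N′
      decWeaken h f (decides r s c) = decides (weaken h r) s (c ∘ f)

      decAny : ∀ {A : Set} {e : A → E a} {Good : A → Set} {N} {L} →
               All (λ w → Decides ρ (e w) (Good w) N) L → Decides ρ (anyOf (map e L)) (Any Good L) (length L * N)
      decAny []       = decFalse evQuoted λ ()
      decAny (d ∷ ds) = decWeaken ≤-refl (λ { (here g) → inj₁ g ; (there g) → inj₂ g }) (decOr d (decAny ds))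

    through : ∀ {a a′} {ρ : Vec Tree a} {ρ′ : Vec Tree a′} {e e′ Good M N} →
              (∀ {v} → Ev ρ′ e′ v N → Ev ρ e v M) → Decides ρ′ e′ Good N → Decides ρ e Good M
    through f (decides r s c) = decides (f r) s c

    record Valid (α : Pairs) : Set where
      constructor mkValid
      field
        |α|   : length α ≡ ℓ
        cell< : All (λ p → proj₁ p < d × proj₂ p < d) α

    module Shape {α : Pairs} (valid : Valid α) where
      open Valid valid public

      inLength : ∀ {i} → i < n → i < length α
      inLength i<n = ≤-trans i<n (≤-trans n≤ℓ (≤-reflexive (sym |α|)))

      inRange : ∀ {C} → InRange n C → InRange (length α) C
      inRange = All.map inLength

      F-inRange : All (InRange (length α)) F
      F-inRange = All.map inRange F-range

      lookValid : ∀ {i} → i < length α → proj₁ (look i α) < d × proj₂ (look i α) < d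
      lookValid = look-All cell<

      setValid : ∀ i {q} → proj₁ q < d × proj₂ q < d → Valid (set i q α)
      setValid i {q} hq = mkValid (trans (length-set i q α) |α|) (set-All i hq cell<)

      evGreedyF : Call fgreedy (encodeClauses F ∙ encodePairs α) (encodeClauses (greedy d F α)) greedyCost
      evGreedyF = evGreedy F α F-bounded F-width F-length |α|

      evLookα : ∀ i → Call flook (encodeℕ i ∙ encodePairs α) (encodePair (look i α)) ℓ
      evLookα i = subst (Call flook _ _) |α| (evLook i α)

      evSetα : ∀ i q → Call fset (encodeℕ i ∙ (encodePair q ∙ encodePairs α)) (encodePairs (set i q α)) ℓ
      evSetα i q = subst (Call fset _ _) |α| (evSet i q α)

    flipValid : ∀ j {C α} → InRange n C → Valid α → Valid (flip j C α)
    flipValid j       {[]}          r        v = v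
    flipValid zero    {(i , _) ∷ C} (l ∷ _)  v = setValid i (proj₂ c< , proj₁ c<)
      where
      open Shape v
      c< = lookValid (inLength l)
    flipValid (suc j) {_ ∷ C}       (_ ∷ r)  v = flipValid j r v

    applyValid : ∀ w {G α} → All (InRange n) G → Valid α → Valid (apply w G α)
    applyValid []      _        v = v
    applyValid (j ∷ w) []       v = v
    applyValid (j ∷ w) (r ∷ rs) v = applyValid w rs (flipValid j r v)

    Near : Pairs → ℕ → Set
    Near α R = ∃[ x ] SatAll x F × InBox x α × dist x α ≤ R

    input : Pairs → ℕ → Tree
    input α R = encodePairs α ∙ (encodeℕ R ∙ encodeClauses F)

    walkCost : ℕ → ℕ
    walkCost zero    = Q
    walkCost (suc R) = Q + κ * walkCost R

    free : Pairs → Pairs → ℕ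
    free []            α = 0
    free ((i , _) ∷ C) α = (if proj₁ (look i α) ≡ᵇ proj₂ (look i α) then 0 else 1) + free C α

    free≤ : ∀ C α → free C α ≤ length C
    free≤ []            α = z≤n
    free≤ ((i , _) ∷ C) α with proj₁ (look i α) ≡ᵇ proj₂ (look i α)
    ... | true  = m≤n⇒m≤1+n (free≤ C α)
    ... | false = s≤s (free≤ C α)

    fixed⇒free< : ∀ C α → Any (λ p → Fixed α (proj₁ p)) C → free C α < length C
    fixed⇒free< ((i , _) ∷ C) α (here e) rewrite e | ≡ᵇ-refl (proj₂ (look i α)) = s≤s (free≤ C α)
    fixed⇒free< ((i , _) ∷ C) α (there a) with proj₁ (look i α) ≡ᵇ proj₂ (look i α)
    ... | true  = m≤n⇒m≤1+n (fixed⇒free< C α a)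
    ... | false = s≤s (fixed⇒free< C α a)

    Walks : ℕ → Set
    Walks R = ∀ {α} → Valid α → Touched F (λ _ → ⊥) α → Decides (input α R ∷ []) walkBody (Near α R) (walkCost R)

    -- The promise is that the solution differs from α at a variable of the remaining literals. A
    -- fixed variable cannot be this one, as the solution lies in the box; a free one must take its
    -- alternative value, which lowers the distance by 1. Only free literals cost a recursive walk.
    branch : ∀ {R} → Walks R → ∀ C {α} → InRange n C → Valid α → Touched F (λ _ → ⊥) α →
      Decides ((encodePairs C ∙ input α R) ∷ []) branchBody
              (∃[ x ] SatAll x F × InBox x α × dist x α ≤ suc R × Any (λ p → Wrong x α (proj₁ p)) C)
              (length C * literalCost + free C α * walkCost R)
    branch walks [] _ _ _ = decFalse (evNode evVar (evNil evVar evQuoted)) λ { (_ , _ , _ , _ , ()) }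
    branch {R} walks ((i , c) ∷ C) {α} (i<n ∷ C<n) valid touched
      with look i α in eqLook | proj₁ (look i α) ≡ᵇ proj₂ (look i α) in eqFix | evLookα i | evEq (proj₁ (look i α)) (proj₂ (look i α)) | lookValid i<len
      where
      open Shape valid
      i<len : i < length α
      i<len = inLength i<n
    ... | a , a′ | true | evl | eve | _ , a′<d = decWeaken cost≤ good
        (through (λ h → evNode evVar (evNode evVar (evNode evVar (evNode evVar
           (evNode (evCall (evCons evVar evVar) evl) (evNode (evCall (evCons evVar evVar) eve) (evCall (evCons evVar evVar) h)))))))
           (branch walks C C<n valid touched))
        where
        open Shape valid
        i<len : i < length α
        i<len = inLength i<n
        X = length C * literalCost
        Z = free C α * walkCost R
        cost≤ : suc ℓ + (suc a′ + suc (X + Z)) ≤ literalCost + X + (0 + free C α) * walkCost R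
        cost≤ = ≤-trans (+-monoʳ-≤ (suc ℓ) (+-monoˡ-≤ (suc (X + Z)) a′<d)) (≤-trans (m≤m+n _ (3 + ℓ)) (≤-reflexive (eq ℓ d X Z)))
          where
          eq : ∀ l d x y → suc l + (d + suc (x + y)) + (3 + l) ≡ 5 + (l + l) + d + x + y
          eq = solve-∀
        good : ∃[ x ] SatAll x F × InBox x α × dist x α ≤ suc R × Any (λ p → Wrong x α (proj₁ p)) ((i , c) ∷ C) →
               ∃[ x ] SatAll x F × InBox x α × dist x α ≤ suc R × Any (λ p → Wrong x α (proj₁ p)) C
        good (x , sat , box , dst , there w) = x , sat , box , dst , w
        good (x , sat , box , dst , here w)  =
          contradiction (trans (wrong⇒alternative box i<len w) (sym (trans (cong proj₁ eqLook) (trans (≡ᵇ-true⇒≡ a a′ eqFix) (sym (cong proj₂ eqLook)))))) w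
    ... | a , a′ | false | evl | eve | _ , a′<d = decWeaken cost≤ good
        (through (λ h → evNode evVar (evNode evVar (evNode evVar (evNode evVar
           (evNode (evCall (evCons evVar evVar) evl) (evNil (evCall (evCons evVar evVar) eve) h))))))
          (decOr
            (through (evCall (evCons (evCall (evCons evVar (evCons (evCons evVar evVar) evVar)) (evSetα i (a′ , a′))) evVar))
                     (walks (setValid i (a′<d , a′<d)) (touched-fix i a′ F-inRange (λ ()) touched)))
            (through (evCall (evCons evVar evVar)) (branch walks C C<n valid touched))))
        where
        open Shape valid
        i<len : i < length α
        i<len = inLength i<n
        X = length C * literalCost
        W = walkCost R
        Z = free C α * W
        cost≤ : suc ℓ + (suc a′ + (suc ℓ + 0 + suc W + suc (X + Z))) ≤ literalCost + X + (1 + free C α) * W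
        cost≤ = ≤-trans (+-monoʳ-≤ (suc ℓ) (+-monoˡ-≤ (suc ℓ + 0 + suc W + suc (X + Z)) a′<d)) (≤-trans (m≤m+n _ 1) (≤-reflexive (eq ℓ d X W Z)))
          where
          eq : ∀ l d x w y → suc l + (d + (suc l + 0 + suc w + suc (x + y))) + 1 ≡ 5 + (l + l) + d + x + (w + y)
          eq = solve-∀
        good : ∃[ x ] SatAll x F × InBox x α × dist x α ≤ suc R × Any (λ p → Wrong x α (proj₁ p)) ((i , c) ∷ C) →
               Near (set i (a′ , a′) α) R ⊎
               ∃[ x ] SatAll x F × InBox x α × dist x α ≤ suc R × Any (λ p → Wrong x α (proj₁ p)) C
        good (x , sat , box , dst , there w) = inj₂ (x , sat , box , dst , w)
        good (x , sat , box , dst , here w)  = inj₁ (x , sat , inBox-set i box (inj₁ x≡a′) ,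
          s≤s⁻¹ (≤-trans (≤-reflexive (dist-set-wrong (a′ , a′) box i<len x≡a′ w)) dst))
          where
          x≡a′ : at x i ≡ a′
          x≡a′ = trans (wrong⇒alternative box i<len w) (cong proj₂ eqLook)

    wrong-dist : ∀ {x α C} → InBox x α → InRange (length α) C → Any (λ p → Wrong x α (proj₁ p)) C → 1 ≤ dist x α
    wrong-dist {x} b (l ∷ _) (here {(i , _)} w) = ≤-trans (s≤s z≤n) (≤-reflexive (dist-set-wrong (at x i , at x i) b l refl w))
    wrong-dist {x} b (_ ∷ r) (there a)          = wrong-dist {x} b r a

    violated-first : ∀ {α C G} → greedy d F α ≡ C ∷ G → All (InRange (length α)) F →
                     InRange n C × length C ≤ k × (∀ x → SatAll x F → Any (λ p → Wrong x α (proj₁ p)) C) ×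
                     (∀ {V} → Touched F V α → Meets (λ i → Fixed α i ⊎ V i) C)
    violated-first {α} e rs
      with subst (All _) e (greedy-All {d = d} α F-range) | subst (All _) e (greedy-All {d = d} α F-width)
         | subst (Greedy α) e (greedy-spec d F F-bounded rs)
    ... | r ∷ _ | w ∷ _ | mkGreedy (v ∷ _) _ = r , w ,
      (λ x sat → violated-wrong {x} v (All.head (subst (All (SatClause x)) e (greedy-All {d = d} α sat)))) ,
      (λ t → All.head (subst (All _) e (greedy-All {d = d} α t)) v)

    -- The greedy list is used only through its head: an empty list means that α violates nothing,
    -- and otherwise the head is a violated clause, in which any solution differs from α somewhere.
    -- At R = 0 this rules out a solution.
    walk : ∀ R → Walks R
    walk R {α} valid touched with greedy d F α in eqG | Shape.evGreedyF valid
    ... | [] | evg = decides {answer = true}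
          (weaken (cost≤ R) (evNode evVar (evNode evVar (evNil (evCall (evCons evVar evVar) evg) evQuoted))))
          (λ _ → model α (Valid.|α| valid) (Valid.cell< valid) (greedy-[] d F eqG)) (λ _ → refl)
          where
          Q≤ : ∀ R → Q ≤ walkCost R
          Q≤ zero    = ≤-refl
          Q≤ (suc R) = m≤m+n _ _
          cost≤ : ∀ R → suc greedyCost + 0 ≤ walkCost R
          cost≤ R = ≤-trans (≤-trans (≤-reflexive (+-identityʳ (suc greedyCost))) (≤-trans (n≤1+n _) (m≤m+n _ _))) (Q≤ R)
    walk zero {α} valid touched | C ∷ G | evg = decFalse
          (weaken cost≤ (evNode evVar (evNode evVar (evNode (evCall (evCons evVar evVar) evg) (evNil evVar evQuoted)))))
          λ { (x , sat , box , dst) → contradiction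
                (≤-trans (wrong-dist box (Shape.inRange valid C<n) (wrong x sat)) dst) λ () }
          where
          first = violated-first eqG (Shape.F-inRange valid)
          C<n = proj₁ first
          wrong = proj₁ (proj₂ (proj₂ first))
          cost≤ : suc greedyCost + 0 ≤ Q
          cost≤ = ≤-trans (≤-reflexive (+-identityʳ (suc greedyCost))) (≤-trans (n≤1+n _) (m≤m+n _ _))
    walk (suc R) {α} valid touched | C ∷ G | evg = decWeaken cost≤ good
          (through (λ h → evNode evVar (evNode evVar (evNode (evCall (evCons evVar evVar) evg) (evNode evVar
             (evCall (evCons evVar (evCons evVar (evCons evVar evVar))) h)))))
             (branch (walk R) C C<n valid touched))
          where
          first = violated-first eqG (Shape.F-inRange valid)
          C<n = proj₁ first
          |C| = proj₁ (proj₂ first)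
          wrong = proj₁ (proj₂ (proj₂ first))
          meets = proj₂ (proj₂ (proj₂ first))
          -- No variable is waiting to be fixed here, so the literal provided by `Touched` is a
          -- fixed one, and at most κ of the `suc κ` literals are free.
          free≤κ : free C α ≤ κ
          free≤κ with meets touched
          ... | inj₁ refl = z≤n
          ... | inj₂ a    = s≤s⁻¹ (≤-trans (fixed⇒free< C α (Any.map (λ { (inj₁ f) → f }) a)) |C|)
          cost≤ : suc greedyCost + suc (length C * literalCost + free C α * walkCost R) ≤ Q + κ * walkCost R
          cost≤ = ≤-trans (+-monoʳ-≤ (suc greedyCost) (s≤s (+-mono-≤ (*-monoˡ-≤ literalCost |C|) (*-monoˡ-≤ (walkCost R) free≤κ))))
                          (≤-reflexive (eq greedyCost (k * literalCost) (κ * walkCost R)))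
            where
            eq : ∀ g x y → suc g + suc (x + y) ≡ 2 + g + x + y
            eq = solve-∀
          good : Near α (suc R) → ∃[ x ] SatAll x F × InBox x α × dist x α ≤ suc R × Any (λ p → Wrong x α (proj₁ p)) C
          good (x , sat , box , dst) = x , sat , box , dst , wrong x sat

    fixCost : ℕ → ℕ → ℕ
    fixCost R zero    = suc (walkCost R)
    fixCost R (suc j) = fixStep + (fixCost R j + fixCost R j)

    -- Bounds the number of doublings in the fixing phase: one per literal, and one more per clause
    -- for dropping it when it is empty, so that `fixCost` can recurse on a single number.
    weight : List Pairs → ℕ
    weight []      = 0
    weight (C ∷ G) = suc (length C + weight G)

    -- The variables still occurring in G are those waiting to be fixed; removing a literal moves
    -- its variable to the fixed ones, so that none is waiting when the walk starts. One of the two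
    -- values of a cell agrees with the solution, and fixing it does not increase the distance.
    fix : ∀ {R} G {α} → All (InRange n) G → Valid α → Touched F (Occurs G) α →
      Decides ((encodeClauses G ∙ input α R) ∷ []) fixBody (Near α R) (fixCost R (weight G))
    fixClause : ∀ {R} C G {α} → InRange n C → All (InRange n) G → Valid α → Touched F (Occurs (C ∷ G)) α →
      Decides ((encodeClauses (C ∷ G) ∙ input α R) ∷ []) fixBody (Near α R) (fixCost R (suc (length C + weight G)))

    fix {R} [] _ valid touched = through (λ h → evNode evVar (evNil evVar (evCall evVar h)))
      (walk R valid (All.map (λ f v → meets-map (λ { (inj₁ f) → inj₁ f }) (f v)) touched))
    fix (C ∷ G) (r ∷ rs) valid touched = fixClause C G r rs valid touched

    fixClause {R} [] G _ rs valid touched = decWeaken cost≤ id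
      (through (λ h → evNode evVar (evNode evVar (evNil evVar (evCall (evCons evVar evVar) h))))
        (fix G rs valid (All.map (λ f v → meets-map (λ { (inj₁ f) → inj₁ f ; (inj₂ (there o)) → inj₂ o }) (f v)) touched)))
      where
      cost≤ : suc (fixCost R (weight G)) ≤ fixStep + (fixCost R (weight G) + fixCost R (weight G))
      cost≤ = +-mono-≤ {1} {fixStep} (s≤s z≤n) (m≤m+n _ _)
    fixClause {R} ((i , c) ∷ C) G {α} (i<n ∷ C<n) rs valid touched = decWeaken cost≤ good
        (through (λ h → evNode evVar (evNode evVar (evNode evVar (evNode evVar (evNode evVar
           (evNode (evCall (evCons evVar evVar) (evLookα i)) h))))))
          (decOr
            (through (evCall (evCons (evCons evVar evVar) (evCons (evCall (evCons evVar (evCons (evCons evVar evVar) evVar)) (evSetα i _)) evVar)))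
                     (option (proj₁ cell) (proj₁ c<)))
            (through (evCall (evCons (evCons evVar evVar) (evCons (evCall (evCons evVar (evCons (evCons evVar evVar) evVar)) (evSetα i _)) evVar)))
                     (option (proj₂ cell) (proj₂ c<)))))
      where
      open Shape valid
      i<len : i < length α
      i<len = inLength i<n
      cell = look i α
      c< = lookValid i<len
      X = fixCost R (suc (length C + weight G))
      sub : ∀ {j} → Occurs (((i , c) ∷ C) ∷ G) j → j ≡ i ⊎ Occurs (C ∷ G) j
      sub (here (here e))  = inj₁ (sym e)
      sub (here (there o)) = inj₂ (here o)
      sub (there o)        = inj₂ (there o)
      option : ∀ a → a < d → Decides ((encodeClauses (C ∷ G) ∙ input (set i (a , a) α) R) ∷ []) fixBody (Near (set i (a , a) α) R) X
      option a a<d = fixClause C G C<n rs (setValid i (a<d , a<d)) (touched-fix i a F-inRange sub touched)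
      cost≤ : suc ℓ + ((suc ℓ + 0 + suc X) + (suc ℓ + 0 + suc X)) ≤ fixStep + (X + X)
      cost≤ = ≤-reflexive (eq ℓ X)
        where
        eq : ∀ l x → suc l + ((suc l + 0 + suc x) + (suc l + 0 + suc x)) ≡ 5 + (l + (l + l)) + (x + x)
        eq = solve-∀
      good : Near α R → Near (set i (proj₁ cell , proj₁ cell) α) R ⊎ Near (set i (proj₂ cell , proj₂ cell) α) R
      good (x , sat , box , dst) with inBox-look box i<len
      ... | inj₁ e = inj₁ (x , sat , inBox-set i box (inj₁ e) , ≤-trans (dist-set-right _ box i<len e) dst)
      ... | inj₂ e = inj₂ (x , sat , inBox-set i box (inj₁ e) , ≤-trans (dist-set-right _ box i<len e) dst)

  -- Cost recurrences, and the division of the variables into blocks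

  cov-length : ∀ {wt} c x {r} → cov wt c x r ≡ true → length c ≡ length x
  cov-length           []      []      _ = refl
  cov-length {wt} (c ∷ cs) (x ∷ xs) {r} e with wt c x
  cov-length (c ∷ cs) (x ∷ xs) {r}     e | stay  = cong suc (cov-length cs xs e)
  cov-length (c ∷ cs) (x ∷ xs) {suc r} e | shift = cong suc (cov-length cs xs e)

  -- Half of the budget u^Δ of a round pays for its recursive calls, the other
  -- half for its own work c.
  round-cost : ∀ c A l S R Δ Y {u v} → v ≤ u → 2 * c + A ≤ Y → 2 * l * v ^ Δ ≤ u ^ Δ →
    S * v ^ R ≤ suc R * (Y * u ^ R) →
    (c + l * (A + S)) * v ^ (R + Δ) ≤ suc (R + Δ) * (Y * u ^ (R + Δ))
  round-cost c A l S R Δ Y {u} {v} v≤u c≤ gain S≤ = *-cancelˡ-≤ 2 (begin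
    2 * ((c + l * (A + S)) * v ^ (R + Δ))                     ≡⟨ cong (λ z → 2 * ((c + l * (A + S)) * z)) (^-distribˡ-+-* v R Δ) ⟩
    2 * ((c + l * (A + S)) * (p * q))                         ≡⟨ eq₁ c l A S p q ⟩
    2 * c * (p * q) + 2 * l * q * (A * p + S * p)             ≤⟨ +-mono-≤ (*-monoʳ-≤ (2 * c) (*-mono-≤ p≤ (^-monoˡ-≤ Δ v≤u))) (*-mono-≤ gain (+-mono-≤ (*-monoʳ-≤ A p≤) S≤)) ⟩
    2 * c * (P * T) + T * (A * P + suc R * (Y * P))           ≡⟨ eq₂ (2 * c) P T A (suc R) Y ⟩
    (2 * c + A + suc R * Y) * (P * T)                         ≤⟨ *-monoˡ-≤ (P * T) (+-monoˡ-≤ (suc R * Y) c≤) ⟩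
    (Y + suc R * Y) * (P * T)                                 ≤⟨ m≤m+n _ ((R + 2 * Δ) * Y * (P * T)) ⟩
    (Y + suc R * Y) * (P * T) + (R + 2 * Δ) * Y * (P * T)     ≡⟨ eq₃ R Δ Y (P * T) ⟩
    2 * (suc (R + Δ) * (Y * (P * T)))                         ≡⟨ cong (λ z → 2 * (suc (R + Δ) * (Y * z))) (sym (^-distribˡ-+-* u R Δ)) ⟩
    2 * (suc (R + Δ) * (Y * u ^ (R + Δ)))                     ∎)
    where
    open ≤-Reasoning
    p = v ^ R
    q = v ^ Δ
    P = u ^ R
    T = u ^ Δ
    p≤ : p ≤ P
    p≤ = ^-monoˡ-≤ R v≤u
    eq₁ : ∀ c l A S p q → 2 * ((c + l * (A + S)) * (p * q)) ≡ 2 * c * (p * q) + 2 * l * q * (A * p + S * p)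
    eq₁ = solve-∀
    eq₂ : ∀ c P T A R Y → c * (P * T) + T * (A * P + R * (Y * P)) ≡ (c + A + R * Y) * (P * T)
    eq₂ = solve-∀
    eq₃ : ∀ R Δ Y x → (Y + suc R * Y) * x + (R + 2 * Δ) * Y * x ≡ 2 * (suc (R + Δ) * (Y * x))
    eq₃ = solve-∀

  -- Since κ v ≤ u, the κ^R of a walk is within (u / v)^R. The 2^J ways of fixing variables do not
  -- depend on R, and `suc R` comes from the bound on the walk.
  leaf-cost : ∀ c J e Q W R Y {κ u v} → v ≤ u → κ * v ≤ u → W ≤ Q * (suc R * κ ^ R) →
    c + 2 ^ J * (suc e + Q) ≤ Y →
    (c + 2 ^ J * (suc W + e)) * v ^ R ≤ suc R * (Y * u ^ R)
  leaf-cost c J e Q W R Y {κ} {u} {v} v≤u κv≤u W≤ Y≥ = begin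
    (c + D * (suc W + e)) * v ^ R                                  ≡⟨ eq₁ c D W e (v ^ R) ⟩
    (c + D * suc e) * v ^ R + D * (W * v ^ R)                      ≤⟨ +-mono-≤ (*-monoʳ-≤ (c + D * suc e) v≤) (*-monoʳ-≤ D walk≤) ⟩
    (c + D * suc e) * U + D * (Q * (suc R * U))                    ≤⟨ m≤m+n _ (R * ((c + D * suc e) * U)) ⟩
    (c + D * suc e) * U + D * (Q * (suc R * U)) + R * ((c + D * suc e) * U)
                                                                   ≡⟨ eq₂ c D e U Q R ⟩
    suc R * ((c + D * (suc e + Q)) * U)                            ≤⟨ *-monoʳ-≤ (suc R) (*-monoˡ-≤ U Y≥) ⟩
    suc R * (Y * U)                                                ∎
    where
    open ≤-Reasoning
    D = 2 ^ J
    U = u ^ R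
    v≤ : v ^ R ≤ U
    v≤ = ^-monoˡ-≤ R v≤u
    walk≤ : W * v ^ R ≤ Q * (suc R * U)
    walk≤ = begin
      W * v ^ R                          ≤⟨ *-monoˡ-≤ (v ^ R) W≤ ⟩
      Q * (suc R * κ ^ R) * v ^ R        ≡⟨ eq₃ Q (suc R) (κ ^ R) (v ^ R) ⟩
      Q * (suc R * (κ ^ R * v ^ R))      ≡⟨ cong (λ z → Q * (suc R * z)) (sym (^-distribʳ-* κ v R)) ⟩
      Q * (suc R * (κ * v) ^ R)          ≤⟨ *-monoʳ-≤ Q (*-monoʳ-≤ (suc R) (^-monoˡ-≤ R κv≤u)) ⟩
      Q * (suc R * U)                    ∎
      where
      eq₃ : ∀ a b c d → a * (b * c) * d ≡ a * (b * (c * d))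
      eq₃ = solve-∀
    eq₁ : ∀ c D W e x → (c + D * (suc W + e)) * x ≡ (c + D * suc e) * x + D * (W * x)
    eq₁ = solve-∀
    eq₂ : ∀ c D e U Q R → (c + D * suc e) * U + D * (Q * (suc R * U)) + R * ((c + D * suc e) * U) ≡ suc R * ((c + D * (suc e + Q)) * U)
    eq₂ = solve-∀

  inBox-++ : ∀ {y x α β} → InBox y β → InBox x α → InBox (y ++ x) (β ++ α)
  inBox-++ []       b = b
  inBox-++ (h ∷ hs) b = h ∷ inBox-++ hs b

  dist-++ : ∀ {y x α β} → InBox y β → dist (y ++ x) (β ++ α) ≡ dist y β + dist x α
  dist-++ []                   = refl
  dist-++ {y ∷ _} {β = p ∷ _} (h ∷ hs) = trans (cong (miss y p +_) (dist-++ hs)) (sym (+-assoc (miss y p) _ _))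

  -- Blocks b n h: h = ⌈ n / b ⌉, computed by truncated subtraction as genBody does.
  data Blocks (b : ℕ) : ℕ → ℕ → Set where
    none : Blocks b 0 0
    more : ∀ {n h} → Blocks b (suc n ∸ b) h → Blocks b (suc n) (suc h)

  blocks-0 : ∀ {b n h} → n ≡ 0 → Blocks b n h → h ≡ 0
  blocks-0 refl none = refl

  blocks : ∀ b n → 1 ≤ b → ∃[ h ] Blocks b n h × n ≤ h * b × h * b ≤ n + b
  blocks b n 1≤b = go (suc n) n ≤-refl
    where
    upper : ∀ {n h} → Blocks b (suc n ∸ b) h → h * b ≤ suc n ∸ b + b → b + h * b ≤ suc n + b
    upper {n} {h} B hi with ≤-total b (suc n)
    ... | inj₁ b≤n = ≤-trans (≤-reflexive (+-comm b (h * b))) (+-monoˡ-≤ b (≤-trans hi (≤-reflexive (m∸n+n≡m b≤n))))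
    ... | inj₂ n≤b rewrite blocks-0 (m≤n⇒m∸n≡0 n≤b) B = ≤-trans (≤-reflexive (+-identityʳ b)) (m≤n+m b (suc n))
    go : ∀ f n → n < f → ∃[ h ] Blocks b n h × n ≤ h * b × h * b ≤ n + b
    go (suc f) zero    _ = 0 , none , z≤n , z≤n
    go (suc f) (suc n) (s≤s n<f) with go f (suc n ∸ b) (≤-trans (s≤s (∸-monoʳ-≤ (suc n) 1≤b)) n<f)
    ... | h , B , lo , hi = suc h , more B , ≤-trans (m≤n+m∸n (suc n) b) (+-monoʳ-≤ b lo) , upper B hi

  foldr-pairs : ∀ cs α → foldr _∙_ (encodePairs α) (map encodePair cs) ≡ encodePairs (cs ++ α)
  foldr-pairs []       α = refl
  foldr-pairs (c ∷ cs) α = cong (encodePair c ∙_) (foldr-pairs cs α)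

  foldr-nils : ∀ r R → foldr _∙_ (encodeℕ R) (replicate r nil) ≡ encodeℕ (r + R)
  foldr-nils zero    R = refl
  foldr-nils (suc r) R = cong (nil ∙_) (foldr-nils r R)

  encodeList-map : ∀ {A : Set} (f : A → Tree) xs → encodeList (λ u → u) (map f xs) ≡ encodeList f xs
  encodeList-map f []       = refl
  encodeList-map f (x ∷ xs) = cong (f x ∙_) (encodeList-map f xs)

  -- The search by rounds, and the enumeration of boxes

  module Deciding
    (n d κ ℓ m : ℕ) (b r Δ s : ℕ) (L₁ L₂ : List (List ℕ)) (F : List Pairs)
    (n≤ℓ : n ≤ ℓ) (F-bounded : All (Bounded d) F) (F-range : All (InRange n) F)
    (F-width : All (λ C → length C ≤ suc κ) F) (F-length : length F ≤ m)
    (SAT : Set)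
    (model : ∀ α → length α ≡ ℓ → All (λ p → proj₁ p < d × proj₂ p < d) α → All (λ C → violated C α ≡ false) F → SAT)
    (v : ℕ) (1≤v : 1 ≤ v) (1≤κ : 1 ≤ κ) (1≤Δ : 1 ≤ Δ) (1≤d : 1 ≤ d)
    (code₁ : IsCode d (cyclic d) b r L₁) (code₂ : IsCode (suc κ) hamming (Δ + 2 * s) s L₂)
    (gain : 2 * length L₂ * v ^ Δ ≤ suc (κ * v) ^ Δ)
    where

    open Searching n d κ ℓ m b r Δ s L₁ L₂ F n≤ℓ F-bounded F-range F-width F-length SAT model public
    open Bounded-by ℓ k m

    u : ℕ
    u = suc (κ * v)

    v≤u : v ≤ u
    v≤u = ≤-trans (≤-trans (≤-reflexive (sym (*-identityˡ v))) (*-monoˡ-≤ v 1≤κ)) (n≤1+n (κ * v))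

    v^≢0 : ∀ R → NonZero (v ^ R)
    v^≢0 R = >-nonZero (1≤^ R 1≤v)

    walkCost≤ : ∀ R → walkCost R ≤ Q * (suc R * κ ^ R)
    walkCost≤ zero    = ≤-reflexive (sym (*-identityʳ Q))
    walkCost≤ (suc R) = begin
      Q + κ * walkCost R                              ≤⟨ +-mono-≤ (≤-trans (≤-reflexive (sym (*-identityʳ Q))) (*-monoʳ-≤ Q (1≤^ (suc R) 1≤κ))) (*-monoʳ-≤ κ (walkCost≤ R)) ⟩
      Q * (κ * κ ^ R) + κ * (Q * (suc R * κ ^ R))     ≡⟨ eq Q κ (κ ^ R) R ⟩
      Q * (suc (suc R) * (κ * κ ^ R))                 ∎
      where
      open ≤-Reasoning
      eq : ∀ Q κ x R → Q * (κ * x) + κ * (Q * (suc R * x)) ≡ Q * (suc (suc R) * (κ * x))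
      eq = solve-∀

    -- Adding `fixStep` on both sides turns the recurrence x ↦ 2 x + c into the doubling of x + c.
    fixCost≤ : ∀ R j → fixCost R j + fixStep ≤ 2 ^ j * (suc (walkCost R) + fixStep)
    fixCost≤ R zero    = ≤-reflexive (sym (*-identityˡ _))
    fixCost≤ R (suc j) = begin
      fixStep + (fixCost R j + fixCost R j) + fixStep            ≡⟨ eq₁ fixStep (fixCost R j) ⟩
      2 * (fixCost R j + fixStep)                                ≤⟨ *-monoʳ-≤ 2 (fixCost≤ R j) ⟩
      2 * (2 ^ j * (suc (walkCost R) + fixStep))                 ≡⟨ sym (*-assoc 2 (2 ^ j) _) ⟩
      2 * 2 ^ j * (suc (walkCost R) + fixStep)                   ∎
      where
      open ≤-Reasoning
      eq₁ : ∀ c x → c + (x + x) + c ≡ 2 * (x + c)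
      eq₁ = solve-∀

    weight≤ : ∀ G → All (λ C → length C ≤ k) G → weight G ≤ length G * suc k
    weight≤ []      []       = z≤n
    weight≤ (C ∷ G) (h ∷ hs) = s≤s (+-mono-≤ h (weight≤ G hs))

    -- The largest N with N v^R ≤ (R + 1) Y u^R. Bounds with cleared denominators enter through
    -- `≤searchCost` and leave through `searchCost-spec`.
    searchCost : ℕ → ℕ
    searchCost R = _/_ (suc R * (Y * u ^ R)) (v ^ R) {{v^≢0 R}}

    searchCost-spec : ∀ R → searchCost R * v ^ R ≤ suc R * (Y * u ^ R)
    searchCost-spec R = m/n*n≤m (suc R * (Y * u ^ R)) (v ^ R) {{v^≢0 R}}

    ≤searchCost : ∀ {N} R → N * v ^ R ≤ suc R * (Y * u ^ R) → N ≤ searchCost R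
    ≤searchCost {N} R h = ≤-trans (≤-reflexive (sym (m*n/n≡m N (v ^ R) {{v^≢0 R}}))) (/-monoˡ-≤ (v ^ R) {{v^≢0 R}} h)

    choices : ∀ {x α} t G → t ≤ length G → All (λ C → ∃[ j ] j < k × Hits x α j C) G →
              ∃[ js ] Word k t js × HitsAll x α js G
    choices zero    G       _       _                    = [] , (refl , []) , []
    choices (suc t) (C ∷ G) (s≤s l) ((j , j<k , h) ∷ hs) with choices t G l hs
    ... | js , (|js| , js<k) , hits = j ∷ js , (cong suc |js| , j<k ∷ js<k) , h ∷ hits

    -- The additive form `+ Δ ≤ R` does two jobs: it provides the radius of the recursive call, and
    -- for R < Δ it shows that no solution is near, which justifies giving up.
    progress : ∀ {α R} → Valid α → t ≤ length (greedy d F α) → Near α R →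
      Any (λ w → ∃[ x ] SatAll x F × InBox x (apply w (greedy d F α) α) × dist x (apply w (greedy d F α) α) + Δ ≤ R) L₂
    progress {α} {R} valid t≤ (x , sat , box , dst) = Any.map (λ {w} → step {w}) (IsCode.covers code₂ (proj₁ (proj₂ picked)))
      where
      open Shape valid
      G = greedy d F α
      spec = greedy-spec d F F-bounded F-inRange
      wrongs : All (λ C → ∃[ j ] j < k × Hits x α j C) G
      wrongs = All.zipWith (λ { ((v , sat) , |C|) → let j , j< , h = hits (violated-wrong {x} v sat) in j , ≤-trans j< |C| , h })
        (All.zip (Greedy.allViolated spec , greedy-All α sat) , greedy-All α F-width)
      picked = choices t G t≤ wrongs
      step : ∀ {w} → cov hamming w (proj₁ picked) s ≡ true →
             ∃[ x ] SatAll x F × InBox x (apply w G α) × dist x (apply w G α) + Δ ≤ R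
      step {w} e with apply-near {w} e (Greedy.disjoint spec) (greedy-All α F-inRange) box (proj₂ (proj₂ picked))
      ... | box′ , near = x , sat , box′ , +-cancelʳ-≤ (2 * s) _ _ (begin
          dist x (apply w G α) + Δ + 2 * s         ≡⟨ +-assoc (dist x (apply w G α)) Δ (2 * s) ⟩
          dist x (apply w G α) + t                 ≡⟨ cong (dist x (apply w G α) +_) (sym (trans (cov-length w (proj₁ picked) e) (proj₁ (proj₁ (proj₂ picked))))) ⟩
          dist x (apply w G α) + length w          ≤⟨ near ⟩
          dist x α + 2 * s                         ≤⟨ +-monoˡ-≤ (2 * s) dst ⟩
          R + 2 * s                                ∎)
        where open ≤-Reasoning

    evMonusℕ : ∀ x y → Call fmonus (encodeℕ x ∙ encodeℕ y) (encodeℕ (x ∸ y)) y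
    evMonusℕ x       zero    = evNode evVar (evNil evVar evVar)
    evMonusℕ zero    (suc y) = weaken z≤n (evNode evVar (evNode evVar (evNil evVar evQuoted)))
    evMonusℕ (suc x) (suc y) = evNode evVar (evNode evVar (evNode evVar (evCall (evCons evVar evVar) (evMonusℕ x y))))

    evMonusClauses : ∀ (G : List Pairs) y →
      Call fmonus ((nil ∙ encodeClauses G) ∙ encodeℕ y) (spine (drop y (nil ∷ map encodePairs G))) y
    evMonusClauses G y = subst (λ g → Call fmonus ((nil ∙ g) ∙ encodeℕ y) (spine (drop y (nil ∷ map encodePairs G))) y)
      (encodeList-map encodePairs G) (evMonus (nil ∷ map encodePairs G) y)

    length-drop-clauses : ∀ y (G : List Pairs) → length (drop y (nil ∷ map encodePairs G)) ≡ suc (length G) ∸ y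
    length-drop-clauses y G = trans (length-drop y (nil ∷ map encodePairs G)) (cong (λ l → suc l ∸ y) (length-map encodePairs G))

    evPrepend : ∀ {a} {ρ : Vec Tree a} us {e u} → Ev ρ e u 0 → Ev ρ (prepend us e) (foldr _∙_ u us) 0
    evPrepend []       h = h
    evPrepend (u ∷ us) h = evCons evQuoted (evPrepend us h)

    overhead≤searchCost : ∀ R → overhead ≤ searchCost R
    overhead≤searchCost R = ≤searchCost R (≤-trans (*-mono-≤ overhead≤Y (^-monoˡ-≤ R v≤u)) (m≤m+n _ _))
      where
      overhead≤Y : overhead ≤ Y
      overhead≤Y = ≤-trans (m≤m+n overhead _) (m≤n+m _ (2 * overhead + applyCost))

    search : ∀ f R → R < f → ∀ {α} → Valid α → Decides (input α R ∷ []) searchBody (Near α R) (searchCost R)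
    search (suc f) R (s≤s R≤f) {α} valid
      with drop t (nil ∷ map encodePairs (greedy d F α)) | evMonusClauses (greedy d F α) t | length-drop-clauses t (greedy d F α)
    ... | [] | evm | |G| = decWeaken cost≤ id
          (through (λ h → evNode evVar (evNode evVar (evLet (evCall (evCons evVar evVar) evGreedyF)
               (evNil (evCall (evCons (evCons evQuoted evVar) evQuoted) evm) (evCall (evCons evVar evVar) h)))))
            (fix {R} (greedy d F α) (greedy-All α F-range) valid
              (All.map (λ f v → meets-map inj₂ (f v)) (greedy-maximal d F F-inRange))))
          where
          open Shape valid
          open ≤-Reasoning
          |G|≤t : length (greedy d F α) ≤ t
          |G|≤t = ≤-trans (n≤1+n _) (m∸n≡0⇒m≤n (sym |G|))
          FC = fixCost R (weight (greedy d F α))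
          D = 2 ^ J * (suc (walkCost R) + fixStep)
          fix≤ : FC ≤ D
          fix≤ = begin
            FC                                                                     ≤⟨ m≤m+n FC fixStep ⟩
            FC + fixStep                                                           ≤⟨ fixCost≤ R (weight (greedy d F α)) ⟩
            2 ^ weight (greedy d F α) * (suc (walkCost R) + fixStep)
              ≤⟨ *-monoˡ-≤ (suc (walkCost R) + fixStep) (^-monoʳ-≤ 2 (≤-trans (weight≤ (greedy d F α) (greedy-All α F-width)) (*-monoˡ-≤ (suc k) |G|≤t))) ⟩
            D                                                                      ∎
          cost≤ : suc greedyCost + (suc t + suc FC) ≤ searchCost R
          cost≤ = ≤-trans (begin
              suc greedyCost + (suc t + suc FC)                ≡⟨ sym (eq (suc greedyCost) (suc t) FC) ⟩
              suc greedyCost + (suc t + 1) + FC                ≤⟨ +-mono-≤ (+-monoʳ-≤ (suc greedyCost) (+-monoʳ-≤ (suc t) (s≤s z≤n))) fix≤ ⟩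
              overhead + D                                     ∎)
            (≤searchCost {overhead + D} R (leaf-cost overhead J fixStep Q (walkCost R) R Y {κ} {u} {v} v≤u (n≤1+n (κ * v)) (walkCost≤ R)
              (m≤n+m _ (2 * overhead + applyCost))))
            where
            eq : ∀ g t f → g + (t + 1) + f ≡ g + (t + suc f)
            eq = solve-∀
    ... | x ∷ xs | evm | |G| with suc R ∸ Δ in eqR | evMonusℕ (suc R) Δ
    ... | zero | evr = decFalse
          (weaken cost≤ (evNode evVar (evNode evVar (evLet (evCall (evCons evVar evVar) evGreedyF)
               (evNode (evCall (evCons (evCons evQuoted evVar) evQuoted) evm) (evNil (evCall (evCons (evCons evQuoted evVar) evQuoted) evr) evQuoted))))))
          λ near → Δ≰R (proj₂ (proj₂ (proj₂ (proj₂ (Any.satisfied (progress valid t≤|G| near))))))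
          where
          open Shape valid
          t≤|G| : t ≤ length (greedy d F α)
          t≤|G| = s≤s⁻¹ (m∸n≢0⇒n<m (λ e → contradiction (trans |G| e) λ ()))
          Δ≰R : ∀ {a} → a + Δ ≤ R → ⊥
          Δ≰R {a} h = <⇒≱ (m∸n≡0⇒m≤n {suc R} {Δ} eqR) (≤-trans (m≤n+m Δ a) h)
          cost≤ : suc greedyCost + (suc t + (suc Δ + 0)) ≤ searchCost R
          cost≤ = ≤-trans (≤-reflexive (cong (λ z → suc greedyCost + (suc t + z)) (+-identityʳ (suc Δ)))) (overhead≤searchCost R)
    ... | suc R′ | evr = decWeaken cost≤ good
          (through (λ h → evNode evVar (evNode evVar (evLet (evCall (evCons evVar evVar) evGreedyF)
               (evNode (evCall (evCons (evCons evQuoted evVar) evQuoted) evm) (evNode (evCall (evCons (evCons evQuoted evVar) evQuoted) evr) h)))))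
            (decAny (All.map (λ {w} → flipped {w}) (IsCode.codewords code₂))))
          where
          open Shape valid
          G = greedy d F α
          t≤|G| : t ≤ length G
          t≤|G| = s≤s⁻¹ (m∸n≢0⇒n<m (λ e → contradiction (trans |G| e) λ ()))
          Δ≤ : Δ ≤ suc R
          Δ≤ = <⇒≤ (m∸n≢0⇒n<m (λ e → contradiction (trans (sym eqR) e) λ ()))
          R≡ : R′ + Δ ≡ R
          R≡ = suc-injective (trans (cong (_+ Δ) (sym eqR)) (m∸n+n≡m Δ≤))
          R′<f : R′ < f
          R′<f = ≤-trans (≤-trans (≤-reflexive (+-comm 1 R′)) (≤-trans (+-monoʳ-≤ R′ 1≤Δ) (≤-reflexive R≡))) R≤f
          M = suc (t * (2 + flipCost)) + 0 + suc (searchCost R′)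
          flipped : ∀ {w x₀ x₂ x₃ x₅ x₈ x₉} → Word k t w →
            Decides (x₀ ∷ encodeℕ R′ ∷ x₂ ∷ x₃ ∷ encodeClauses G ∷ x₅ ∷ encodeClauses F ∷ encodePairs α ∷ x₈ ∷ x₉ ∷ [])
                    (flipBy w) (Near (apply w G α) R′) M
          flipped {w} (|w| , _) = through
            (evCall (evCons (evCall (evCons evQuoted (evCons evVar evVar))
                                    (weaken (≤-reflexive (cong (_* (2 + flipCost)) |w|)) (evApply w G α (greedy-All α F-width) |α|)))
                            (evCons evVar evVar)))
            (search f R′ R′<f (applyValid w (greedy-All α F-range) valid))
          good : Near α R → Any (λ w → Near (apply w G α) R′) L₂
          good near = Any.map (λ { (x , sat , box , le) → x , sat , box , +-cancelʳ-≤ Δ _ _ (≤-trans le (≤-reflexive (sym R≡))) }) (progress valid t≤|G| near)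
          cost≤ : suc greedyCost + (suc t + (suc Δ + length L₂ * M)) ≤ searchCost R
          cost≤ = ≤-trans (≤-reflexive (trans (eq₁ (suc greedyCost) (suc t) (suc Δ) (length L₂ * M))
                                              (cong (λ z → overhead + length L₂ * z) (eq₂ (t * (2 + flipCost)) (searchCost R′)))))
            (≤searchCost R (subst (λ R → (overhead + length L₂ * (applyCost + searchCost R′)) * v ^ R ≤ suc R * (Y * u ^ R)) R≡
              (round-cost overhead applyCost (length L₂) (searchCost R′) R′ Δ Y v≤u (m≤m+n _ _) gain (searchCost-spec R′))))
            where
            eq₁ : ∀ a b c x → a + (b + (c + x)) ≡ a + (b + c) + x
            eq₁ = solve-∀
            eq₂ : ∀ x y → suc x + 0 + suc y ≡ 2 + x + y
            eq₂ = solve-∀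

    -- The list x is a suffix of a solution, with h blocks yet to be put in front. This follows
    -- `gen`, which builds the box from its last block to its first.
    data Extends : ℕ → List ℕ → Set where
      none : ∀ {x} → SatAll x F → Extends 0 x
      more : ∀ {h y x} → Word d b y → Extends h (y ++ x) → Extends (suc h) x

    Reachable : ℕ → Pairs → ℕ → Set
    Reachable h α R = ∃[ x ] Extends h x × InBox x α × dist x α ≤ R

    extends : ∀ h {x} z → length x ≡ h * b → All (_< d) x → SatAll (x ++ z) F → Extends h z
    extends zero    {[]} z _   _   sat = none sat
    extends (suc h) {x}  z |x| x<d sat = more (|y| , All.drop⁺ (h * b) x<d)
      (extends h (drop (h * b) x ++ z)
        (trans (length-take (h * b) x) (m≤n⇒m⊓n≡m (≤-trans (m≤n+m (h * b) b) (≤-reflexive (sym |x|)))))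
        (All.take⁺ (h * b) x<d)
        (subst (λ x → SatAll x F) (trans (cong (_++ z) (sym (take++drop≡id (h * b) x))) (++-assoc (take (h * b) x) _ z)) sat))
      where
      |y| : length (drop (h * b) x) ≡ b
      |y| = trans (length-drop (h * b) x) (trans (cong (_∸ h * b) |x|) (m+n∸n≡m b (h * b)))

    box-covers : ∀ c y {r} → cov (cyclic d) c y r ≡ true → InBox y (cells c) × dist y (cells c) ≤ r
    box-covers []      []      _ = [] , z≤n
    box-covers (c ∷ cs) (y ∷ ys) {r} e with y ≡ᵇ c in eqc | y ≡ᵇ next d c in eqn
    ... | true | _ with box-covers cs ys e
    ... | box , dst = inj₁ (≡ᵇ-true⇒≡ y c eqc) ∷ box , dst
    box-covers (c ∷ cs) (y ∷ ys) {suc r} e | false | true with box-covers cs ys e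
    ... | box , dst = inj₂ (≡ᵇ-true⇒≡ y (next d c) eqn) ∷ box , s≤s dst

    cells-valid : ∀ {c} → All (_< d) c → All (λ p → proj₁ p < d × proj₂ p < d) (cells c)
    cells-valid []       = []
    cells-valid (h ∷ hs) = (h , next< 1≤d h) ∷ cells-valid hs

    1≤M : 1 ≤ length L₁
    1≤M = nonempty (IsCode.covers code₁ (some b))
      where
      nonempty : ∀ {P : List ℕ → Set} {L} → Any P L → 1 ≤ length L
      nonempty (here _)  = s≤s z≤n
      nonempty (there _) = s≤s z≤n
      some : ∀ b → Word d b (replicate b 0)
      some b = length-replicate b , All.replicate⁺ b 1≤d

    genCost : ℕ → ℕ → ℕ
    genCost S h = suc h * (length L₁ ^ h * (2 + b + S))

    -- Every block adds exactly r to the radius, so the invariant `h * r + R ≡ R₀` gives all leaves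
    -- the same search cost. The factor `suc h` in `genCost` pays for the levels of the enumeration
    -- tree.
    gen : ∀ {R₀} h {n′ α R} → Blocks b n′ h → h * b + length α ≡ ℓ → All (λ p → proj₁ p < d × proj₂ p < d) α →
          h * r + R ≡ R₀ →
          Decides ((encodeℕ n′ ∙ input α R) ∷ []) genBody (Reachable h α R) (genCost (searchCost R₀) h)
    gen {R₀} zero {R = R} none |α| α< refl =
      decWeaken cost≤ (λ { (x , none sat , box , dst) → x , sat , box , dst })
        (through (λ h → evNode evVar (evNil evVar (evCall evVar h))) (search (suc R) R ≤-refl (mkValid |α| α<)))
      where
      S = searchCost R
      cost≤ : suc S ≤ 1 * (1 * (2 + b + S))
      cost≤ = ≤-trans (s≤s (≤-trans (m≤n+m S b) (n≤1+n _))) (≤-reflexive (sym (trans (*-identityˡ _) (*-identityˡ _))))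
    gen {R₀} (suc h) {suc n′} {α} {R} (more B) |α| α< R≡ =
      decWeaken cost≤ good
        (through (λ h → evNode evVar (evNode evVar (evNode evVar (evNode evVar (evLet (evCall (evCons evVar evQuoted) (evMonusℕ (suc n′) b)) h)))))
          (decAny (All.map (λ {c} → extended {c}) (IsCode.codewords code₁))))
      where
      S = searchCost R₀
      M = length L₁
      extended : ∀ {c x₃ x₄ x₅ x₆ x₇ x₈} → Word d b c →
        Decides (encodeℕ (suc n′ ∸ b) ∷ encodeℕ R ∷ encodeClauses F ∷ encodePairs α ∷ x₃ ∷ x₄ ∷ x₅ ∷ x₆ ∷ x₇ ∷ x₈ ∷ [])
                (extendBy c) (Reachable h (cells c ++ α) (r + R)) (suc (genCost S h))
      extended {c} (|c| , c<d) = through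
        (evCall (evCons evVar (evCons (subst (λ v → Ev _ _ v 0) (foldr-pairs (cells c) α) (evPrepend (map encodePair (cells c)) evVar))
                              (evCons (subst (λ v → Ev _ _ v 0) (foldr-nils r R) (evPrepend (replicate r nil) evVar)) evVar))))
        (gen h B (trans (cong (h * b +_) (trans (length-++ (cells c)) (cong (_+ length α) (trans (length-map _ c) |c|))))
                        (trans (eq h b (length α)) |α|))
                 (All.++⁺ (cells-valid c<d) α<) (trans (eq h r R) R≡))
        where
        eq : ∀ h b a → h * b + (b + a) ≡ b + h * b + a
        eq = solve-∀
      good : Reachable (suc h) α R → Any (λ c → Reachable h (cells c ++ α) (r + R)) L₁
      good (x , more {y = y} word ext , box , dst) = Any.map step (IsCode.covers code₁ word)
        where
        step : ∀ {c} → cov (cyclic d) c y r ≡ true → Reachable h (cells c ++ α) (r + R)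
        step {c} e with box-covers c y e
        ... | box′ , dst′ = y ++ x , ext , inBox-++ box′ box , ≤-trans (≤-reflexive (dist-++ box′)) (+-mono-≤ dst′ dst)
      cost≤ : suc b + M * suc (genCost S h) ≤ genCost S (suc h)
      cost≤ = begin
        suc b + M * suc (suc h * (M ^ h * Z))                ≡⟨ eq₁ (suc b) M (suc h) (M ^ h) Z ⟩
        (suc b + M) + suc h * (M * M ^ h * Z)                ≤⟨ +-monoˡ-≤ _ own≤ ⟩
        M * M ^ h * Z + suc h * (M * M ^ h * Z)              ∎
        where
        open ≤-Reasoning
        Z = 2 + b + S
        eq₁ : ∀ b M h x Z → b + M * suc (h * (x * Z)) ≡ (b + M) + h * (M * x * Z)
        eq₁ = solve-∀
        own≤ : suc b + M ≤ M * M ^ h * Z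
        own≤ = begin
          suc b + M                ≤⟨ +-monoˡ-≤ M (≤-trans (≤-reflexive (sym (*-identityˡ (suc b)))) (*-monoˡ-≤ (suc b) 1≤M)) ⟩
          M * suc b + M            ≡⟨ eq₂ M b ⟩
          M * 1 * (2 + b)          ≤⟨ *-mono-≤ (*-monoʳ-≤ M (1≤^ h 1≤M)) (m≤m+n (2 + b) S) ⟩
          M * M ^ h * Z            ∎
          where
          eq₂ : ∀ M b → M * suc b + M ≡ M * 1 * (2 + b)
          eq₂ = solve-∀

    main : ∀ h → Blocks b n h → h * b ≡ ℓ →
      Decides ((encodeℕ n ∙ encodeClauses F) ∷ []) mainBody (∃[ x ] length x ≡ ℓ × All (_< d) x × SatAll x F)
              (suc (genCost (searchCost (h * r)) h))
    main h B hb≡ = decWeaken ≤-refl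
      (λ { (x , |x| , x<d , sat) → [] , extends h [] (trans |x| (sym hb≡)) x<d (subst (λ x → SatAll x F) (sym (++-identityʳ x)) sat) , [] , z≤n })
      (through (λ h → evNode evVar (evCall (evCons evVar (evCons evQuoted (evCons evQuoted evVar))) h))
        (gen h B (trans (+-identityʳ (h * b)) hb≡) [] (+-identityʳ (h * r))))

-- Polynomial bounds, and the number of distinct clauses

module Complexity where

  open import Data.Integer using (+_; +[1+_])
  open import Data.Nat
  open Algorithm
  module ℚ^ = Algebra.Definitions.RawSemiring ℚ.+-*-rawSemiring

  PolyBounded : (ℕ → ℕ) → Set
  PolyBounded f = ∃₂ λ a c → ∀ n → f n ≤ a * suc n ^ c

  poly-const : ∀ a → PolyBounded (λ _ → a)
  poly-const a = a , 0 , λ _ → ≤-reflexive (sym (*-identityʳ a))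

  poly-id : PolyBounded (λ n → n)
  poly-id = 1 , 1 , λ n → ≤-trans (n≤1+n n) (≤-reflexive (sym (trans (*-identityˡ _) (*-identityʳ (suc n)))))

  poly-≤ : ∀ {f g} → (∀ n → f n ≤ g n) → PolyBounded g → PolyBounded f
  poly-≤ h (a , c , p) = a , c , λ n → ≤-trans (h n) (p n)

  infixl 6 _⊕_
  infixl 7 _⊗_

  _⊕_ : ∀ {f g} → PolyBounded f → PolyBounded g → PolyBounded (λ n → f n + g n)
  (a , c , p) ⊕ (a′ , c′ , p′) = a + a′ , c + c′ , λ n → ≤-trans
    (+-mono-≤ (≤-trans (p n) (*-monoʳ-≤ a (^-monoʳ-≤ (suc n) (m≤m+n c c′))))
              (≤-trans (p′ n) (*-monoʳ-≤ a′ (^-monoʳ-≤ (suc n) (m≤n+m c′ c)))))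
    (≤-reflexive (sym (*-distribʳ-+ (suc n ^ (c + c′)) a a′)))

  _⊗_ : ∀ {f g} → PolyBounded f → PolyBounded g → PolyBounded (λ n → f n * g n)
  (a , c , p) ⊗ (a′ , c′ , p′) = a * a′ , c + c′ , λ n → ≤-trans (*-mono-≤ (p n) (p′ n))
    (≤-reflexive (trans (eq a (suc n ^ c) a′ (suc n ^ c′)) (cong (a * a′ *_) (sym (^-distribˡ-+-* (suc n) c c′)))))
    where
    eq : ∀ a x b y → a * x * (b * y) ≡ a * b * (x * y)
    eq = solve-∀

  poly-suc : ∀ {f} → PolyBounded f → PolyBounded (λ n → suc (f n))
  poly-suc p = poly-const 1 ⊕ p

  -- The number 1 + a + ... + a^k of lists of at most k literals out of a. Since constraints are not
  -- repeated, it bounds the length of the formula by a polynomial in n.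
  clauseCount : ℕ → ℕ → ℕ
  clauseCount a zero    = 1
  clauseCount a (suc k) = suc (a * clauseCount a k)

  poly-clauseCount : ∀ {f} → PolyBounded f → ∀ k → PolyBounded (λ n → clauseCount (f n) k)
  poly-clauseCount p zero    = poly-const 1
  poly-clauseCount p (suc k) = poly-suc (p ⊗ poly-clauseCount p k)

  module _ {d n : ℕ} where

    literalCode : Literal d n → Fin (n * d)
    literalCode (i , c) = Fin.combine i c

    literalCode-injective : ∀ {p q} → literalCode p ≡ literalCode q → p ≡ q
    literalCode-injective {i , c} {j , c′} e with Fin.combine-injective i c j c′ e
    ... | refl , refl = refl

    clauseCode : ∀ k (C : Constraint d n) → Fin (clauseCount (n * d) k)
    clauseCode zero    C       = zero
    clauseCode (suc k) []      = zero
    clauseCode (suc k) (p ∷ C) = suc (Fin.combine (literalCode p) (clauseCode k C))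

    clauseCode-injective : ∀ k {C C′} → length C ≤ k → length C′ ≤ k → clauseCode k C ≡ clauseCode k C′ → C ≡ C′
    clauseCode-injective zero    {[]}    {[]}     _       _        _ = refl
    clauseCode-injective (suc k) {[]}    {[]}     _       _        _ = refl
    clauseCode-injective (suc k) {p ∷ C} {q ∷ C′} (s≤s h) (s≤s h′) e
      with Fin.combine-injective (literalCode p) (clauseCode k C) (literalCode q) (clauseCode k C′) (Fin.suc-injective e)
    ... | e₁ , e₂ = cong₂ _∷_ (literalCode-injective e₁) (clauseCode-injective k h h′ e₂)

  lookup-injective : ∀ {A : Set} {xs : List A} → Unique xs → ∀ {i j} → List.lookup xs i ≡ List.lookup xs j → i ≡ j
  lookup-injective (_ ∷ _)  {zero}  {zero}  e = refl
  lookup-injective (h ∷ _)  {zero}  {suc j} e = contradiction e (All.lookup h (∈-lookup j))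
  lookup-injective (h ∷ _)  {suc i} {zero}  e = contradiction (sym e) (All.lookup h (∈-lookup i))
  lookup-injective (_ ∷ us) {suc i} {suc j} e = cong suc (lookup-injective us e)

  constraints-length : ∀ {d k n} (F : CSP d k n) → length (constraints F) ≤ clauseCount (n * d) k
  constraints-length {d} {k} {n} F = Fin.injective⇒≤ {f = λ i → clauseCode k (List.lookup (constraints F) i)} λ {i} {j} e →
    lookup-injective (distinct F) (clauseCode-injective k (All.lookup (width F) (∈-lookup i)) (All.lookup (width F) (∈-lookup j)) e)

  -- Formulas as lists of numbers

  rawLiteral : ∀ {d n} → Literal d n → ℕ × ℕ
  rawLiteral (i , c) = toℕ i , toℕ c

  raw : ∀ {d k n} → CSP d k n → List Pairs
  raw F = map (map rawLiteral) (constraints F)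

  encodeList-raw : ∀ {A B : Set} {g : A → B} {f : A → Tree} {f′ : B → Tree} → (∀ x → f x ≡ f′ (g x)) →
                   ∀ xs → encodeList f xs ≡ encodeList f′ (map g xs)
  encodeList-raw h []       = refl
  encodeList-raw h (x ∷ xs) = cong₂ _∙_ (h x) (encodeList-raw h xs)

  encodeCSP≡ : ∀ {d k n} (F : CSP d k n) → encodeCSP F ≡ encodeℕ n ∙ encodeClauses (raw F)
  encodeCSP≡ F = cong (_ ∙_) (encodeList-raw (encodeList-raw (λ _ → refl)) (constraints F))

  module _ {d k n : ℕ} (F : CSP d k n) where

    raw-bounded : All (Bounded d) (raw F)
    raw-bounded = All.map⁺ (All.universal (λ C → All.map⁺ (All.universal (λ p → toℕ<n (proj₂ p)) C)) (constraints F))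

    raw-range : All (InRange n) (raw F)
    raw-range = All.map⁺ (All.universal (λ C → All.map⁺ (All.universal (λ p → toℕ<n (proj₁ p)) C)) (constraints F))

    raw-width : All (λ C → length C ≤ k) (raw F)
    raw-width = All.map⁺ (All.map (λ {C} h → ≤-trans (≤-reflexive (length-map rawLiteral C)) h) (width F))

    raw-length : length (raw F) ≤ clauseCount (n * d) k
    raw-length = ≤-trans (≤-reflexive (length-map (map rawLiteral) (constraints F))) (constraints-length F)

    raw-model : ∀ {ℓ} → n ≤ ℓ → ∀ α → length α ≡ ℓ → All (λ p → proj₁ p < d × proj₂ p < d) α →
                All (λ C → violated C α ≡ false) (raw F) → Satisfiable F
    raw-model n≤ℓ α refl α<d sat = β , All.map (λ {C} e → Any.map (satisfied _) (Any.map⁻ (violated-false (map rawLiteral C) {α} e))) (All.map⁻ sat)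
      where
      current< : ∀ i → current α (toℕ i) < d
      current< i = proj₁ (look-All α<d (≤-trans (toℕ<n i) n≤ℓ))
      β : Assignment d n
      β i = fromℕ< (current< i)
      satisfied : ∀ p → current α (toℕ (proj₁ p)) ≢ toℕ (proj₂ p) → SatisfiesLiteral β p
      satisfied (i , c) h e = h (trans (sym (toℕ-fromℕ< (current< i))) (cong toℕ e))

    raw-complete : ∀ {ℓ} → 1 ≤ d → n ≤ ℓ → Satisfiable F → ∃[ x ] length x ≡ ℓ × All (_< d) x × SatAll x (raw F)
    raw-complete {ℓ} 1≤d n≤ℓ (β , sat) = applyUpTo value ℓ , length-applyUpTo value ℓ , All.applyUpTo⁺₁ value ℓ (λ {i} _ → value< i) ,
        All.map⁺ (All.map (λ s → Any.map⁺ (Any.map satisfied s)) sat)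
      where
      value : ℕ → ℕ
      value i with i <? n
      ... | yes i<n = toℕ (β (fromℕ< i<n))
      -- A padding variable of the last block occurs in no clause, so that any value below d will
      -- do.
      ... | no _    = 0
      value< : ∀ i → value i < d
      value< i with i <? n
      ... | yes i<n = toℕ<n _
      ... | no _    = 1≤d
      value≡ : ∀ i → value (toℕ i) ≡ toℕ (β i)
      value≡ i with toℕ i <? n
      ... | yes h = cong (toℕ ∘ β) (fromℕ<-toℕ i h)
      ... | no ¬h = contradiction (toℕ<n i) ¬h
      at-applyUpTo : ∀ f {i l} → i < l → at (applyUpTo f l) i ≡ f i
      at-applyUpTo f {zero}  (s≤s _) = refl
      at-applyUpTo f {suc i} (s≤s h) = at-applyUpTo (f ∘ suc) h
      satisfied : ∀ {p} → SatisfiesLiteral β p → at (applyUpTo value ℓ) (toℕ (proj₁ p)) ≢ toℕ (proj₂ p)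
      satisfied {i , c} h e = h (toℕ-injective (trans (sym (value≡ i)) (trans (sym (at-applyUpTo value (≤-trans (toℕ<n i) n≤ℓ))) e)))

  -- From natural numbers to rational rates

  fromℚᵘ-fromℕ : ∀ n → toℚᵘ (fromℕ n) ℚᵘ.≃ mkℚᵘ (+ n) 0
  fromℚᵘ-fromℕ n = ℚ.toℚᵘ-fromℚᵘ (mkℚᵘ (+ n) 0)

  fromℕ-* : ∀ a b → fromℕ (a * b) ≡ fromℕ a ℚ.* fromℕ b
  fromℕ-* a b = ℚ.toℚᵘ-injective (begin
    toℚᵘ (fromℕ (a * b))                      ≈⟨ fromℚᵘ-fromℕ (a * b) ⟩
    mkℚᵘ (+ (a * b)) 0                        ≈⟨ ℚᵘ.*≡* (cong (ℤ._* + 1) (ℤ.pos-* a b)) ⟩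
    mkℚᵘ (+ a) 0 ℚᵘ.* mkℚᵘ (+ b) 0            ≈⟨ ℚᵘ.*-cong (ℚᵘ.≃-sym (fromℚᵘ-fromℕ a)) (ℚᵘ.≃-sym (fromℚᵘ-fromℕ b)) ⟩
    toℚᵘ (fromℕ a) ℚᵘ.* toℚᵘ (fromℕ b)        ≈⟨ ℚᵘ.≃-sym (ℚ.toℚᵘ-homo-* (fromℕ a) (fromℕ b)) ⟩
    toℚᵘ (fromℕ a ℚ.* fromℕ b)                ∎)
    where open import Relation.Binary.Reasoning.Setoid ℚᵘ.≃-setoid

  fromℕ-mono : ∀ {a b} → a ≤ b → fromℕ a ℚ.≤ fromℕ b
  fromℕ-mono {a} {b} h = ℚ.toℚᵘ-cancel-≤ (begin
    toℚᵘ (fromℕ a)   ≃⟨ fromℚᵘ-fromℕ a ⟩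
    mkℚᵘ (+ a) 0     ≤⟨ ℚᵘ.*≤* (ℤ.*-monoʳ-≤-nonNeg (+ 1) (ℤ.+≤+ h)) ⟩
    mkℚᵘ (+ b) 0     ≃⟨ ℚᵘ.≃-sym (fromℚᵘ-fromℕ b) ⟩
    toℚᵘ (fromℕ b)   ∎)
    where open ℚᵘ.≤-Reasoning

  fromℕ-nonNeg : ∀ n → ℚ.NonNegative (fromℕ n)
  fromℕ-nonNeg n = ℚ.normalize-nonNeg n 1

  power-bound : ∀ {X Y g} .{{_ : ℚ.NonNegative g}} → fromℕ X ℚ.≤ fromℕ Y ℚ.* g → ∀ n → fromℕ (X ^ n) ℚ.≤ fromℕ (Y ^ n) ℚ.* g ℚ^.^ n
  power-bound h zero = ℚ.≤-refl
  power-bound {X} {Y} {g} h (suc n) = begin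
    fromℕ (X * X ^ n)                                      ≡⟨ fromℕ-* X (X ^ n) ⟩
    fromℕ X ℚ.* fromℕ (X ^ n)                              ≤⟨ ℚ.*-monoʳ-≤-nonNeg (fromℕ (X ^ n)) {{fromℕ-nonNeg (X ^ n)}} h ⟩
    fromℕ Y ℚ.* g ℚ.* fromℕ (X ^ n)                        ≤⟨ ℚ.*-monoˡ-≤-nonNeg (fromℕ Y ℚ.* g) {{ℚ.nonNeg*nonNeg⇒nonNeg (fromℕ Y) {{fromℕ-nonNeg Y}} g}} (power-bound h n) ⟩
    fromℕ Y ℚ.* g ℚ.* (fromℕ (Y ^ n) ℚ.* g ℚ^.^ n)         ≡⟨ eq (fromℕ Y) g (fromℕ (Y ^ n)) (g ℚ^.^ n) ⟩
    fromℕ Y ℚ.* fromℕ (Y ^ n) ℚ.* (g ℚ.* g ℚ^.^ n)         ≡⟨ cong (ℚ._* (g ℚ.* g ℚ^.^ n)) (sym (fromℕ-* Y (Y ^ n))) ⟩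
    fromℕ (Y * Y ^ n) ℚ.* (g ℚ.* g ℚ^.^ n)                 ∎
    where
    open ℚ.≤-Reasoning
    eq : ∀ a b c e → a ℚ.* b ℚ.* (c ℚ.* e) ≡ a ℚ.* c ℚ.* (b ℚ.* e)
    eq a b c e = trans (ℚ.*-assoc a b (c ℚ.* e)) (trans (cong (a ℚ.*_) (trans (sym (ℚ.*-assoc b c e))
      (trans (cong (ℚ._* e) (ℚ.*-comm b c)) (ℚ.*-assoc c b e)))) (sym (ℚ.*-assoc a c (b ℚ.* e))))

  rate-bound : ∀ {N C X Y g n} .{{_ : ℚ.NonNegative g}} → 1 ≤ Y → fromℕ X ℚ.≤ fromℕ Y ℚ.* g → N * Y ^ n ≤ C * X ^ n →
               fromℕ N ℚ.≤ fromℕ C ℚ.* g ℚ^.^ n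
  rate-bound {N} {C} {X} {Y} {g} {n} 1≤Y h hN = ℚ.*-cancelʳ-≤-pos (fromℕ (Y ^ n)) {{ℚ.normalize-pos (Y ^ n) 1 {{_}} {{>-nonZero (1≤^ n 1≤Y)}}}} (begin
    fromℕ N ℚ.* fromℕ (Y ^ n)                          ≡⟨ sym (fromℕ-* N (Y ^ n)) ⟩
    fromℕ (N * Y ^ n)                                  ≤⟨ fromℕ-mono hN ⟩
    fromℕ (C * X ^ n)                                  ≡⟨ fromℕ-* C (X ^ n) ⟩
    fromℕ C ℚ.* fromℕ (X ^ n)                          ≤⟨ ℚ.*-monoˡ-≤-nonNeg (fromℕ C) {{fromℕ-nonNeg C}} (power-bound h n) ⟩
    fromℕ C ℚ.* (fromℕ (Y ^ n) ℚ.* g ℚ^.^ n)           ≡⟨ cong (fromℕ C ℚ.*_) (ℚ.*-comm (fromℕ (Y ^ n)) (g ℚ^.^ n)) ⟩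
    fromℕ C ℚ.* (g ℚ^.^ n ℚ.* fromℕ (Y ^ n))           ≡⟨ sym (ℚ.*-assoc (fromℕ C) (g ℚ^.^ n) (fromℕ (Y ^ n))) ⟩
    fromℕ C ℚ.* g ℚ^.^ n ℚ.* fromℕ (Y ^ n)             ∎)
    where open ℚ.≤-Reasoning

  -- a / k + 1 / q = (a q + k) / (k q) is below the rate a / k + ε if 1 / q ≤ ε.
  rate≥ : ∀ a κ p q .(c : Coprime (suc p) (suc q)) → fromℕ (a * suc q + suc κ) ℚ.≤ fromℕ (suc κ * suc q) ℚ.* ((+ a) ℚ./ suc κ ℚ.+ mkℚ +[1+ p ] q c)
  rate≥ a κ p q c = ℚ.toℚᵘ-cancel-≤ (begin
    toℚᵘ (fromℕ X)                                                        ≃⟨ fromℚᵘ-fromℕ X ⟩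
    mkℚᵘ (+ X) 0                                                          ≤⟨ ℚᵘ.*≤* (subst₂ ℤ._≤_ lhs rhs (ℤ.+≤+ in-ℕ)) ⟩
    mkℚᵘ (+ Y) 0 ℚᵘ.* (mkℚᵘ (+ a) κ ℚᵘ.+ mkℚᵘ +[1+ p ] q)                 ≃⟨ ℚᵘ.*-cong (ℚᵘ.≃-sym (fromℚᵘ-fromℕ Y)) (ℚᵘ.+-cong (ℚᵘ.≃-sym (ℚ.toℚᵘ-fromℚᵘ (mkℚᵘ (+ a) κ))) ℚᵘ.≃-refl) ⟩
    toℚᵘ (fromℕ Y) ℚᵘ.* (toℚᵘ ((+ a) ℚ./ suc κ) ℚᵘ.+ toℚᵘ ε)              ≃⟨ ℚᵘ.*-cong (ℚᵘ.≃-refl {toℚᵘ (fromℕ Y)}) (ℚᵘ.≃-sym (ℚ.toℚᵘ-homo-+ ((+ a) ℚ./ suc κ) ε)) ⟩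
    toℚᵘ (fromℕ Y) ℚᵘ.* toℚᵘ ((+ a) ℚ./ suc κ ℚ.+ ε)                      ≃⟨ ℚᵘ.≃-sym (ℚ.toℚᵘ-homo-* (fromℕ Y) _) ⟩
    toℚᵘ (fromℕ Y ℚ.* ((+ a) ℚ./ suc κ ℚ.+ ε))                            ∎)
    where
    open ℚᵘ.≤-Reasoning
    ε = mkℚ +[1+ p ] q c
    X = a * suc q + suc κ
    Y = suc κ * suc q
    in-ℕ : X * (1 * (suc κ * suc q)) ≤ Y * (a * suc q + suc p * suc κ) * 1
    in-ℕ = ≤-trans (m≤m+n _ (suc κ * suc q * (p * suc κ))) (≤-reflexive (eq a κ p q))
      where
      eq : ∀ a κ p q → (a * suc q + suc κ) * (1 * (suc κ * suc q)) + suc κ * suc q * (p * suc κ) ≡ suc κ * suc q * (a * suc q + suc p * suc κ) * 1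
      eq = solve-∀
    lhs : + (X * (1 * (suc κ * suc q))) ≡ + X ℤ.* + (1 * (suc κ * suc q))
    lhs = ℤ.pos-* X (1 * (suc κ * suc q))
    rhs : + (Y * (a * suc q + suc p * suc κ) * 1) ≡ + Y ℤ.* (+ a ℤ.* + suc q ℤ.+ + suc p ℤ.* + suc κ) ℤ.* + 1
    rhs = trans (ℤ.pos-* (Y * (a * suc q + suc p * suc κ)) 1) (cong (ℤ._* + 1) (trans (ℤ.pos-* Y _)
      (cong (+ Y ℤ.*_) (trans (ℤ.pos-+ (a * suc q) (suc p * suc κ)) (cong₂ ℤ._+_ (ℤ.pos-* a (suc q)) (ℤ.pos-* (suc p) (suc κ)))))))

  -- Raised to the power h, the size condition of the code contains the factor (v / u)^(h r), which
  -- cancels the exponential part of the cost of a search at distance h r. Rounding n up to h b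
  -- costs only the constant factor X^b.
  box-search-cost : ∀ c {h b r n M S Y u v X D} → 1 ≤ v → v ≤ u → 1 ≤ X → 1 ≤ D → n ≤ h * b → h * b ≤ n + b →
    M * (u ^ r * D ^ b) ≤ X ^ b * v ^ r → S * v ^ (h * r) ≤ suc (h * r) * (Y * u ^ (h * r)) →
    M ^ h * (c + S) * D ^ n ≤ (c + suc (h * r) * Y) * X ^ b * X ^ n
  box-search-cost c {h} {b} {r} {n} {M} {S} {Y} {u} {v} {X} {D} 1≤v v≤u 1≤X 1≤D n≤hb hb≤ size S≤ =
    *-cancelʳ-≤ _ _ (v ^ R) {{>-nonZero (1≤^ R 1≤v)}} (begin
      M ^ h * (c + S) * D ^ n * v ^ R                      ≤⟨ *-monoˡ-≤ (v ^ R) (*-monoʳ-≤ (M ^ h * (c + S)) (^-monoʳ-≤ D {{>-nonZero 1≤D}} n≤hb)) ⟩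
      M ^ h * (c + S) * D ^ (h * b) * v ^ R                ≡⟨ eq₁ (M ^ h) c S (D ^ (h * b)) (v ^ R) ⟩
      M ^ h * D ^ (h * b) * (c * v ^ R + S * v ^ R)        ≤⟨ *-monoʳ-≤ (M ^ h * D ^ (h * b)) (+-mono-≤ (*-monoʳ-≤ c (^-monoˡ-≤ R v≤u)) S≤) ⟩
      M ^ h * D ^ (h * b) * (c * u ^ R + suc R * (Y * u ^ R))
                                                           ≡⟨ eq₂ (M ^ h) (D ^ (h * b)) c (u ^ R) (suc R) Y ⟩
      (c + suc R * Y) * (M ^ h * (u ^ R * D ^ (h * b)))    ≤⟨ *-monoʳ-≤ (c + suc R * Y) all-blocks ⟩
      (c + suc R * Y) * (X ^ (h * b) * v ^ R)              ≤⟨ *-monoʳ-≤ (c + suc R * Y) (*-monoˡ-≤ (v ^ R) (^-monoʳ-≤ X {{>-nonZero 1≤X}} hb≤)) ⟩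
      (c + suc R * Y) * (X ^ (n + b) * v ^ R)              ≡⟨ cong (λ z → (c + suc R * Y) * (z * v ^ R)) (^-distribˡ-+-* X n b) ⟩
      (c + suc R * Y) * (X ^ n * X ^ b * v ^ R)            ≡⟨ eq₃ (c + suc R * Y) (X ^ n) (X ^ b) (v ^ R) ⟩
      (c + suc R * Y) * X ^ b * X ^ n * v ^ R              ∎)
    where
    open ≤-Reasoning
    R = h * r
    eq₁ : ∀ m c s d v → m * (c + s) * d * v ≡ m * d * (c * v + s * v)
    eq₁ = solve-∀
    eq₂ : ∀ m d c u r y → m * d * (c * u + r * (y * u)) ≡ (c + r * y) * (m * (u * d))
    eq₂ = solve-∀
    eq₃ : ∀ a b c d → a * (b * c * d) ≡ a * c * b * d
    eq₃ = solve-∀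
    power : ∀ x i → (x ^ i) ^ h ≡ x ^ (h * i)
    power x i = trans (^-*-assoc x i h) (cong (x ^_) (*-comm i h))
    all-blocks : M ^ h * (u ^ R * D ^ (h * b)) ≤ X ^ (h * b) * v ^ R
    all-blocks = begin
      M ^ h * (u ^ R * D ^ (h * b))              ≡⟨ cong (M ^ h *_) (sym (trans (^-distribʳ-* (u ^ r) (D ^ b) h) (cong₂ _*_ (power u r) (power D b)))) ⟩
      M ^ h * (u ^ r * D ^ b) ^ h                ≡⟨ sym (^-distribʳ-* M (u ^ r * D ^ b) h) ⟩
      (M * (u ^ r * D ^ b)) ^ h                  ≤⟨ ^-monoˡ-≤ h size ⟩
      (X ^ b * v ^ r) ^ h                        ≡⟨ trans (^-distribʳ-* (X ^ b) (v ^ r) h) (cong₂ _*_ (power X b) (power v r)) ⟩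
      X ^ (h * b) * v ^ R                        ∎

  -- Choice of the constants, and the running time

  -- With β = u / v slightly above k - 1, the box code gives the rate d β / (β + 1),
  -- which is below X / D = d (k - 1) / k + 1 / (1 + q).
  module Assembly (d κ q : ℕ) (2≤d : 2 ≤ d) (1≤κ : 1 ≤ κ) where

    k v u X D : ℕ
    k = suc κ
    -- With β = κ + δ, the rate d β / (β + 1) exceeds d κ / k by d δ / (k (k + δ)), which is less
    -- than d δ. Since δ = 1 / v, this choice keeps the excess below 1 / (1 + q).
    v = d * suc q
    u = suc (κ * v)
    X = d * κ * suc q + suc κ
    D = suc κ * suc q

    1≤d : 1 ≤ d
    1≤d = ≤-trans (s≤s z≤n) 2≤d

    1≤v : 1 ≤ v
    1≤v = *-mono-≤ 1≤d (s≤s (z≤n {q}))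

    1≤X : 1 ≤ X
    1≤X = ≤-trans (s≤s z≤n) (m≤n+m (suc κ) (d * κ * suc q))

    v≤u : v ≤ u
    v≤u = ≤-trans (≤-trans (≤-reflexive (sym (*-identityˡ v))) (*-monoˡ-≤ v 1≤κ)) (n≤1+n (κ * v))

    rate : d * u * D < X * (u + 1 * v)
    rate = ≤-trans (m≤m+n _ (κ + (κ * κ + 2 * κ) * (d * suc q))) (≤-reflexive (eq d κ q))
      where
      eq : ∀ d κ q → suc (d * suc (κ * (d * suc q)) * (suc κ * suc q)) + (κ + (κ * κ + 2 * κ) * (d * suc q)) ≡
                     (d * κ * suc q + suc κ) * (suc (κ * (d * suc q)) + 1 * (d * suc q))
      eq = solve-∀

    module Coded (box : BoxCode d u v X D) (branching : BranchingCode κ v) where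

      b r s Δ t : ℕ
      L₁ L₂ : List (List ℕ)
      b  = proj₁ box
      r  = proj₁ (proj₂ box)
      L₁ = proj₁ (proj₂ (proj₂ box))
      s  = proj₁ branching
      Δ  = proj₁ (proj₂ branching)
      L₂ = proj₁ (proj₂ (proj₂ branching))
      t  = Δ + 2 * s

      1≤b : 1 ≤ b
      1≤b = proj₁ (proj₂ (proj₂ (proj₂ box)))

      module P = Functions d b r t Δ L₁ L₂
      K = Calls.K P.bodies

      prog : Program
      prog = program 14 P.bodies

      blocksFor : ∀ n → ∃[ h ] Blocks b n h × n ≤ h * b × h * b ≤ n + b
      blocksFor n = blocks b n 1≤b

      h ℓ m Y overall T : ℕ → ℕ
      h n = proj₁ (blocksFor n)
      ℓ n = h n * b
      m n = clauseCount (n * d) k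
      Y n = SearchCosts.Y d k (ℓ n) (m n) t Δ
      overall n = K * (3 + h n) * ((2 + b + suc (h n * r) * Y n) * X ^ b)
      T n = _/_ (overall n * X ^ n) (D ^ n) {{m^n≢0 D n}}

      h-poly : PolyBounded h
      h-poly = poly-≤ (λ n → ≤-trans (≤-trans (≤-reflexive (sym (*-identityʳ (h n)))) (*-monoʳ-≤ (h n) 1≤b)) (proj₂ (proj₂ (proj₂ (blocksFor n)))))
                      (poly-id ⊕ poly-const b)

      ℓ-poly : PolyBounded ℓ
      ℓ-poly = h-poly ⊗ poly-const b

      greedyCost-poly : PolyBounded (λ n → HelperCosts.greedyCost (ℓ n) d k (m n))
      greedyCost-poly = poly-clauseCount (poly-id ⊗ poly-const d) k ⊗
        (poly-const 3 ⊕ poly-const k ⊗ (poly-const 3 ⊕ ℓ-poly ⊕ poly-const d) ⊕ poly-const k ⊗ (poly-const 2 ⊕ ℓ-poly))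

      Y-poly : PolyBounded Y
      Y-poly = poly-const 2 ⊗ overhead ⊕ applyCost ⊕ (overhead ⊕ poly-const (2 ^ (t * suc k)) ⊗ (poly-suc fixStep ⊕ Q))
        where
        overhead  = poly-suc greedyCost-poly ⊕ poly-const (suc t + suc Δ)
        applyCost = poly-const 2 ⊕ poly-const t ⊗ (poly-const 2 ⊕ (poly-const k ⊕ (poly-const 2 ⊕ (ℓ-poly ⊕ ℓ-poly))))
        fixStep   = poly-const 5 ⊕ (ℓ-poly ⊕ (ℓ-poly ⊕ ℓ-poly))
        Q         = poly-const 2 ⊕ greedyCost-poly ⊕ poly-const k ⊗ (poly-const 5 ⊕ (ℓ-poly ⊕ ℓ-poly) ⊕ poly-const d)

      overall-poly : PolyBounded overall
      overall-poly = poly-const K ⊗ (poly-const 3 ⊕ h-poly) ⊗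
        ((poly-const (2 + b) ⊕ poly-suc (h-poly ⊗ poly-const r) ⊗ Y-poly) ⊗ poly-const (X ^ b))

      T∈O* : ∀ p .(c : Coprime (suc p) (suc q)) → T ∈O* (λ n → ((+ (d * κ)) ℚ./ suc κ ℚ.+ mkℚ +[1+ p ] q c) ℚ^.^ n)
      T∈O* p c = a , e , λ n → rate-bound {T n} {a * suc n ^ e} {X} {D} {g} {n} {{g≥0}} (s≤s z≤n) (rate≥ (d * κ) κ p q c)
          (≤-trans (m/n*n≤m (overall n * X ^ n) (D ^ n) {{m^n≢0 D n}}) (*-monoˡ-≤ (X ^ n) (bound n)))
        where
        a = proj₁ overall-poly
        e = proj₁ (proj₂ overall-poly)
        bound = proj₂ (proj₂ overall-poly)
        g = (+ (d * κ)) ℚ./ suc κ ℚ.+ mkℚ +[1+ p ] q c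
        g≥0 : ℚ.NonNegative g
        g≥0 = ℚ.nonNeg+nonNeg⇒nonNeg ((+ (d * κ)) ℚ./ suc κ) {{ℚ.normalize-nonNeg (d * κ) (suc κ)}} (mkℚ +[1+ p ] q c)

      module _ {n : ℕ} (F : CSP d k n) where

        H = proj₂ (blocksFor n)

        open Deciding n d κ (ℓ n) (m n) b r Δ s L₁ L₂ (raw F) (proj₁ (proj₂ H)) (raw-bounded F) (raw-range F) (raw-width F) (raw-length F)
          (Satisfiable F) (raw-model F (proj₁ (proj₂ H))) v 1≤v 1≤κ (proj₁ (proj₂ (proj₂ (proj₂ branching)))) 1≤d
          (proj₁ (proj₂ (proj₂ (proj₂ (proj₂ box))))) (proj₁ (proj₂ (proj₂ (proj₂ (proj₂ branching)))))
          (proj₂ (proj₂ (proj₂ (proj₂ (proj₂ branching)))))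
          using (Decides; decides; main; searchCost; searchCost-spec; genCost; 1≤M)

        cost≤T : ∀ {c} → c ≤ size P.mainBody + suc (genCost (searchCost (h n * r)) (h n)) * K → c ≤ T n
        cost≤T {c} c≤ = ≤-trans (≤-reflexive (sym (m*n/n≡m c (D ^ n) {{m^n≢0 D n}}))) (/-monoˡ-≤ (D ^ n) {{m^n≢0 D n}} (begin
          c * D ^ n                                        ≤⟨ *-monoˡ-≤ (D ^ n) c≤W ⟩
          K * (3 + h n) * W * D ^ n                        ≡⟨ *-assoc (K * (3 + h n)) W (D ^ n) ⟩
          K * (3 + h n) * (W * D ^ n)                      ≤⟨ *-monoʳ-≤ (K * (3 + h n)) W≤ ⟩
          K * (3 + h n) * (per-box * X ^ n)                ≡⟨ sym (*-assoc (K * (3 + h n)) per-box (X ^ n)) ⟩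
          overall n * X ^ n                                ∎))
          where
          open ≤-Reasoning
          S = searchCost (h n * r)
          W = length L₁ ^ h n * (2 + b + S)
          per-box = (2 + b + suc (h n * r) * Y n) * X ^ b
          1≤W : 1 ≤ W
          1≤W = *-mono-≤ {1} {length L₁ ^ h n} {1} {2 + b + S} (1≤^ (h n) 1≤M) (s≤s z≤n)
          W≤ : W * D ^ n ≤ per-box * X ^ n
          W≤ = box-search-cost (2 + b) {h n} {b} {r} {n} {length L₁} {S} {Y n} 1≤v v≤u 1≤X (s≤s z≤n) (proj₁ (proj₂ H)) (proj₂ (proj₂ H))
                 (proj₂ (proj₂ (proj₂ (proj₂ (proj₂ box))))) (searchCost-spec (h n * r))
          -- One `K` is for the main body, one for the call it makes, and h + 1 are for the levels
          -- of the enumeration; W ≥ 1 absorbs the first two.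
          factor : ∀ k h W → 1 ≤ W → k + suc (suc h * W) * k ≤ k * (3 + h) * W
          factor k h (suc w) _ = ≤-trans (m≤m+n _ (2 * k * w)) (≤-reflexive (eq k h w))
            where
            eq : ∀ k h w → k + suc (suc h * suc w) * k + 2 * k * w ≡ k * (3 + h) * suc w
            eq = solve-∀
          c≤W : c ≤ K * (3 + h n) * W
          c≤W = ≤-trans c≤ (≤-trans (+-monoˡ-≤ (suc (genCost S (h n)) * K) (Calls.size≤K P.bodies zero)) (factor K (h n) W 1≤W))

        decision : Decides ((encodeℕ n ∙ encodeClauses (raw F)) ∷ []) P.mainBody
                           (∃[ x ] length x ≡ ℓ n × All (_< d) x × SatAll x (raw F)) (suc (genCost (searchCost (h n * r)) (h n)))
        decision = main (h n) (proj₁ H) refl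

        open Decides decision using (answer; run; sound; complete)

        reflects : ∀ answer → (answer ≡ true → Satisfiable F) → (Satisfiable F → answer ≡ true) → Reflects (Satisfiable F) answer
        reflects true  sound complete = ofʸ (sound refl)
        reflects false sound complete = ofⁿ (λ sat → contradiction (complete sat) λ ())

        solved : ∃₂ λ answer t → Runs prog (encodeCSP F) (encodeBool answer) t × Reflects (Satisfiable F) answer × t ≤ T n
        solved = answer , Calls.Ev.cost run ,
          subst (λ e → Runs prog e (encodeBool answer) (Calls.Ev.cost run)) (sym (encodeCSP≡ F)) (Calls.Ev.run run) ,
          reflects answer sound (complete ∘ raw-complete F 1≤d (proj₁ (proj₂ H))) ,
          cost≤T (Calls.Ev.cost≤ run)

    open Coded (box-code d u v X D 2≤d (s≤s z≤n) rate) (branching-code κ v 1≤κ 1≤v) public using (prog; T; T∈O*; solved)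

open import Data.Integer using (+_; +[1+_]; -[1+_])
open import Data.Rational using (0ℚ; _<_; _+_; _/_; +-*-rawSemiring)
open import Algebra.Definitions.RawSemiring +-*-rawSemiring using (_^_)

corollary13 : (d k : ℕ) .{{_ : NonZero k}} → 2 ℕ.≤ d → 2 ℕ.≤ k →
    (ε : ℚ) → 0ℚ < ε →
    ∃₂ λ (P : Program) (T : ℕ → ℕ) →
    SolvesCSP d k P T ×
    T ∈O* (λ n → ((+ (d ℕ.* (k ℕ.∸ 1))) / k + ε) ^ n)
-- A positive ε = (1 + p) / (1 + q) is at least 1 / (1 + q), so the constants are built from q.
corollary13 d (ℕ.suc κ) 2≤d (ℕ.s≤s 1≤κ) (mkℚ +[1+ p ] q c) _ = prog , T , solved , T∈O* p c
  where open Complexity.Assembly d κ q 2≤d 1≤κ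
corollary13 d k _ _ (mkℚ (+ 0) q c) 0<ε = contradiction (ℚ.positive 0<ε) λ ()
corollary13 d k _ _ (mkℚ -[1+ p ] q c) 0<ε = contradiction (ℚ.positive 0<ε) λ ()
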